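{- Consider the set of all mesh patterns of length $2$, i.e. all pairs $(\tau,R)$ with $\tau\in S_2=\{12,21\}$ and $R\subseteq\{0,1,2\}\times\{0,1,2\}$. The number of Wilf-equivalence classes of this set is at most $49$.
   Context: A mesh pattern of length $2$ is a pair $(\tau,R)$ with $\tau\in S_2$ and $R\subseteq\{0,1,2\}^2$; the element $(a,b)\in R$ is called a shaded box. For $\pi=\pi_1\cdots\pi_n\in S_n$, an occurrence of $(\tau,R)$ in $\pi$ is a pair of positions $i_1<i_2$ such that $\pi_{i_1}\pi_{i_2}$ is order-isomorphic to $\tau$ and, setting $x_0=0,\ x_1=i_1,\ x_2=i_2,\ x_3=n+1$ and $y_0=0,\ y_1=\min(\pi_{i_1},\pi_{i_2}),\ y_2=\max(\pi_{i_1},\pi_{i_2}),\ y_3=n+1$, for every $(a,b)\in R$ there is no index $k$ with $x_a<k<x_{a+1}$ and $y_b<\pi_k<y_{b+1}$. A permutation avoids $p$ if it has no occurrence of $p$; $s_n(p)$ denotes the number of permutations in $S_n$ avoiding $p$. Two patterns $p_1,p_2$ are Wilf-equivalent if $s_n(p_1)=s_n(p_2)$ for all $n\ge 0$. -}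

module Defs where

open import Data.Nat using (ℕ; zero; suc; _≡ᵇ_; _<ᵇ_)
open import Data.Bool using (Bool; true; false; _∧_; not; if_then_else_)
open import Data.List using (List; []; _∷_; [_]; map; upTo; concatMap; all; any; filterᵇ; length)
open import Data.Fin using (Fin; zero; suc)
open import Data.Product using (_×_; _,_; proj₁; proj₂)
open import Relation.Binary.PropositionalEquality using (_≡_)

data S₂ : Set where
  p12 p21 : S₂

-- A shading R ⊆ {0,1,2}², as its characteristic function: R a b = true iff (a,b) ∈ R.
Shading : Set
Shading = Fin 3 → Fin 3 → Bool

MeshPattern : Set
MeshPattern = S₂ × Shading

-- A permutation π = π₁⋯πₙ ∈ Sₙ is represented by its one-line notation, the list [π₁,…,πₙ].

-- π at (1-based) position k; 0 if k is out of range.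
val : List ℕ → ℕ → ℕ
val [] _ = 0
val (x ∷ xs) zero = 0
val (x ∷ xs) (suc zero) = x
val (x ∷ xs) (suc (suc k)) = val xs (suc k)

upto1 : ℕ → List ℕ
upto1 n = map suc (upTo n)

words : ℕ → ℕ → List (List ℕ)
words zero n = [ [] ]
words (suc k) n = concatMap (λ w → map (λ v → v ∷ w) (upto1 n)) (words k n)

-- a word of length n over {1,…,n} is a permutation iff every value 1,…,n occurs in it
isPermᵇ : ℕ → List ℕ → Bool
isPermᵇ n w = all (λ v → any (λ x → v ≡ᵇ x) w) (upto1 n)

S : ℕ → List (List ℕ)
S n = filterᵇ (isPermᵇ n) (words n n)

-- x₀ < x₁ < x₂ < x₃ (resp. y₀ ≤ y₁ < y₂ ≤ y₃) given the two entries
bound : ℕ → ℕ → ℕ → Fin 4 → ℕ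
bound n u v zero = 0
bound n u v (suc zero) = u
bound n u v (suc (suc zero)) = v
bound n u v (suc (suc (suc zero))) = suc n

inj : Fin 3 → Fin 4
inj zero = zero
inj (suc zero) = suc zero
inj (suc (suc zero)) = suc (suc zero)

nxt : Fin 3 → Fin 4
nxt a = suc a

between : ℕ → ℕ → ℕ → Bool
between a k b = (a <ᵇ k) ∧ (k <ᵇ b)

min max : ℕ → ℕ → ℕ
min u v = if u <ᵇ v then u else v
max u v = if u <ᵇ v then v else u

orderIsoᵇ : S₂ → ℕ → ℕ → Bool
orderIsoᵇ p12 u v = u <ᵇ v
orderIsoᵇ p21 u v = v <ᵇ u

boxEmptyᵇ : List ℕ → ℕ → ℕ → ℕ → Fin 3 → Fin 3 → Bool
boxEmptyᵇ π i₁ i₂ n a b =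
  all (λ k → not (between (bound n i₁ i₂ (inj a)) k (bound n i₁ i₂ (nxt a))
                  ∧ between (bound n y₁ y₂ (inj b)) (val π k) (bound n y₁ y₂ (nxt b))))
      (upto1 n)
  where
  y₁ = min (val π i₁) (val π i₂)
  y₂ = max (val π i₁) (val π i₂)

allFin3 : List (Fin 3)
allFin3 = zero ∷ suc zero ∷ suc (suc zero) ∷ []

occurrenceᵇ : MeshPattern → ℕ → List ℕ → ℕ → ℕ → Bool
occurrenceᵇ (τ , R) n π i₁ i₂ =
  (i₁ <ᵇ i₂) ∧ orderIsoᵇ τ (val π i₁) (val π i₂)
  ∧ all (λ a → all (λ b → if R a b then boxEmptyᵇ π i₁ i₂ n a b else true) allFin3) allFin3

containsᵇ : MeshPattern → ℕ → List ℕ → Bool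
containsᵇ p n π = any (λ i₁ → any (λ i₂ → occurrenceᵇ p n π i₁ i₂) (upto1 n)) (upto1 n)

avoidsᵇ : MeshPattern → ℕ → List ℕ → Bool
avoidsᵇ p n π = not (containsᵇ p n π)

s : ℕ → MeshPattern → ℕ
s n p = length (filterᵇ (avoidsᵇ p n) (S n))

WilfEquivalent : MeshPattern → MeshPattern → Set
WilfEquivalent p q = (n : ℕ) → s n p ≡ s n q

{-# OPTIONS --safe #-}

-- The reverse, rotation by 180 degrees and inverse of a permutation, the shading lemma, and the bijections that
-- reverse the entries after the first entry or after the entry 1 give most of the equivalences.  The patterns that
-- remain come in pairs which differ by exchanging two rows.  Reading a permutation from left to right, one can mirror
-- the entries above the current left-to-right minimum if column 0 plays no role.  Otherwise permutations are built
-- by prepending relative ranks: an occurrence may be destroyed by later entries, but the ranks destroying it are nested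
-- for the different occurrences, so only the innermost one matters, and the number of avoiders is determined by a
-- state recording a few sizes, which evolves in the same way for both patterns.  A finite computation then checks that
-- these equivalences join the 512 shadings of the pattern 12 into 49 classes.

module Submission where

open import Defs
open import Data.Nat using (ℕ; zero; suc; _+_; _*_; _∸_; _^_; _⊓_; _⊔_; _≤_; _<_; z≤n; s≤s; pred; _≤?_; _<?_; _≟_; _<ᵇ_; _≡ᵇ_)
open import Data.Nat.Properties
open import Data.Nat.ListAction using (sum)
open import Data.Nat.ListAction.Properties using (sum-++; sum-↭)
open import Data.Bool using (Bool; true; false; _∧_; _∨_; not; if_then_else_; T; T?)
open import Data.Bool.Properties using (¬-not; ∧-zeroʳ)
open import Data.List using (List; []; _∷_; [_]; _++_; map; length; reverse; upTo; applyUpTo; concatMap; all; any; filterᵇ; cartesianProductWith)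
open import Data.List.Properties using (length-map; length-upTo; map-∘; map-++; length-++; ++-assoc; reverse-involutive; reverse-++; unfold-reverse; ∷-injective; map-injective; map-upTo)
open import Data.List.Membership.Propositional using (_∈_; _∉_; find; lose)
open import Data.List.Membership.Propositional.Properties
open import Data.List.Relation.Unary.Any as Any using (Any; here; there)
open import Data.List.Relation.Unary.All as All using (All; []; _∷_)
import Data.List.Relation.Unary.All.Properties as All
open import Data.List.Relation.Unary.AllPairs using ([]; _∷_)
open import Data.List.Relation.Unary.Unique.Propositional using (Unique)
import Data.List.Relation.Unary.Unique.Propositional.Properties as Unique
open import Data.List.Relation.Binary.Subset.Propositional using (_⊆_)
open import Data.List.Relation.Binary.Permutation.Propositional using (_↭_; ↭-refl; ↭-sym; ↭-trans; ↭-prep; ↭⇒↭ₛ)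
import Data.List.Relation.Binary.Permutation.Propositional.Properties as ↭
open import Data.Fin using (Fin; zero; suc)
open import Data.Fin.Patterns using (1F; 2F)
open import Data.Product using (Σ; ∃-syntax; _×_; _,_; proj₁; proj₂; swap)
open import Data.Sum using (_⊎_; inj₁; inj₂; [_,_]′)
open import Data.Empty using (⊥; ⊥-elim)
open import Data.Unit using (tt)
open import Function using (_∘_; id)
open import Relation.Nullary using (¬_; Dec; yes; no; contradiction)
open import Relation.Binary.PropositionalEquality using (_≡_; _≢_; refl; sym; trans; cong; cong₂; subst; subst₂; setoid; module ≡-Reasoning)
import Data.List.Relation.Binary.Permutation.Setoid.Properties as PermS
open import Relation.Binary.Definitions using (tri<; tri≈; tri>)
open import Relation.Nullary.Decidable using (⌊_⌋; ¬?; _×-dec_)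
open import Data.Fin.Properties using () renaming (_≟_ to _≟ᶠ_)
open import Data.Maybe using (Maybe; just; nothing; is-nothing)
open import Data.Nat.DivMod using (_/_; _%_)
open import Data.Vec using (Vec; []; _∷_)

-- Permutations as lists

-- Exchanging two rows of a shading is not a symmetry of the square, and for such pairs no explicit
-- bijection between the avoiders is built. Counting succeeds for the pairs treated by prepending
-- because a prepended entry stands in column 0 of every occurrence already present and can itself
-- only be the first point of a new one. Hence it acts in two ways only: it destroys the old
-- occurrences whose box in column 0 containing it is shaded, and it creates occurrences that start
-- with it. For these pairs the creating ranks, and the ranks destroying the decisive occurrence,
-- form intervals. Exchanging the rows moves or reverses these intervals but keeps their sizes, and
-- a sum over all ranks does not see the difference. An upper bound on the number of classes asks
-- only for enough equivalences; patterns listed in different classes are never compared.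

subset↭ : ∀ {A : Set} {xs ys : List A} → Unique xs → xs ⊆ ys → length ys ≤ length xs → xs ↭ ys
subset↭ {ys = []} [] _ _ = ↭-refl
subset↭ {xs = x ∷ xs} {ys} (x∉ ∷ u) sub le with ∈-∃++ (sub (here refl))
... | as , bs , refl = ↭-trans (↭-prep x (subset↭ u sub′ le′)) (↭-sym (↭.shift x as bs))
  where
  sub′ : xs ⊆ as ++ bs
  sub′ {z} z∈ with ∈-++⁻ as (sub (there z∈))
  ... | inj₁ p = ∈-++⁺ˡ p
  ... | inj₂ (here refl) = ⊥-elim (All.lookup x∉ z∈ refl)
  ... | inj₂ (there p) = ∈-++⁺ʳ as p
  le′ : length (as ++ bs) ≤ length xs
  le′ = ≤-pred (subst (_≤ suc (length xs)) (↭.↭-length (↭.shift x as bs)) le)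

Unique-resp-↭ : ∀ {A : Set} {xs ys : List A} → xs ↭ ys → Unique xs → Unique ys
Unique-resp-↭ {A} = PermS.Unique-resp-↭ (setoid A) ∘ ↭⇒↭ₛ

InRange : ℕ → ℕ → Set
InRange n v = 1 ≤ v × v ≤ n

∈-upto1⁺ : ∀ {n v} → InRange n v → v ∈ upto1 n
∈-upto1⁺ {n} {suc v} (_ , le) = ∈-map⁺ suc (∈-upTo⁺ le)

∈-upto1⁻ : ∀ {n v} → v ∈ upto1 n → InRange n v
∈-upto1⁻ p with ∈-map⁻ suc p
... | u , q , refl = s≤s z≤n , ∈-upTo⁻ q

upto1-unique : ∀ n → Unique (upto1 n)
upto1-unique n = Unique.map⁺ suc-injective (Unique.upTo⁺ n)

length-upto1 : ∀ n → length (upto1 n) ≡ n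
length-upto1 n = trans (length-map suc (upTo n)) (length-upTo n)

record IsPerm (n : ℕ) (w : List ℕ) : Set where
  constructor isPerm
  field
    len  : length w ≡ n
    bnd  : All (InRange n) w
    uniq : Unique w

  w⊆upto1 : w ⊆ upto1 n
  w⊆upto1 v∈ = ∈-upto1⁺ (All.lookup bnd v∈)

  ↭upto1 : w ↭ upto1 n
  ↭upto1 = subset↭ uniq w⊆upto1 (≤-reflexive (trans (length-upto1 n) (sym len)))

  occurs : ∀ {v} → InRange n v → v ∈ w
  occurs r = ↭.∈-resp-↭ (↭-sym ↭upto1) (∈-upto1⁺ r)

open IsPerm public

↭upto1⇒IsPerm : ∀ {n w} → w ↭ upto1 n → IsPerm n w
↭upto1⇒IsPerm {n} p = isPerm (trans (↭.↭-length p) (length-upto1 n))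
  (All.tabulate (λ v∈ → ∈-upto1⁻ (↭.∈-resp-↭ p v∈))) (Unique-resp-↭ (↭-sym p) (upto1-unique n))

-- Boolean tests and the enumeration of permutations

T⇒≡ : ∀ {b} → T b → b ≡ true
T⇒≡ {true} _ = refl

≡⇒T : ∀ {b} → b ≡ true → T b
≡⇒T refl = tt

∧-true : ∀ {a b} → a ∧ b ≡ true → a ≡ true × b ≡ true
∧-true {true} {true} refl = refl , refl

not-true⁻ : ∀ {b} → not b ≡ true → b ≡ false
not-true⁻ {false} _ = refl

true≢false : true ≢ false
true≢false ()

all-true⁺ : ∀ {A : Set} (f : A → Bool) xs → (∀ {x} → x ∈ xs → f x ≡ true) → all f xs ≡ true
all-true⁺ f [] h = refl
all-true⁺ f (x ∷ xs) h rewrite h (here refl) = all-true⁺ f xs (h ∘ there)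

all-true⁻ : ∀ {A : Set} (f : A → Bool) xs → all f xs ≡ true → ∀ {x} → x ∈ xs → f x ≡ true
all-true⁻ f (x ∷ xs) e (here refl) = proj₁ (∧-true e)
all-true⁻ f (x ∷ xs) e (there p) = all-true⁻ f xs (proj₂ (∧-true {f x} e)) p

any-true⁺ : ∀ {A : Set} (f : A → Bool) {x} xs → x ∈ xs → f x ≡ true → any f xs ≡ true
any-true⁺ f (x ∷ xs) (here refl) e rewrite e = refl
any-true⁺ f (x ∷ xs) (there p) e with f x
... | true = refl
... | false = any-true⁺ f xs p e

any-true⁻ : ∀ {A : Set} (f : A → Bool) xs → any f xs ≡ true → ∃[ x ] x ∈ xs × f x ≡ true
any-true⁻ f (x ∷ xs) e with f x in eq
... | true = x , here refl , eq
... | false with any-true⁻ f xs e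
...   | y , p , q = y , there p , q

isPermᵇ⁻ : ∀ n w → isPermᵇ n w ≡ true → ∀ {v} → InRange n v → v ∈ w
isPermᵇ⁻ n w e {v} r with any-true⁻ (v ≡ᵇ_) w (all-true⁻ _ (upto1 n) e (∈-upto1⁺ r))
... | x , p , q = subst (_∈ w) (sym (≡ᵇ⇒≡ v x (≡⇒T q))) p

isPermᵇ⁺ : ∀ n w → (∀ {v} → InRange n v → v ∈ w) → isPermᵇ n w ≡ true
isPermᵇ⁺ n w h = all-true⁺ _ (upto1 n) λ {v} p →
  any-true⁺ (v ≡ᵇ_) w (h (∈-upto1⁻ p)) (T⇒≡ (≡⇒≡ᵇ v v refl))

∈-words⁺ : ∀ k n {w} → length w ≡ k → All (InRange n) w → w ∈ words k n
∈-words⁺ zero n {[]} _ _ = here refl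
∈-words⁺ (suc k) n {x ∷ w} e (r ∷ rs) =
  ∈-concatMap⁺ _ (lose (∈-words⁺ k n (suc-injective e) rs) (∈-map⁺ (_∷ w) (∈-upto1⁺ r)))

∈-words⁻ : ∀ k n {w} → w ∈ words k n → length w ≡ k × All (InRange n) w
∈-words⁻ zero n (here refl) = refl , []
∈-words⁻ (suc k) n p with find (∈-concatMap⁻ _ {xs = words k n} p)
... | w , w∈ , q with ∈-map⁻ _ q | ∈-words⁻ k n w∈
... | v , v∈ , refl | l , b = cong suc l , ∈-upto1⁻ v∈ ∷ b

words-unique : ∀ k n → Unique (words k n)
words-unique zero n = [] ∷ []
words-unique (suc k) n = subst Unique (same (words k n))
  (Unique.cartesianProductWith⁺ (λ w v → v ∷ w) inj′ (words-unique k n) (upto1-unique n))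
  where
  inj′ : ∀ {w x : List ℕ} {y z : ℕ} → y ∷ w ≡ z ∷ x → w ≡ x × y ≡ z
  inj′ refl = refl , refl
  same : ∀ ws → cartesianProductWith (λ w v → v ∷ w) ws (upto1 n) ≡ concatMap (λ w → map (_∷ w) (upto1 n)) ws
  same [] = refl
  same (w ∷ ws) = cong (map (_∷ w) (upto1 n) ++_) (same ws)

∈-filterᵇ⁺ : ∀ {A : Set} (f : A → Bool) {x xs} → x ∈ xs → f x ≡ true → x ∈ filterᵇ f xs
∈-filterᵇ⁺ f p e = ∈-filter⁺ (T? ∘ f) p (≡⇒T e)

∈-filterᵇ⁻ : ∀ {A : Set} (f : A → Bool) {x xs} → x ∈ filterᵇ f xs → x ∈ xs × f x ≡ true
∈-filterᵇ⁻ f p with ∈-filter⁻ (T? ∘ f) p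
... | q , t = q , T⇒≡ t

filterᵇ-unique : ∀ {A : Set} (f : A → Bool) {xs} → Unique xs → Unique (filterᵇ f xs)
filterᵇ-unique f = Unique.filter⁺ (T? ∘ f)

S-unique : ∀ n → Unique (S n)
S-unique n = filterᵇ-unique _ (words-unique n n)

∈S⇒IsPerm : ∀ {n w} → w ∈ S n → IsPerm n w
∈S⇒IsPerm {n} {w} p with ∈-filterᵇ⁻ (isPermᵇ n) p
... | q , e with ∈-words⁻ n n q
... | l , b = ↭upto1⇒IsPerm (↭-sym (subset↭ (upto1-unique n)
  (λ v∈ → isPermᵇ⁻ n w e (∈-upto1⁻ v∈))
  (≤-reflexive (trans l (sym (length-upto1 n))))))

IsPerm⇒∈S : ∀ {n w} → IsPerm n w → w ∈ S n
IsPerm⇒∈S {n} {w} P = ∈-filterᵇ⁺ (isPermᵇ n) (∈-words⁺ n n (len P) (bnd P))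
  (isPermᵇ⁺ n w (occurs P))

inj-length : ∀ {A B : Set} (φ : A → B) {xs : List A} {ys : List B} → Unique xs →
  (∀ {x} → x ∈ xs → φ x ∈ ys) → (∀ {x y} → x ∈ xs → y ∈ xs → φ x ≡ φ y → x ≡ y) → length xs ≤ length ys
inj-length φ [] _ _ = z≤n
inj-length φ {x ∷ xs} {ys} (x∉ ∷ u) sub inj′ with ∈-∃++ (sub (here refl))
... | as , bs , refl = ≤-trans (s≤s (inj-length φ {ys = as ++ bs} u sub′ λ p q → inj′ (there p) (there q)))
    (≤-reflexive (sym (↭.↭-length (↭.shift (φ x) as bs))))
  where
  sub′ : ∀ {z} → z ∈ xs → φ z ∈ as ++ bs
  sub′ {z} z∈ with ∈-++⁻ as (sub (there z∈))
  ... | inj₁ p = ∈-++⁺ˡ p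
  ... | inj₂ (here e) = ⊥-elim (All.lookup x∉ z∈ (inj′ (here refl) (there z∈) (sym e)))
  ... | inj₂ (there p) = ∈-++⁺ʳ as p

unique-same-↭ : ∀ {A : Set} {xs ys : List A} → Unique xs → Unique ys → xs ⊆ ys → ys ⊆ xs → xs ↭ ys
unique-same-↭ u v p q = subset↭ u p (inj-length id v q (λ _ _ e → e))

-- Occurrences

-- Ties go upwards: `t = u` falls into strip 1 and `t = v` into strip 2. `Head` relies on this,
-- where `u` is a gap and the entry equal to `u` lies just above it.
zone : ℕ → ℕ → ℕ → Fin 3
zone u v t = if t <ᵇ u then zero else (if t <ᵇ v then 1F else 2F)

<ᵇ-true : ∀ {m n} → m < n → (m <ᵇ n) ≡ true
<ᵇ-true lt = T⇒≡ (<⇒<ᵇ lt)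

<ᵇ-true⁻ : ∀ {m n} → (m <ᵇ n) ≡ true → m < n
<ᵇ-true⁻ {m} {n} e = <ᵇ⇒< m n (≡⇒T e)

<ᵇ-false : ∀ {m n} → n ≤ m → (m <ᵇ n) ≡ false
<ᵇ-false {m} {n} le with m <ᵇ n in eq
... | false = refl
... | true = ⊥-elim (<⇒≱ (<ᵇ-true⁻ eq) le)

zone-below : ∀ {u v t} → t < u → zone u v t ≡ zero
zone-below lt rewrite <ᵇ-true lt = refl

zone-middle : ∀ {u v t} → u ≤ t → t < v → zone u v t ≡ 1F
zone-middle le lt rewrite <ᵇ-false le | <ᵇ-true lt = refl

zone-above : ∀ {u v t} → u ≤ v → v ≤ t → zone u v t ≡ 2F
zone-above uv le rewrite <ᵇ-false (≤-trans uv le) | <ᵇ-false le = refl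

∧-true⁺ : ∀ {a b} → a ≡ true → b ≡ true → a ∧ b ≡ true
∧-true⁺ refl refl = refl

data ZoneView (u v t : ℕ) : Set where
  below  : t < u → zone u v t ≡ zero → ZoneView u v t
  middle : u < t → t < v → zone u v t ≡ 1F → ZoneView u v t
  above  : v < t → zone u v t ≡ 2F → ZoneView u v t

zoneView : ∀ {u v t} → u < v → t ≢ u → t ≢ v → ZoneView u v t
zoneView {u} {v} {t} uv t≢u t≢v with <-cmp t u
... | tri< lt _ _ = below lt (zone-below {u} {v} lt)
... | tri≈ _ e _ = ⊥-elim (t≢u e)
... | tri> _ _ gt with <-cmp t v
...   | tri< lt _ _ = middle gt lt (zone-middle (<⇒≤ gt) lt)
...   | tri≈ _ e _ = ⊥-elim (t≢v e)
...   | tri> _ _ gt′ = above gt′ (zone-above (<⇒≤ uv) (<⇒≤ gt′))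

between⁻ : ∀ {a k b} → between a k b ≡ true → a < k × k < b
between⁻ {a} {k} {b} e with ∧-true {a <ᵇ k} {k <ᵇ b} e
... | p , q = <ᵇ-true⁻ {a} p , <ᵇ-true⁻ {k} q

between⁺ : ∀ {a k b} → a < k → k < b → between a k b ≡ true
between⁺ p q rewrite <ᵇ-true p | <ᵇ-true q = refl

cell : ℕ → ℕ → ℕ → Fin 3 → ℕ → Bool
cell n u v a k = between (bound n u v (inj a)) k (bound n u v (nxt a))

cell⁻ : ∀ n {u v} → u < v → ∀ a {k} → cell n u v a k ≡ true → zone u v k ≡ a × k ≢ u × k ≢ v
cell⁻ n {u} {v} uv zero {k} e with between⁻ {0} {k} {u} e
... | _ , lt = zone-below {v = v} lt , <⇒≢ lt , <⇒≢ (<-trans lt uv)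
cell⁻ n {u} {v} uv 1F {k} e with between⁻ {u} {k} {v} e
... | gt , lt = zone-middle (<⇒≤ gt) lt , >⇒≢ gt , <⇒≢ lt
cell⁻ n {u} {v} uv 2F {k} e with between⁻ {v} {k} {suc n} e
... | gt , _ = zone-above (<⇒≤ uv) (<⇒≤ gt) , >⇒≢ (<-trans uv gt) , >⇒≢ gt

cell⁺ : ∀ {n u v k} → u < v → InRange n k → k ≢ u → k ≢ v → cell n u v (zone u v k) k ≡ true
cell⁺ uv (k≥1 , k≤n) ku kv with zoneView uv ku kv
... | below lt e rewrite e = between⁺ k≥1 lt
... | middle gt lt e rewrite e = between⁺ gt lt
... | above gt e rewrite e = between⁺ gt (s≤s k≤n)

-- The quantifier over shaded boxes is replaced by one over entries: each entry other than the two
-- pattern points lies in exactly one box, and that box has to be unshaded. In this form one can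
-- follow an entry while a pattern point or the permutation changes.
Clear : Shading → ℕ → (ℕ → ℕ) → ℕ → ℕ → ℕ → ℕ → Set
Clear R n f i j y₁ y₂ = ∀ {k} → InRange n k → k ≢ i → k ≢ j → R (zone i j k) (zone y₁ y₂ (f k)) ≡ false

record PermFun (n : ℕ) (f : ℕ → ℕ) : Set where
  constructor permFun
  field
    range : ∀ {k} → InRange n k → InRange n (f k)
    injective : ∀ {k l} → InRange n k → InRange n l → f k ≡ f l → k ≡ l

open PermFun public

∈-allFin3 : ∀ a → a ∈ allFin3
∈-allFin3 zero = here refl
∈-allFin3 1F = there (here refl)
∈-allFin3 2F = there (there (here refl))

boxesᵇ : Shading → ℕ → List ℕ → ℕ → ℕ → Bool
boxesᵇ R n π i j = all (λ a → all (λ b → if R a b then boxEmptyᵇ π i j n a b else true) allFin3) allFin3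

boxes⁺ : ∀ R n π {i j y₁ y₂} → i < j → y₁ < y₂ →
  min (val π i) (val π j) ≡ y₁ → max (val π i) (val π j) ≡ y₂ →
  Clear R n (val π) i j y₁ y₂ → boxesᵇ R n π i j ≡ true
boxes⁺ R n π {i} {j} ij y₁<y₂ refl refl cl = all-true⁺ _ allFin3 λ {a} _ → all-true⁺ _ allFin3 λ {b} _ → box a b
  where
  box : ∀ a b → (if R a b then boxEmptyᵇ π i j n a b else true) ≡ true
  box a b with R a b in eq
  ... | false = refl
  ... | true = all-true⁺ _ (upto1 n) λ {k} k∈ → point k (∈-upto1⁻ k∈)
    where
    point : ∀ k → InRange n k →
      not (cell n i j a k ∧ cell n (min (val π i) (val π j)) (max (val π i) (val π j)) b (val π k)) ≡ true
    point k r with cell n i j a k in e₁ | cell n (min (val π i) (val π j)) (max (val π i) (val π j)) b (val π k) in e₂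
    ... | false | _ = refl
    ... | true | false = refl
    ... | true | true with cell⁻ n ij a e₁ | cell⁻ n y₁<y₂ b e₂
    ...   | refl , k≢i , k≢j | refl , _ = trans (sym (cl r k≢i k≢j)) eq

-- The hypothesis `off` lets 12 and 21 share the proof: `y₁` and `y₂` are the two chosen values in
-- one order or the other, and any other entry avoids both, hence lies inside a box and not on a
-- grid line.
boxes⁻ : ∀ R n π {i j y₁ y₂} → PermFun n (val π) → InRange n i → InRange n j → i < j → y₁ < y₂ →
  min (val π i) (val π j) ≡ y₁ → max (val π i) (val π j) ≡ y₂ →
  (∀ y → y ≢ val π i → y ≢ val π j → y ≢ y₁ × y ≢ y₂) →
  boxesᵇ R n π i j ≡ true → Clear R n (val π) i j y₁ y₂
boxes⁻ R n π {i} {j} P ri rj ij y₁<y₂ refl refl off e {k} r k≢i k≢j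
  with R (zone i j k) (zone (min (val π i) (val π j)) (max (val π i) (val π j)) (val π k)) in eq
... | false = refl
... | true = ⊥-elim (contra box)
  where
  a = zone i j k
  b = zone (min (val π i) (val π j)) (max (val π i) (val π j)) (val π k)
  box₀ : (if R a b then boxEmptyᵇ π i j n a b else true) ≡ true
  box₀ = all-true⁻ (λ b → if R a b then boxEmptyᵇ π i j n a b else true) allFin3
    (all-true⁻ (λ a → all (λ b → if R a b then boxEmptyᵇ π i j n a b else true) allFin3) allFin3 e (∈-allFin3 a)) (∈-allFin3 b)
  box : boxEmptyᵇ π i j n a b ≡ true
  box = trans (sym (cong (λ z → if z then boxEmptyᵇ π i j n a b else true) eq)) box₀
  away = off (val π k) (λ q → k≢i (injective P r ri q)) (λ q → k≢j (injective P r rj q))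
  contra : boxEmptyᵇ π i j n a b ≡ true → ⊥
  contra h with all-true⁻ _ (upto1 n) h (∈-upto1⁺ r)
  ... | h′ rewrite cell⁺ ij r k≢i k≢j | cell⁺ y₁<y₂ (range P r) (proj₁ away) (proj₂ away) with h′
  ... | ()

record Occ₁₂ (R : Shading) (n : ℕ) (f : ℕ → ℕ) : Set where
  constructor occ₁₂
  field
    {i j} : ℕ
    ri    : InRange n i
    rj    : InRange n j
    i<j   : i < j
    fi<fj : f i < f j
    clear : Clear R n f i j (f i) (f j)

record Occ₂₁ (R : Shading) (n : ℕ) (f : ℕ → ℕ) : Set where
  constructor occ₂₁
  field
    {i j} : ℕ
    ri    : InRange n i
    rj    : InRange n j
    i<j   : i < j
    fj<fi : f j < f i
    clear : Clear R n f i j (f j) (f i)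

contains₁₂⁺ : ∀ {R n π} → Occ₁₂ R n (val π) → containsᵇ (p12 , R) n π ≡ true
contains₁₂⁺ {R} {n} {π} (occ₁₂ {i} {j} ri rj i<j lt cl) =
  any-true⁺ _ (upto1 n) (∈-upto1⁺ ri) (any-true⁺ _ (upto1 n) (∈-upto1⁺ rj) occ)
  where
  occ : occurrenceᵇ (p12 , R) n π i j ≡ true
  occ = ∧-true⁺ (<ᵇ-true i<j) (∧-true⁺ (<ᵇ-true lt) (boxes⁺ R n π i<j lt
    (cong (λ b → if b then val π i else val π j) (<ᵇ-true lt))
    (cong (λ b → if b then val π j else val π i) (<ᵇ-true lt)) cl))

contains₁₂⁻ : ∀ {R n π} → PermFun n (val π) → containsᵇ (p12 , R) n π ≡ true → Occ₁₂ R n (val π)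
contains₁₂⁻ {R} {n} {π} P e with any-true⁻ _ (upto1 n) e
... | i , i∈ , e₁ with any-true⁻ _ (upto1 n) e₁
... | j , j∈ , e₂ with ∧-true {i <ᵇ j} e₂
... | e₃ , e₄ with ∧-true {val π i <ᵇ val π j} e₄
... | e₅ , e₆ = occ₁₂ (∈-upto1⁻ i∈) (∈-upto1⁻ j∈) (<ᵇ-true⁻ e₃) lt
  (boxes⁻ R n π P (∈-upto1⁻ i∈) (∈-upto1⁻ j∈) (<ᵇ-true⁻ e₃) lt
    (cong (λ b → if b then val π i else val π j) (<ᵇ-true lt))
    (cong (λ b → if b then val π j else val π i) (<ᵇ-true lt)) (λ y p q → p , q) e₆)
  where
  lt = <ᵇ-true⁻ e₅

contains₂₁⁺ : ∀ {R n π} → Occ₂₁ R n (val π) → containsᵇ (p21 , R) n π ≡ true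
contains₂₁⁺ {R} {n} {π} (occ₂₁ {i} {j} ri rj i<j lt cl) =
  any-true⁺ _ (upto1 n) (∈-upto1⁺ ri) (any-true⁺ _ (upto1 n) (∈-upto1⁺ rj) occ)
  where
  occ : occurrenceᵇ (p21 , R) n π i j ≡ true
  occ = ∧-true⁺ (<ᵇ-true i<j) (∧-true⁺ (<ᵇ-true lt) (boxes⁺ R n π i<j lt
    (cong (λ b → if b then val π i else val π j) (<ᵇ-false (<⇒≤ lt)))
    (cong (λ b → if b then val π j else val π i) (<ᵇ-false (<⇒≤ lt))) cl))

contains₂₁⁻ : ∀ {R n π} → PermFun n (val π) → containsᵇ (p21 , R) n π ≡ true → Occ₂₁ R n (val π)
contains₂₁⁻ {R} {n} {π} P e with any-true⁻ _ (upto1 n) e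
... | i , i∈ , e₁ with any-true⁻ _ (upto1 n) e₁
... | j , j∈ , e₂ with ∧-true {i <ᵇ j} e₂
... | e₃ , e₄ with ∧-true {val π j <ᵇ val π i} e₄
... | e₅ , e₆ = occ₂₁ (∈-upto1⁻ i∈) (∈-upto1⁻ j∈) (<ᵇ-true⁻ e₃) lt
  (boxes⁻ R n π P (∈-upto1⁻ i∈) (∈-upto1⁻ j∈) (<ᵇ-true⁻ e₃) lt
    (cong (λ b → if b then val π i else val π j) (<ᵇ-false (<⇒≤ lt)))
    (cong (λ b → if b then val π j else val π i) (<ᵇ-false (<⇒≤ lt))) (λ y p q → q , p) e₆)
  where
  lt = <ᵇ-true⁻ e₅

-- From positions to decompositions of the list

val-∈ : ∀ w {k} → InRange (length w) k → val w k ∈ w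
val-∈ [] (k≥1 , k≤0) = ⊥-elim (<⇒≱ k≥1 k≤0)
val-∈ (x ∷ w) {suc zero} _ = here refl
val-∈ (x ∷ w) {suc (suc k)} (_ , s≤s le) = there (val-∈ w (s≤s z≤n , le))

∈-val : ∀ {w e} → e ∈ w → ∃[ k ] InRange (length w) k × val w k ≡ e
∈-val (here refl) = 1 , (≤-refl , s≤s z≤n) , refl
∈-val (there p) with ∈-val p
... | suc k , (_ , le) , e = suc (suc k) , (s≤s z≤n , s≤s le) , e

val-++ˡ : ∀ X {r k} → k ≤ length X → val (X ++ r) k ≡ val X k
val-++ˡ [] {[]} z≤n = refl
val-++ˡ [] {x ∷ r} z≤n = refl
val-++ˡ (x ∷ X) {k = zero} _ = refl
val-++ˡ (x ∷ X) {k = suc zero} _ = refl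
val-++ˡ (x ∷ X) {k = suc (suc k)} (s≤s le) = val-++ˡ X le

val-++ʳ : ∀ X {r k} → 1 ≤ k → val (X ++ r) (length X + k) ≡ val r k
val-++ʳ [] _ = refl
val-++ʳ (x ∷ X) {k = suc k} p with length X + suc k in eq
... | zero = ⊥-elim (1+n≢0 (trans (sym (+-suc (length X) k)) eq))
... | suc m = trans (cong (val (X ++ _)) (sym eq)) (val-++ʳ X p)

val-injective : ∀ {w} → Unique w → ∀ {k l} → InRange (length w) k → InRange (length w) l → val w k ≡ val w l → k ≡ l
val-injective [] (k≥1 , k≤0) _ _ = ⊥-elim (<⇒≱ k≥1 k≤0)
val-injective (_ ∷ u) {suc zero} {suc zero} _ _ _ = refl
val-injective {x ∷ w} (x∉ ∷ u) {suc zero} {suc (suc l)} _ (_ , s≤s le) e = ⊥-elim (All.lookup x∉ (val-∈ w (s≤s z≤n , le)) e)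
val-injective {x ∷ w} (x∉ ∷ u) {suc (suc k)} {suc zero} (_ , s≤s le) _ e = ⊥-elim (All.lookup x∉ (val-∈ w (s≤s z≤n , le)) (sym e))
val-injective (_ ∷ u) {suc (suc k)} {suc (suc l)} (_ , s≤s p) (_ , s≤s q) e = cong suc (val-injective u (s≤s z≤n , p) (s≤s z≤n , q) e)

IsPerm⇒PermFun : ∀ {n w} → IsPerm n w → PermFun n (val w)
IsPerm⇒PermFun {w = w} P@(isPerm refl b u) = permFun (λ r → All.lookup b (val-∈ w r)) (val-injective u)

splitAt : ∀ w {k} → InRange (length w) k → ∃[ X ] ∃[ r ] w ≡ X ++ val w k ∷ r × suc (length X) ≡ k
splitAt [] (k≥1 , k≤0) = ⊥-elim (<⇒≱ k≥1 k≤0)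
splitAt (x ∷ w) {suc zero} _ = [] , w , refl , refl
splitAt (x ∷ w) {suc (suc k)} (_ , s≤s le) with splitAt w (s≤s z≤n , le)
... | X , r , e , l = x ∷ X , r , cong (x ∷_) e , cong suc l

Free : Shading → Fin 3 → ℕ → ℕ → ℕ → Set
Free R a x y e = R a (zone x y e) ≡ false

-- The columns are the lists `X`, `Y` and `Z`, so only the row of an entry has to be computed. This
-- suits arguments that prepend an entry or reverse a segment, whereas `Occ₁₂` suits those that
-- treat positions as numbers.
record Occ (R : Shading) (w : List ℕ) : Set where
  constructor occ
  field
    {X Y Z} : List ℕ
    {x y}   : ℕ
    split   : w ≡ X ++ x ∷ Y ++ y ∷ Z
    x<y     : x < y
    left    : All (Free R zero x y) X
    mid     : All (Free R 1F x y) Y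
    right   : All (Free R 2F x y) Z

Occ⇒Occ₁₂ : ∀ {R w} → Occ R w → Occ₁₂ R (length w) (val w)
Occ⇒Occ₁₂ {R} (occ {X} {Y} {Z} {x} {y} refl x<y l m r) = subst₂′ (vi , vj)
  where
  w = X ++ x ∷ Y ++ y ∷ Z
  i = length X + 1
  j = length X + suc (length Y + 1)
  lenw : length w ≡ length X + suc (length Y + suc (length Z))
  lenw = trans (length-++ X) (cong (λ t → length X + suc t) (length-++ Y))
  vi : val w i ≡ x
  vi = val-++ʳ X ≤-refl
  vY : ∀ {k} → val w (length X + suc (suc k)) ≡ val (Y ++ y ∷ Z) (suc k)
  vY = val-++ʳ X (s≤s z≤n)
  vj : val w j ≡ y
  vj rewrite +-comm (length Y) 1 = trans vY (trans (cong (val (Y ++ y ∷ Z)) (+-comm 1 (length Y))) (val-++ʳ Y ≤-refl))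
  i<j : i < j
  i<j = +-monoʳ-< (length X) (s≤s (m≤n+m 1 (length Y)))
  rj : InRange (length w) j
  rj = ≤-trans (s≤s z≤n) i<j , ≤-trans (+-monoʳ-≤ (length X) (s≤s (+-monoʳ-≤ (length Y) (s≤s z≤n)))) (≤-reflexive (sym lenw))
  ri : InRange (length w) i
  ri = m≤n+m 1 (length X) , ≤-trans (<⇒≤ i<j) (proj₂ rj)
  clear : ∀ {k} → InRange (length w) k → k ≢ i → k ≢ j → R (zone i j k) (zone x y (val w k)) ≡ false
  clear {k} (k≥1 , k≤n) k≢i k≢j with zoneView i<j k≢i k≢j
  ... | below lt e rewrite e = subst (Free R zero x y) (sym (val-++ˡ X k≤X)) (All.lookup l (val-∈ X (k≥1 , k≤X)))
    where
    k≤X : k ≤ length X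
    k≤X = ≤-pred (≤-trans lt (≤-reflexive (+-comm (length X) 1)))
  -- The position is written as `i + 1 + d`, which makes it the entry number `d + 1` of `Y`.
  ... | middle gt lt e with m≤n⇒∃[o]m+o≡n gt
  ...   | d , refl rewrite e = subst (Free R 1F x y) (sym (trans veq (val-++ˡ Y d<Y))) (All.lookup m (val-∈ Y (s≤s z≤n , d<Y)))
    where
    keq : suc (i + d) ≡ length X + suc (suc d)
    keq = trans (cong suc (+-assoc (length X) 1 d)) (sym (+-suc (length X) (suc d)))
    veq : val w (suc (i + d)) ≡ val (Y ++ y ∷ Z) (suc d)
    veq = trans (cong (val w) keq) vY
    d<Y : suc d ≤ length Y
    d<Y = ≤-pred (≤-pred (≤-trans (+-cancelˡ-< (length X) _ _ (subst (_< j) keq lt)) (≤-reflexive (cong suc (+-comm (length Y) 1)))))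
  clear {k} (k≥1 , k≤n) k≢i k≢j | above gt e with m≤n⇒∃[o]m+o≡n gt
  ...   | d , refl rewrite e = subst (Free R 2F x y) (sym veq) (All.lookup r (val-∈ Z (s≤s z≤n , d<Z)))
    where
    keq : suc (j + d) ≡ length X + suc (suc (length Y + suc d))
    keq = trans (cong suc (trans (+-assoc (length X) _ d) (cong (λ t → length X + suc t) (+-assoc (length Y) 1 d)))) (sym (+-suc (length X) _))
    veq : val w (suc (j + d)) ≡ val Z (suc d)
    veq = trans (cong (val w) keq) (trans vY (trans (cong (val (Y ++ y ∷ Z)) (sym (+-suc (length Y) (suc d)))) (val-++ʳ Y (s≤s z≤n))))
    d<Z : suc d ≤ length Z
    d<Z = ≤-pred (+-cancelˡ-≤ (length Y) _ _ (≤-trans (≤-reflexive (+-suc (length Y) (suc d)))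
      (≤-pred (+-cancelˡ-≤ (length X) _ _ (≤-trans (≤-reflexive (sym keq)) (≤-trans k≤n (≤-reflexive lenw)))))))
  subst₂′ : val w i ≡ x × val w j ≡ y → Occ₁₂ R (length w) (val w)
  subst₂′ (p , q) = occ₁₂ ri rj i<j (subst₂ _<_ (sym p) (sym q) x<y)
    λ {k} rk k≢i k≢j → subst₂ (λ a b → R (zone i j k) (zone a b (val w k)) ≡ false) (sym p) (sym q) (clear rk k≢i k≢j)

Occ₁₂⇒Occ : ∀ {R w} → Occ₁₂ R (length w) (val w) → Occ R w
Occ₁₂⇒Occ {R} {w} (occ₁₂ {i} {j} ri rj i<j lt cl) with splitAt w ri
... | X , r , eq , refl with m≤n⇒∃[o]m+o≡n i<j
... | d , refl with splitAt r {suc d} (s≤s z≤n , d<r)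
  where
  d<r : suc d ≤ length r
  d<r = +-cancelˡ-≤ (suc (length X)) _ _ (≤-trans (≤-reflexive (+-suc (suc (length X)) d)) (≤-trans (proj₂ rj)
     (≤-reflexive (trans (cong length eq) (trans (length-++ X) (+-suc (length X) _))))))
... | Y , Z , eq′ , refl = occ {X = X} {Y} {Z} {x} {y} weq lt left′ mid′ right′
  where
  x = val w (suc (length X))
  y = val w (suc (suc (length X) + length Y))
  ix : ∀ m → suc (suc (length X) + m) ≡ length X + suc (suc m)
  ix m = sym (trans (+-suc (length X) (suc m)) (cong suc (+-suc (length X) m)))
  vr : ∀ m → val w (suc (suc (length X) + m)) ≡ val r (suc m)
  vr m = trans (cong₂ val eq (ix m)) (val-++ʳ X (s≤s z≤n))
  weq : w ≡ X ++ x ∷ Y ++ y ∷ Z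
  weq = trans eq (cong (λ t → X ++ x ∷ t) (trans eq′ (cong (λ t → Y ++ t ∷ Z) (sym (vr (length Y))))))
  lenw : length w ≡ length X + suc (length Y + suc (length Z))
  lenw = trans (cong length weq) (trans (length-++ X) (cong (λ t → length X + suc t) (length-++ Y)))
  left′ : All (Free R zero x y) X
  left′ = All.tabulate λ e∈ → go (∈-val e∈)
    where
    go : ∀ {e} → ∃[ k ] InRange (length X) k × val X k ≡ e → Free R zero x y e
    go (k , (k≥1 , k≤) , refl) with cl {k} (k≥1 , ≤-trans k≤ (≤-trans (m≤m+n _ _) (≤-reflexive (sym lenw))))
                                      (<⇒≢ (s≤s k≤)) (<⇒≢ (<-trans (s≤s k≤) i<j))
    ... | h rewrite zone-below {suc (length X)} {suc (suc (length X) + length Y)} {k} (s≤s k≤) =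
      subst (λ t → Free R zero x y t) (trans (cong (λ t → val t k) eq) (val-++ˡ X k≤)) h
  mid′ : All (Free R 1F x y) Y
  mid′ = All.tabulate λ e∈ → go (∈-val e∈)
    where
    go : ∀ {e} → ∃[ k ] InRange (length Y) k × val Y k ≡ e → Free R 1F x y e
    go (suc k , (_ , k≤) , refl) with cl {suc (suc (length X) + k)}
        (s≤s z≤n , ≤-trans (<⇒≤ lt′) (proj₂ rj)) (>⇒≢ gt′) (<⇒≢ lt′)
      where
      lt′ : suc (suc (length X) + k) < suc (suc (length X) + length Y)
      lt′ = s≤s (+-monoʳ-< (suc (length X)) k≤)
      gt′ : suc (length X) < suc (suc (length X) + k)
      gt′ = s≤s (m≤m+n _ k)
    ... | h rewrite zone-middle {suc (length X)} {suc (suc (length X) + length Y)} {suc (suc (length X) + k)}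
        (m≤n⇒m≤1+n (m≤m+n _ k)) (s≤s (+-monoʳ-< (suc (length X)) k≤)) =
      subst (λ t → Free R 1F x y t) (trans (vr k) (trans (cong (λ t → val t (suc k)) eq′) (val-++ˡ Y k≤))) h
  right′ : All (Free R 2F x y) Z
  right′ = All.tabulate λ e∈ → go (∈-val e∈)
    where
    go : ∀ {e} → ∃[ k ] InRange (length Z) k × val Z k ≡ e → Free R 2F x y e
    go (suc k , (_ , k≤) , refl) with cl {suc (suc (length X) + (length Y + suc k))}
        (s≤s z≤n , rng) (>⇒≢ (<-trans i<j gt′)) (>⇒≢ gt′)
      where
      gt′ : suc (suc (length X) + length Y) < suc (suc (length X) + (length Y + suc k))
      gt′ = s≤s (+-monoʳ-< (suc (length X)) (m<m+n (length Y) (s≤s z≤n)))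
      rng : suc (suc (length X) + (length Y + suc k)) ≤ length w
      rng = ≤-trans (≤-reflexive (ix _)) (≤-trans (+-monoʳ-≤ (length X) (s≤s (≤-trans (≤-reflexive (sym (+-suc (length Y) (suc k)))) (+-monoʳ-≤ (length Y) (s≤s k≤)))))
        (≤-reflexive (sym lenw)))
    ... | h rewrite zone-above {suc (length X)} {suc (suc (length X) + length Y)} {suc (suc (length X) + (length Y + suc k))}
        (<⇒≤ i<j) (s≤s (+-monoʳ-≤ (suc (length X)) (m≤m+n (length Y) (suc k)))) =
      subst (λ t → Free R 2F x y t) (trans (vr _) (trans (cong₂ val eq′ (sym (+-suc (length Y) (suc k)))) (val-++ʳ Y (s≤s z≤n)))) h

-- Symmetries

infix 4 _~_

_~_ : Shading → Shading → Set
R ~ R′ = WilfEquivalent (p12 , R) (p12 , R′)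

Contains : MeshPattern → ℕ → List ℕ → Set
Contains p n w = containsᵇ p n w ≡ true

-- If containment of `q` in the image pulls back to containment of `p`, then `φ` maps avoiders of
-- `p` to avoiders of `q`, injectively.
s-≤ : ∀ {n p q} (φ : List ℕ → List ℕ) → (∀ {w} → IsPerm n w → IsPerm n (φ w)) →
  (∀ {v w} → IsPerm n v → IsPerm n w → φ v ≡ φ w → v ≡ w) →
  (∀ {w} → IsPerm n w → Contains q n (φ w) → Contains p n w) → s n p ≤ s n q
s-≤ {n} {p} {q} φ pres inj′ reflect = inj-length φ (filterᵇ-unique _ (S-unique n)) into
  λ v∈ w∈ → inj′ (perm v∈) (perm w∈)
  where
  perm : ∀ {w} → w ∈ filterᵇ (avoidsᵇ p n) (S n) → IsPerm n w
  perm w∈ = ∈S⇒IsPerm (proj₁ (∈-filterᵇ⁻ (avoidsᵇ p n) {xs = S n} w∈))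
  into : ∀ {w} → w ∈ filterᵇ (avoidsᵇ p n) (S n) → φ w ∈ filterᵇ (avoidsᵇ q n) (S n)
  into {w} w∈ = ∈-filterᵇ⁺ (avoidsᵇ q n) (IsPerm⇒∈S (pres (perm w∈))) avoids
    where
    avoids : avoidsᵇ q n (φ w) ≡ true
    avoids with containsᵇ q n (φ w) in eq
    ... | false = refl
    ... | true = trans (sym (cong not (reflect (perm w∈) eq))) (proj₂ (∈-filterᵇ⁻ (avoidsᵇ p n) {xs = S n} w∈))

-- For an involution, transporting containment forwards is enough: applied to the image, it gives
-- the pull-back that `s-≤` asks for, and the two directions give the two inequalities.
wilf-involution : ∀ {p q} (φ : ℕ → List ℕ → List ℕ) → (∀ {n w} → IsPerm n w → IsPerm n (φ n w)) →
  (∀ {n w} → IsPerm n w → φ n (φ n w) ≡ w) →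
  (∀ {n w} → IsPerm n w → Contains p n w → Contains q n (φ n w)) →
  (∀ {n w} → IsPerm n w → Contains q n w → Contains p n (φ n w)) → WilfEquivalent p q
wilf-involution {p} {q} φ pres invol f g n = ≤-antisym (s-≤ {n} {p} {q} (φ n) pres inj′ (back {q} {p} g)) (s-≤ {n} {q} {p} (φ n) pres inj′ (back {p} {q} f))
  where
  inj′ : ∀ {v w} → IsPerm n v → IsPerm n w → φ n v ≡ φ n w → v ≡ w
  inj′ V W e = trans (sym (invol V)) (trans (cong (φ n) e) (invol W))
  back : ∀ {p q} → (∀ {n w} → IsPerm n w → Contains p n w → Contains q n (φ n w)) →
    ∀ {w} → IsPerm n w → Contains p n (φ n w) → Contains q n w
  back {p} {q} h W c = subst (Contains q n) (invol W) (h (pres W) c)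

~-refl : ∀ {R} → R ~ R
~-refl n = refl

~-sym : ∀ {R R′} → R ~ R′ → R′ ~ R
~-sym e n = sym (e n)

~-trans : ∀ {R R′ R″} → R ~ R′ → R′ ~ R″ → R ~ R″
~-trans e e′ n = trans (e n) (e′ n)

contains⇒occ : ∀ {R n w} → IsPerm n w → Contains (p12 , R) n w → Occ R w
contains⇒occ {R} {w = w} P@(isPerm refl _ _) c = Occ₁₂⇒Occ {R} {w} (contains₁₂⁻ {R} {length w} {w} (IsPerm⇒PermFun P) c)

occ⇒contains : ∀ {R n w} → IsPerm n w → Occ R w → Contains (p12 , R) n w
occ⇒contains {R} {w = w} (isPerm refl _ _) o = contains₁₂⁺ {R} {length w} {w} (Occ⇒Occ₁₂ o)

~-involution : ∀ {R R′} (φ : ℕ → List ℕ → List ℕ) → (∀ {n w} → IsPerm n w → IsPerm n (φ n w)) →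
  (∀ {n w} → IsPerm n w → φ n (φ n w) ≡ w) →
  (∀ {n w} → IsPerm n w → Occ R w → Occ R′ (φ n w)) →
  (∀ {n w} → IsPerm n w → Occ R′ w → Occ R (φ n w)) → R ~ R′
~-involution {R} {R′} φ pres invol f g = wilf-involution {p12 , R} {p12 , R′} φ pres invol
  (λ P c → occ⇒contains (pres P) (f P (contains⇒occ P c)))
  (λ P c → occ⇒contains (pres P) (g P (contains⇒occ P c)))

-- The identity serves as the bijection, since both patterns are contained in the same permutations.
~-coincidence : ∀ {R R′} → (∀ {n w} → IsPerm n w → Occ₁₂ R n (val w) → Occ₁₂ R′ n (val w)) →
  (∀ {n w} → IsPerm n w → Occ₁₂ R′ n (val w) → Occ₁₂ R n (val w)) → R ~ R′
~-coincidence {R} {R′} f g = wilf-involution {p12 , R} {p12 , R′} (λ _ w → w) id (λ _ → refl)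
  (λ {n} {w} P c → contains₁₂⁺ {R′} {n} {w} (f P (contains₁₂⁻ {R} {n} {w} (IsPerm⇒PermFun P) c)))
  (λ {n} {w} P c → contains₁₂⁺ {R} {n} {w} (g P (contains₁₂⁻ {R′} {n} {w} (IsPerm⇒PermFun P) c)))

-- Inclusion of the sets of shaded boxes, phrased through unshaded boxes because `Clear` and `Free`
-- speak of those.
_⊑_ : Shading → Shading → Set
R ⊑ R′ = ∀ a b → R′ a b ≡ false → R a b ≡ false

Occ₁₂-mono : ∀ {R R′ n f} → R ⊑ R′ → Occ₁₂ R′ n f → Occ₁₂ R n f
Occ₁₂-mono le (occ₁₂ ri rj i<j lt cl) = occ₁₂ ri rj i<j lt λ r p q → le _ _ (cl r p q)

Occ-mono : ∀ {R R′ w} → R ⊑ R′ → Occ R′ w → Occ R w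
Occ-mono le (occ e lt l m r) = occ e lt (All.map (le _ _) l) (All.map (le _ _) m) (All.map (le _ _) r)

~-pointwise : ∀ {R R′} → (∀ a b → R a b ≡ R′ a b) → R ~ R′
~-pointwise h = ~-coincidence (λ _ → Occ₁₂-mono λ a b e → trans (sym (h a b)) e) (λ _ → Occ₁₂-mono λ a b e → trans (h a b) e)

Occ₁₂-cong : ∀ {R n f g} → (∀ {k} → InRange n k → f k ≡ g k) → Occ₁₂ R n f → Occ₁₂ R n g
Occ₁₂-cong {R} {n} {f} {g} h (occ₁₂ {i} {j} ri rj i<j lt cl) = occ₁₂ ri rj i<j (subst₂ _<_ (h ri) (h rj) lt) cl′
  where
  cl′ : Clear R n g i j (g i) (g j)
  cl′ {k} r p q rewrite sym (h ri) | sym (h rj) | sym (h r) = cl r p q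

-- Permutations given by functions

table : ℕ → (ℕ → ℕ) → List ℕ
table n f = map f (upto1 n)

val-map : ∀ (f : ℕ → ℕ) w {k} → InRange (length w) k → val (map f w) k ≡ f (val w k)
val-map f [] (k≥1 , k≤0) = ⊥-elim (<⇒≱ k≥1 k≤0)
val-map f (x ∷ w) {suc zero} _ = refl
val-map f (x ∷ w) {suc (suc k)} (_ , s≤s le) = val-map f w (s≤s z≤n , le)

val-applyUpTo : ∀ (f : ℕ → ℕ) {n k} → k < n → val (applyUpTo f n) (suc k) ≡ f k
val-applyUpTo f {suc n} {zero} _ = refl
val-applyUpTo f {suc n} {suc k} (s≤s lt) = val-applyUpTo (f ∘ suc) lt

val-upto1 : ∀ {n k} → InRange n k → val (upto1 n) k ≡ k
val-upto1 {n} {suc k} (_ , le) = trans (val-map suc (upTo n) (s≤s z≤n , ≤-trans le (≤-reflexive (sym (length-upTo n)))))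
  (cong suc (val-applyUpTo id le))

val-table : ∀ {n f k} → InRange n k → val (table n f) k ≡ f k
val-table {n} {f} {k} r = trans (val-map f (upto1 n) (subst (λ m → InRange m k) (sym (length-upto1 n)) r)) (cong f (val-upto1 r))

map-unique : ∀ {A B : Set} (f : A → B) {xs} → (∀ {x y} → x ∈ xs → y ∈ xs → f x ≡ f y → x ≡ y) → Unique xs → Unique (map f xs)
map-unique f h [] = []
map-unique f {x ∷ xs} h (x∉ ∷ u) =
  All.map⁺ (All.tabulate λ y∈ e → All.lookup x∉ y∈ (h (here refl) (there y∈) e)) ∷ map-unique f (λ p q → h (there p) (there q)) u

table-perm : ∀ {n f} → PermFun n f → IsPerm n (table n f)
table-perm {n} {f} P = isPerm (trans (length-map f (upto1 n)) (length-upto1 n))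
  (All.map⁺ (All.tabulate λ v∈ → range P (∈-upto1⁻ v∈)))
  (map-unique f (λ p q → injective P (∈-upto1⁻ p) (∈-upto1⁻ q)) (upto1-unique n))

val-ext : ∀ v w → length v ≡ length w → (∀ {k} → InRange (length w) k → val v k ≡ val w k) → v ≡ w
val-ext [] [] _ _ = refl
val-ext (x ∷ v) (y ∷ w) e h = cong₂ _∷_ (h (≤-refl , s≤s z≤n)) (val-ext v w (suc-injective e) λ { {suc k} (_ , le) → h (s≤s z≤n , s≤s le) })

table-ext : ∀ {n f w} → IsPerm n w → (∀ {k} → InRange n k → f k ≡ val w k) → table n f ≡ w
table-ext {n} {f} {w} P h = val-ext _ w (trans (len (↭upto1⇒IsPerm′)) (sym (len P))) λ {k} r →
  let r′ = subst (λ m → InRange m k) (len P) r in trans (val-table r′) (h r′)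
  where
  ↭upto1⇒IsPerm′ : IsPerm n (table n f)
  ↭upto1⇒IsPerm′ = table-perm (permFun (λ r → subst (InRange n) (sym (h r)) (range (IsPerm⇒PermFun P) r))
    λ r r′ e → injective (IsPerm⇒PermFun P) r r′ (trans (sym (h r)) (trans e (h r′))))

mirror : ℕ → ℕ → ℕ
mirror n k = suc n ∸ k

mirror-range : ∀ {n k} → InRange n k → InRange n (mirror n k)
mirror-range {n} {suc k} (_ , le) = m<n⇒0<n∸m le , m∸n≤m n k

mirror-invol : ∀ {n k} → InRange n k → mirror n (mirror n k) ≡ k
mirror-invol (_ , le) = m∸[m∸n]≡n (m≤n⇒m≤1+n le)

mirror-perm : ∀ {n} → PermFun n (mirror n)
mirror-perm {n} = permFun mirror-range λ r r′ e → trans (sym (mirror-invol r)) (trans (cong (mirror n) e) (mirror-invol r′))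

mirror-< : ∀ {n k l} → l ≤ n → k < l → mirror n l < mirror n k
mirror-< l≤n lt = ∸-monoʳ-< lt (m≤n⇒m≤1+n l≤n)

∘-perm : ∀ {n f g} → PermFun n f → PermFun n g → PermFun n (f ∘ g)
∘-perm F G = permFun (range F ∘ range G) λ r r′ e → injective G r r′ (injective F (range G r) (range G r′) e)

-- Rotation, reversal and inverse

transpose : Shading → Shading
transpose R a b = R b a

opposite : Fin 3 → Fin 3
opposite zero = 2F
opposite 1F = 1F
opposite 2F = zero

opposite-invol : ∀ a → opposite (opposite a) ≡ a
opposite-invol zero = refl
opposite-invol 1F = refl
opposite-invol 2F = refl

rotate : Shading → Shading
rotate R a b = R (opposite a) (opposite b)

reflect : Shading → Shading
reflect R a b = R (opposite a) b

zone-mirror : ∀ {n u v t} → u < v → v ≤ n → t ≤ n → t ≢ u → t ≢ v →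
  zone (mirror n v) (mirror n u) (mirror n t) ≡ opposite (zone u v t)
zone-mirror {n} {u} {v} {t} uv v≤n t≤n tu tv with zoneView uv tu tv
... | below lt e rewrite e = zone-above (<⇒≤ (mirror-< v≤n uv)) (<⇒≤ (mirror-< (≤-trans (<⇒≤ uv) v≤n) lt))
... | middle gt lt e rewrite e = zone-middle (<⇒≤ (mirror-< v≤n lt)) (mirror-< t≤n gt)
... | above gt e rewrite e = zone-below {v = mirror n u} (mirror-< t≤n gt)

-- The part common to rotation and reversal: position `k` of the image comes from position
-- `mirror n k`, and the columns appear in opposite order.
mirror-reflect : ∀ {n i j k} → InRange n i → InRange n j → i < j → InRange n k → k ≢ mirror n j → k ≢ mirror n i →
  mirror n k ≢ i × mirror n k ≢ j × opposite (zone (mirror n j) (mirror n i) k) ≡ zone i j (mirror n k)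
mirror-reflect {n} {i} {j} {k} ri rj i<j r k≢ k≢′ = l≢i , l≢j ,
  trans (cong (λ t → opposite (zone (mirror n j) (mirror n i) t)) (sym (mirror-invol r)))
    (trans (cong opposite (zone-mirror i<j (proj₂ rj) (proj₂ (mirror-range r)) l≢i l≢j)) (opposite-invol _))
  where
  l≢i : mirror n k ≢ i
  l≢i e = k≢′ (trans (sym (mirror-invol r)) (cong (mirror n) e))
  l≢j : mirror n k ≢ j
  l≢j e = k≢ (trans (sym (mirror-invol r)) (cong (mirror n) e))

Occ₁₂-rotate : ∀ {R n f} → PermFun n f → Occ₁₂ R n f → Occ₁₂ (rotate R) n (mirror n ∘ f ∘ mirror n)
Occ₁₂-rotate {R} {n} {f} F (occ₁₂ {i} {j} ri rj i<j lt cl) =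
  occ₁₂ (mirror-range rj) (mirror-range ri) (mirror-< (proj₂ rj) i<j)
    (mirror-< f′i≤n (subst₂ _<_ (sym fi) (sym fj) lt)) clear′
  where
  fi : f (mirror n (mirror n i)) ≡ f i
  fi = cong f (mirror-invol ri)
  fj : f (mirror n (mirror n j)) ≡ f j
  fj = cong f (mirror-invol rj)
  f′i≤n : f (mirror n (mirror n j)) ≤ n
  f′i≤n = subst (_≤ n) (sym fj) (proj₂ (range F rj))
  clear′ : Clear (rotate R) n (mirror n ∘ f ∘ mirror n) (mirror n j) (mirror n i)
    (mirror n (f (mirror n (mirror n j)))) (mirror n (f (mirror n (mirror n i))))
  clear′ {k} r k≢ k≢′ rewrite fi | fj with mirror-reflect ri rj i<j r k≢ k≢′
  ... | l≢i , l≢j , pos = subst₂ (λ a b → R a b ≡ false) (sym pos) (sym value) (cl rl l≢i l≢j)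
    where
    l = mirror n k
    rl = mirror-range r
    value : opposite (zone (mirror n (f j)) (mirror n (f i)) (mirror n (f l))) ≡ zone (f i) (f j) (f l)
    value = trans (cong opposite (zone-mirror lt (proj₂ (range F rj)) (proj₂ (range F rl))
      (λ e → l≢i (injective F rl ri e)) (λ e → l≢j (injective F rl rj e)))) (opposite-invol _)

~-rotate : ∀ R → R ~ rotate R
~-rotate R = wilf-involution {p12 , R} {p12 , rotate R} φ
  (λ P → table-perm (G P))
  (λ {n} {w} P → table-ext P λ {k} r → trans (cong (mirror n) (val-table (mirror-range r)))
    (trans (mirror-invol (range (IsPerm⇒PermFun P) (mirror-range (mirror-range r)))) (cong (val w) (mirror-invol r))))
  (λ {n} {w} P c → contains₁₂⁺ {rotate R} {n} {φ n w} (fwd P (contains₁₂⁻ {R} {n} {w} (IsPerm⇒PermFun P) c)))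
  (λ {n} {w} P c → contains₁₂⁺ {R} {n} {φ n w} (Occ₁₂-mono {R} {rotate (rotate R)}
    (λ a b e → trans (sym (cong₂ R (opposite-invol a) (opposite-invol b))) e)
    (fwd P (contains₁₂⁻ {rotate R} {n} {w} (IsPerm⇒PermFun P) c))))
  where
  φ : ℕ → List ℕ → List ℕ
  φ n w = table n (mirror n ∘ val w ∘ mirror n)
  G : ∀ {n w} → IsPerm n w → PermFun n (mirror n ∘ val w ∘ mirror n)
  G P = ∘-perm mirror-perm (∘-perm (IsPerm⇒PermFun P) mirror-perm)
  fwd : ∀ {R n w} → IsPerm n w → Occ₁₂ R n (val w) → Occ₁₂ (rotate R) n (val (φ n w))
  fwd {R} P o = Occ₁₂-cong (λ r → sym (val-table r)) (Occ₁₂-rotate {R} (IsPerm⇒PermFun P) o)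

Occ₂₁-reflect : ∀ {R n f} → Occ₂₁ R n f → Occ₁₂ (reflect R) n (f ∘ mirror n)
Occ₂₁-reflect {R} {n} {f} (occ₂₁ {i} {j} ri rj i<j lt cl) =
  occ₁₂ (mirror-range rj) (mirror-range ri) (mirror-< (proj₂ rj) i<j)
    (subst₂ (λ a b → f a < f b) (sym (mirror-invol rj)) (sym (mirror-invol ri)) lt) clear′
  where
  clear′ : Clear (reflect R) n (f ∘ mirror n) (mirror n j) (mirror n i) (f (mirror n (mirror n j))) (f (mirror n (mirror n i)))
  clear′ {k} r k≢ k≢′ rewrite mirror-invol ri | mirror-invol rj with mirror-reflect ri rj i<j r k≢ k≢′
  ... | l≢i , l≢j , pos =
    subst (λ a → R a (zone (f j) (f i) (f (mirror n k))) ≡ false) (sym pos) (cl (mirror-range r) l≢i l≢j)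

Occ₁₂-reflect : ∀ {R n f} → Occ₁₂ (reflect R) n f → Occ₂₁ R n (f ∘ mirror n)
Occ₁₂-reflect {R} {n} {f} (occ₁₂ {i} {j} ri rj i<j lt cl) =
  occ₂₁ (mirror-range rj) (mirror-range ri) (mirror-< (proj₂ rj) i<j)
    (subst₂ (λ a b → f a < f b) (sym (mirror-invol ri)) (sym (mirror-invol rj)) lt) clear′
  where
  clear′ : Clear R n (f ∘ mirror n) (mirror n j) (mirror n i) (f (mirror n (mirror n i))) (f (mirror n (mirror n j)))
  clear′ {k} r k≢ k≢′ rewrite mirror-invol ri | mirror-invol rj with mirror-reflect ri rj i<j r k≢ k≢′
  ... | l≢i , l≢j , pos = subst (λ a → R a (zone (f i) (f j) (f (mirror n k))) ≡ false)
    (trans (cong opposite (sym pos)) (opposite-invol _)) (cl (mirror-range r) l≢i l≢j)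

-- Reversal turns an occurrence of 21 into one of 12 with the columns in opposite order; thus only
-- the 512 shadings of 12 have to be classified.
wilf-reflect : ∀ R → WilfEquivalent (p21 , R) (p12 , reflect R)
wilf-reflect R = wilf-involution {p21 , R} {p12 , reflect R} φ
  (λ P → table-perm (G P))
  (λ {n} {w} P → table-ext P λ {k} r → trans (val-table (mirror-range r)) (cong (val w) (mirror-invol r)))
  (λ {n} {w} P c → contains₁₂⁺ {reflect R} {n} {φ n w} (Occ₁₂-cong {reflect R} (λ r → sym (val-table r))
    (Occ₂₁-reflect (contains₂₁⁻ {R} {n} {w} (IsPerm⇒PermFun P) c))))
  (λ {n} {w} P c → contains₂₁⁺ {R} {n} {φ n w} (Occ₂₁-cong (λ r → sym (val-table r))
    (Occ₁₂-reflect {R} (contains₁₂⁻ {reflect R} {n} {w} (IsPerm⇒PermFun P) c))))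
  where
  φ : ℕ → List ℕ → List ℕ
  φ n w = table n (val w ∘ mirror n)
  G : ∀ {n w} → IsPerm n w → PermFun n (val w ∘ mirror n)
  G P = ∘-perm (IsPerm⇒PermFun P) mirror-perm
  Occ₂₁-cong : ∀ {R n f g} → (∀ {k} → InRange n k → f k ≡ g k) → Occ₂₁ R n f → Occ₂₁ R n g
  Occ₂₁-cong {R} {n} {f} {g} h (occ₂₁ {i} {j} ri rj i<j lt cl) = occ₂₁ ri rj i<j (subst₂ _<_ (h rj) (h ri) lt) cl′
    where
    cl′ : Clear R n g i j (g j) (g i)
    cl′ {k} r p q rewrite sym (h ri) | sym (h rj) | sym (h r) = cl r p q

position : List ℕ → ℕ → ℕ
position [] v = zero
position (x ∷ w) v with v ≟ x
... | yes _ = 1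
... | no _ = suc (position w v)

position-range : ∀ {w v} → v ∈ w → InRange (length w) (position w v)
position-range {x ∷ w} {v} v∈ with v ≟ x
... | yes _ = ≤-refl , s≤s z≤n
position-range {x ∷ w} (here e) | no ne = ⊥-elim (ne e)
position-range {x ∷ w} (there p) | no _ = s≤s z≤n , s≤s (proj₂ (position-range p))

val-position : ∀ {w v} → v ∈ w → val w (position w v) ≡ v
val-position {x ∷ w} {v} v∈ with v ≟ x
... | yes e = sym e
val-position {x ∷ w} (here e) | no ne = ⊥-elim (ne e)
val-position {x ∷ w} {v} (there p) | no _ with position w v | position-range p | val-position p
... | suc k | _ | e = e

module Inverse {n w} (P : IsPerm n w) where

  position-range′ : ∀ {v} → InRange n v → InRange n (position w v)
  position-range′ {v} r = subst (λ m → InRange m (position w v)) (len P) (position-range (occurs P r))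

  val∘position : ∀ {v} → InRange n v → val w (position w v) ≡ v
  val∘position r = val-position (occurs P r)

  position∘val : ∀ {k} → InRange n k → position w (val w k) ≡ k
  position∘val r = injective F (position-range′ (range F r)) r (val∘position (range F r))
    where F = IsPerm⇒PermFun P

  position-perm : PermFun n (position w)
  position-perm = permFun position-range′ λ r r′ e → trans (sym (val∘position r)) (trans (cong (val w) e) (val∘position r′))

-- In the inverse, positions and values trade places, and so do columns and rows. The conditions
-- `i < j` and `val w i < val w j` just swap, so 12 stays 12.
Occ₁₂-transpose : ∀ {R n w} → IsPerm n w → Occ₁₂ R n (val w) → Occ₁₂ (transpose R) n (position w)
Occ₁₂-transpose {R} {n} {w} P (occ₁₂ {i} {j} ri rj i<j lt cl) =
  occ₁₂ (range F ri) (range F rj) lt (subst₂ _<_ (sym (position∘val ri)) (sym (position∘val rj)) i<j) clear′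
  where
  open Inverse P
  F = IsPerm⇒PermFun P
  clear′ : Clear (transpose R) n (position w) (val w i) (val w j) (position w (val w i)) (position w (val w j))
  clear′ {k} r k≢ k≢′ rewrite position∘val ri | position∘val rj =
    subst (λ t → R (zone i j l) (zone (val w i) (val w j) t) ≡ false) (val∘position r)
      (cl (position-range′ r) (λ e → k≢ (trans (sym (val∘position r)) (cong (val w) e)))
        (λ e → k≢′ (trans (sym (val∘position r)) (cong (val w) e))))
    where
    l = position w k

~-transpose : ∀ R → R ~ transpose R
~-transpose R = wilf-involution {p12 , R} {p12 , transpose R} φ
  (λ P → table-perm (Inverse.position-perm P))
  (λ {n} {w} P → table-ext P λ {k} r → invol P r)
  (λ {n} {w} P c → contains₁₂⁺ {transpose R} {n} {φ n w} (fwd P (contains₁₂⁻ {R} {n} {w} (IsPerm⇒PermFun P) c)))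
  (λ {n} {w} P c → contains₁₂⁺ {R} {n} {φ n w} (fwd {transpose R} P (contains₁₂⁻ {transpose R} {n} {w} (IsPerm⇒PermFun P) c)))
  where
  φ : ℕ → List ℕ → List ℕ
  φ n w = table n (position w)
  fwd : ∀ {R n w} → IsPerm n w → Occ₁₂ R n (val w) → Occ₁₂ (transpose R) n (val (φ n w))
  fwd {R} P o = Occ₁₂-cong {transpose R} (λ r → sym (val-table r)) (Occ₁₂-transpose P o)
  invol : ∀ {n w k} → IsPerm n w → InRange n k → position (φ n w) k ≡ val w k
  -- The injective map `position w` sends both sides to `k`.
  invol {n} {w} {k} P r = injective (position-perm P) (position-range′ Q r) (range (IsPerm⇒PermFun P) r)
    (trans (sym (val-table (position-range′ Q r))) (trans (val∘position Q r) (sym (position∘val P r))))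
    where
    open Inverse
    Q : IsPerm n (φ n w)
    Q = table-perm (position-perm P)

-- Shading one more box

-- The side of the first pattern point on which a box lies, in one coordinate. The four boxes around
-- that point are `(near dx , near dy)`; those around the second point are reached through `rotate`.
data Side : Set where
  low high : Side

near far : Side → Fin 3
near low = zero
near high = 1F
far low = 1F
far high = zero

Beyond : Side → ℕ → ℕ → Set
Beyond low t e = t < e
Beyond high t e = e < t

-- How the zone of t changes when the first pattern point moves from u to a point e of its adjacent zone.
data Shift (d : Side) (u v e t : ℕ) : Set where
  stays : zone e v t ≡ zone u v t → (zone e v t ≡ near d → Beyond d t e) → Shift d u v e t
  crosses : zone u v t ≡ near d → zone e v t ≡ far d → Shift d u v e t

shift : ∀ d {u v e t} → u < v → zone u v e ≡ near d → e ≢ u → e ≢ v → t ≢ u → t ≢ v → t ≢ e → Shift d u v e t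
shift low {u} {v} {e} {t} uv near-e e≢u e≢v t≢u t≢v t≢e with zoneView uv e≢u e≢v
... | middle _ _ q = contradiction (trans (sym near-e) q) λ ()
... | above _ q = contradiction (trans (sym near-e) q) λ ()
... | below e<u _ with zoneView (<-trans e<u uv) t≢e t≢v | zoneView uv t≢u t≢v
...   | below t<e q | below _ q′ = stays (trans q (sym q′)) (λ _ → t<e)
...   | below t<e q | middle u<t _ _ = ⊥-elim (<-asym (<-trans e<u u<t) t<e)
...   | below t<e q | above v<t _ = ⊥-elim (<-asym (<-trans (<-trans e<u uv) v<t) t<e)
...   | middle _ _ q | below _ q′ = crosses q′ q
...   | middle e<t _ q | middle _ _ q′ = stays (trans q (sym q′)) λ r → contradiction (trans (sym r) q) λ ()
...   | middle _ t<v _ | above v<t _ = ⊥-elim (<-asym t<v v<t)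
...   | above v<t _ | below t<u _ = ⊥-elim (<-asym (<-trans t<u uv) v<t)
...   | above v<t _ | middle _ t<v _ = ⊥-elim (<-asym t<v v<t)
...   | above _ q | above _ q′ = stays (trans q (sym q′)) λ r → contradiction (trans (sym r) q) λ ()
shift high {u} {v} {e} {t} uv near-e e≢u e≢v t≢u t≢v t≢e with zoneView uv e≢u e≢v
... | below _ q = contradiction (trans (sym near-e) q) λ ()
... | above _ q = contradiction (trans (sym near-e) q) λ ()
... | middle u<e e<v _ with zoneView e<v t≢e t≢v | zoneView uv t≢u t≢v
...   | below _ q | below _ q′ = stays (trans q (sym q′)) λ r → contradiction (trans (sym r) q) λ ()
...   | below _ q | middle _ _ q′ = crosses q′ q
...   | below t<e _ | above v<t _ = ⊥-elim (<-asym (<-trans e<v v<t) t<e)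
...   | middle e<t _ _ | below t<u _ = ⊥-elim (<-asym (<-trans t<u u<e) e<t)
...   | middle e<t _ q | middle _ _ q′ = stays (trans q (sym q′)) (λ _ → e<t)
...   | middle _ t<v _ | above v<t _ = ⊥-elim (<-asym t<v v<t)
...   | above v<t _ | below t<u _ = ⊥-elim (<-asym (<-trans t<u uv) v<t)
...   | above v<t _ | middle _ t<v _ = ⊥-elim (<-asym t<v v<t)
...   | above _ q | above _ q′ = stays (trans q (sym q′)) λ r → contradiction (trans (sym r) q) λ ()

near⇒<v : ∀ d {u v e} → u < v → zone u v e ≡ near d → e ≢ u → e ≢ v → e < v × zone e v u ≡ far d
near⇒<v d {u} {v} {e} uv near-e e≢u e≢v with zoneView uv e≢u e≢v
near⇒<v low uv near-e e≢u e≢v | below lt q = <-trans lt uv , zone-middle (<⇒≤ lt) uv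
near⇒<v high {u} {v} {e} uv near-e e≢u e≢v | middle gt lt q = lt , zone-below {e} {v} {u} gt
near⇒<v high uv near-e e≢u e≢v | below lt q with () ← trans (sym near-e) q
near⇒<v low uv near-e e≢u e≢v | middle _ _ q with () ← trans (sym near-e) q
near⇒<v low uv near-e e≢u e≢v | above _ q with () ← trans (sym near-e) q
near⇒<v high uv near-e e≢u e≢v | above _ q with () ← trans (sym near-e) q

extreme : ∀ d n {P : ℕ → Set} → (∀ k → Dec (P k)) →
  (∀ {k} → InRange n k → ¬ P k) ⊎ (∃[ e ] InRange n e × P e × (∀ {k} → InRange n k → P k → ¬ Beyond d k e))
extreme d zero P? = inj₁ λ { (k≥1 , k≤0) → ⊥-elim (<⇒≱ k≥1 k≤0) }
extreme low (suc n) P? with extreme low n P?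
... | inj₂ (e , (e≥1 , e≤n) , pe , least) = inj₂ (e , (e≥1 , m≤n⇒m≤1+n e≤n) , pe , least′)
  where
  least′ : ∀ {k} → InRange (suc n) k → _ → ¬ k < e
  least′ (k≥1 , _) pk lt = least (k≥1 , <⇒≤ (≤-trans lt e≤n)) pk lt
... | inj₁ none with P? (suc n)
...   | yes p = inj₂ (suc n , (s≤s z≤n , ≤-refl) , p , λ { (k≥1 , _) pk lt → none (k≥1 , ≤-pred lt) pk })
...   | no ¬p = inj₁ λ { (k≥1 , le) pk → [ (λ lt → none (k≥1 , ≤-pred lt) pk) , (λ { refl → ¬p pk }) ]′ (m≤n⇒m<n∨m≡n le) }
extreme high (suc n) P? with P? (suc n)
... | yes p = inj₂ (suc n , (s≤s z≤n , ≤-refl) , p , λ { (_ , le) _ lt → <⇒≱ lt le })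
... | no ¬p with extreme high n P?
...   | inj₁ none = inj₁ λ { (k≥1 , le) pk → [ (λ lt → none (k≥1 , ≤-pred lt) pk) , (λ { refl → ¬p pk }) ]′ (m≤n⇒m<n∨m≡n le) }
...   | inj₂ (e , (e≥1 , e≤n) , pe , greatest) = inj₂ (e , (e≥1 , m≤n⇒m≤1+n e≤n) , pe , greatest′)
  where
  greatest′ : ∀ {k} → InRange (suc n) k → _ → ¬ e < k
  greatest′ (k≥1 , le) pk lt = [ (λ lt′ → greatest (k≥1 , ≤-pred lt′) pk lt) , (λ { refl → ¬p pk }) ]′ (m≤n⇒m<n∨m≡n le)

shadeBox : Fin 3 → Fin 3 → Shading → Shading
shadeBox a b R c d = R c d ∨ (⌊ c ≟ᶠ a ⌋ ∧ ⌊ d ≟ᶠ b ⌋)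

shadeBox-free : ∀ {a b R c d} → R c d ≡ false → ¬ (c ≡ a × d ≡ b) → shadeBox a b R c d ≡ false
shadeBox-free {a} {b} {R} {c} {d} e ne rewrite e with c ≟ᶠ a | d ≟ᶠ b
... | yes p | yes q = ⊥-elim (ne (p , q))
... | yes _ | no _ = refl
... | no _ | _ = refl

∨-false : ∀ {a b} → a ∨ b ≡ false → a ≡ false
∨-false {false} _ = refl

-- The point of the pattern is moved to the extreme point of the box to be shaded.
shading-lemma : ∀ {R} dx dy → R (far dx) (far dy) ≡ false → R (far dx) (near dy) ≡ false →
  (R 2F (near dy) ≡ false → R 2F (far dy) ≡ false) →
  (R (near dx) 2F ≡ false → R (far dx) 2F ≡ false) →
  R ~ shadeBox (near dx) (near dy) R
shading-lemma {R} dx dy h₁ h₂ h₃ h₄ = ~-coincidence {R} {R′} (λ P → move (IsPerm⇒PermFun P)) (λ _ → Occ₁₂-mono {R} {R′} λ a b → ∨-false)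
  where
  a = near dx
  b = near dy
  R′ = shadeBox a b R
  near≢far : ∀ d → near d ≢ far d
  near≢far low ()
  near≢far high ()
  near≢2 : ∀ d → 2F ≢ near d
  near≢2 low ()
  near≢2 high ()
  which : ∀ d c → c ≡ near d ⊎ c ≡ far d ⊎ c ≡ 2F
  which low zero = inj₁ refl
  which low 1F = inj₂ (inj₁ refl)
  which high zero = inj₂ (inj₁ refl)
  which high 1F = inj₁ refl
  which _ 2F = inj₂ (inj₂ refl)
  move : ∀ {n f} → PermFun n f → Occ₁₂ R n f → Occ₁₂ R′ n f
  -- The search runs through the box to be shaded. `dx` selects its member farthest, in position,
  -- from the old first point, so no other member remains in the near column of the new one.
  move {n} {f} F (occ₁₂ {i} {j} ri rj i<j lt cl) with extreme dx n {λ k → (k ≢ i × k ≢ j) × zone i j k ≡ a × zone (f i) (f j) (f k) ≡ b}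
      (λ k → (¬? (k ≟ i) ×-dec ¬? (k ≟ j)) ×-dec ((zone i j k ≟ᶠ a) ×-dec (zone (f i) (f j) (f k) ≟ᶠ b)))
  ... | inj₁ none = occ₁₂ ri rj i<j lt λ r p q → shadeBox-free {R = R} (cl r p q) λ { (e , e′) → none r ((p , q) , e , e′) }
  ... | inj₂ (e , re , ((e≢i , e≢j) , ea , eb) , ext) with near⇒<v dx i<j ea e≢i e≢j
        | near⇒<v dy lt eb (λ q → e≢i (injective F re ri q)) (λ q → e≢j (injective F re rj q))
  ...   | e<j , i-far | fe<fj , fi-far = occ₁₂ re rj e<j fe<fj clear′
    where
    clear′ : Clear R′ n f e j (f e) (f j)
    clear′ {k} r k≢e k≢j with k ≟ i
    -- The old first point has become an ordinary entry in the far column and far row, a box that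
    -- `h₁` leaves unshaded.
    ... | yes refl rewrite i-far | fi-far = shadeBox-free {R = R} h₁ λ { (q , _) → near≢far dx (sym q) }
    ... | no k≢i with cl r k≢i k≢j
        | shift dx i<j ea e≢i e≢j k≢i k≢j k≢e
        | shift dy lt eb (λ q → e≢i (injective F re ri q)) (λ q → e≢j (injective F re rj q))
            (λ q → k≢i (injective F r ri q)) (λ q → k≢j (injective F r rj q)) (λ q → k≢e (injective F r re q))
    ...   | c | stays p p′ | stays q q′ = shadeBox-free {R = R} (trans (cong₂ R p q) c)
              λ { (s , t) → ext r ((k≢i , k≢j) , trans (sym p) s , trans (sym q) t) (p′ s) }
    ...   | c | crosses p p′ | stays q q′ rewrite p′ | q | p with which dy (zone (f i) (f j) (f k))
    ...     | inj₁ t rewrite t = shadeBox-free {R = R} h₂ λ { (s , _) → near≢far dx (sym s) }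
    ...     | inj₂ (inj₁ t) rewrite t = shadeBox-free {R = R} h₁ λ { (s , _) → near≢far dx (sym s) }
    ...     | inj₂ (inj₂ t) rewrite t = shadeBox-free {R = R} (h₄ c) λ { (s , _) → near≢far dx (sym s) }
    -- Here only the horizontal line passes over the entry. In the near column this contradicts the
    -- extremal choice, in the far column the entry lands in the box of `h₁`, and in column 2 the
    -- passage is `h₃`.
    clear′ {k} r k≢e k≢j | no k≢i | c | stays p p′ | crosses q q′ with which dx (zone i j k)
    ...     | inj₁ t = ⊥-elim (ext r ((k≢i , k≢j) , t , q) (p′ (trans p t)))
    ...     | inj₂ (inj₁ t) rewrite p | q′ | t = shadeBox-free {R = R} h₁ λ { (s , _) → near≢far dx (sym s) }
    ...     | inj₂ (inj₂ t) rewrite p | q′ | q | t = shadeBox-free {R = R} (h₃ c) λ { (s , _) → near≢2 dx s }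
    clear′ {k} r k≢e k≢j | no k≢i | c | crosses p p′ | crosses q q′ rewrite p′ | q′ =
      shadeBox-free {R = R} h₁ λ { (s , _) → near≢far dx (sym s) }

-- Explicit avoiders and reversals

empty : Shading
empty _ _ = false

-- A permutation that is not decreasing contains peakShading: among the entries that exceed some entry to their
-- left take the largest as second point, and the leftmost smaller entry as first point.
record Peak (n : ℕ) (f : ℕ → ℕ) : Set where
  constructor peak
  field
    {i j}   : ℕ
    ri      : InRange n i
    rj      : InRange n j
    i<j     : i < j
    fi<fj   : f i < f j
    highest : ∀ {h k} → InRange n h → InRange n k → h < k → f h < f k → ¬ f j < f k

-- The search is by value and not by position: among the values with a smaller entry to their left,
-- the greatest is taken.
highestPeak : ∀ {n w} → IsPerm n w → Occ₁₂ empty n (val w) → Peak n (val w)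
highestPeak {n} {w} P (occ₁₂ {i} {j} ri rj i<j lt _) = result (extreme high n tops?)
  where
  open Inverse P
  F = IsPerm⇒PermFun P
  f = val w
  Tops : ℕ → Set
  Tops v = ∃[ h ] InRange n h × h < position w v × f h < f (position w v)
  tops? : ∀ v → Dec (Tops v)
  -- `extreme` serves here as a bounded test for existence.
  tops? v with extreme low n (λ h → (h <? position w v) ×-dec (f h <? f (position w v)))
  ... | inj₁ none = no λ { (h , r , b) → none r b }
  ... | inj₂ (h , r , b , _) = yes (h , r , b)
  tops : ∀ {h k} → InRange n h → InRange n k → h < k → f h < f k → Tops (f k)
  tops {h} rh rk h<k lt′ = h , rh , subst (λ t → h < t × f h < f t) (sym (position∘val rk)) (h<k , lt′)
  result : _ → Peak n f
  result (inj₁ none) = ⊥-elim (none (range F rj) (tops ri rj i<j lt))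
  result (inj₂ (v , rv , (h , rh , h<j , lt′) , greatest)) = peak rh (position-range′ rv) h<j lt′
    λ {_} {k} rh′ rk h<k lt″ gt → greatest (range F rk) (tops rh′ rk h<k lt″) (subst (_< f k) (val∘position rv) gt)

-- These boxes are emptied by the choice of the two points. An entry to the right of the first point
-- and above the second would be a higher peak; an entry to the left of the first point and below
-- the second would have been preferred as first point.
peakShading : Shading
peakShading zero zero = true
peakShading zero 1F = true
peakShading 1F 2F = true
peakShading 2F 2F = true
peakShading _ _ = false

peak-occ : ∀ {n w} → IsPerm n w → Peak n (val w) → Occ₁₂ peakShading n (val w)
peak-occ {n} {w} P (peak {i} {j} ri rj i<j lt highest) with extreme low n (λ h → (h <? j) ×-dec (val w h <? val w j))
... | inj₁ none = ⊥-elim (none ri (i<j , lt))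
... | inj₂ (h , rh , (h<j , fh<fj) , least) = occ₁₂ rh rj h<j fh<fj clear
  where
  F = IsPerm⇒PermFun P
  f = val w
  top : ∀ {k} → InRange n k → h < k → ¬ f j < f k
  top rk h<k gt = highest rh rk h<k (<-trans fh<fj gt) gt
  first : ∀ {k} → InRange n k → k < h → ¬ f k < f j
  first rk k<h fk<fj = least rk (<-trans k<h h<j , fk<fj) k<h
  clear : Clear peakShading n f h j (f h) (f j)
  clear {k} r k≢h k≢j with zoneView h<j k≢h k≢j | zoneView fh<fj (λ q → k≢h (injective F r rh q)) (λ q → k≢j (injective F r rj q))
  ... | below k<h _    | below fk<fh _ = ⊥-elim (first r k<h (<-trans fk<fh fh<fj))
  ... | below k<h _    | middle _ fk<fj _ = ⊥-elim (first r k<h fk<fj)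
  ... | below _ p      | above _ q rewrite p | q = refl
  ... | middle _ _ p   | below _ q rewrite p | q = refl
  ... | middle _ _ p   | middle _ _ q rewrite p | q = refl
  ... | middle h<k _ _ | above gt _ = ⊥-elim (top r h<k gt)
  ... | above _ p      | below _ q rewrite p | q = refl
  ... | above _ p      | middle _ _ q rewrite p | q = refl
  ... | above j<k _    | above gt _ = ⊥-elim (top r (<-trans h<j j<k) gt)

-- In both cases the decreasing permutation is the only avoider of each length.
~-empty : ∀ {R} → R ⊑ peakShading → R ~ empty
~-empty {R} le = ~-coincidence {R} {empty} (λ _ → Occ₁₂-mono λ _ _ _ → refl)
  λ P o → Occ₁₂-mono le (peak-occ P (highestPeak P o))

corner : Shading
corner 2F zero = true
corner _ _ = false

cross : Shading
cross _ zero = true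
cross 1F _ = true
cross _ _ = false

-- A permutation contains any of these patterns iff 1 is not its last entry.
~-corner : ∀ {R} → corner ⊑ R → R ⊑ cross → R ~ corner
~-corner {R} ge le = ~-coincidence {R} {corner} (λ _ → Occ₁₂-mono ge) λ P o → Occ₁₂-mono le (one-first P o)
  where
  one-first : ∀ {n w} → IsPerm n w → Occ₁₂ corner n (val w) → Occ₁₂ cross n (val w)
  -- The witness consists of 1 and its right neighbour: nothing lies below 1, and nothing stands
  -- between adjacent positions.
  one-first {n} {w} P (occ₁₂ {i} {j} ri rj i<j lt cl) = occ₁₂ rp rp′ ≤-refl fp<fp′ clear
    where
    open Inverse P
    F = IsPerm⇒PermFun P
    f = val w
    r1 : InRange n 1
    r1 = ≤-refl , ≤-trans (proj₁ ri) (proj₂ ri)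
    p = position w 1
    rp : InRange n p
    rp = position-range′ r1
    fp : f p ≡ 1
    fp = val∘position r1
    p≢j : p ≢ j
    p≢j e = <⇒≱ (≤-<-trans (proj₁ (range F ri)) lt) (≤-reflexive (trans (cong f (sym e)) fp))
    fp<fi : p ≢ i → f p < f i
    fp<fi p≢i = ≤∧≢⇒< (subst (_≤ f i) (sym fp) (proj₁ (range F ri))) λ e → p≢i (injective F rp ri e)
    p<j : p < j
    p<j with p ≟ i
    ... | yes e = subst (_< j) (sym e) i<j
    ... | no p≢i with zoneView i<j p≢i p≢j
    ...   | below p<i _ = <-trans p<i i<j
    ...   | middle _ lt′ _ = lt′
    ...   | above _ z with cl rp p≢i p≢j
    ...     | c rewrite z | zone-below {f i} {f j} {f p} (fp<fi p≢i) with c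
    ...     | ()
    rp′ : InRange n (suc p)
    rp′ = s≤s z≤n , ≤-trans p<j (proj₂ rj)
    smaller : ∀ {k} → InRange n k → k ≢ p → f p < f k
    smaller {k} r k≢p = ≤∧≢⇒< (subst (_≤ f k) (sym fp) (proj₁ (range F r))) λ e → k≢p (injective F r rp (sym e))
    fp<fp′ : f p < f (suc p)
    fp<fp′ = smaller rp′ 1+n≢n
    clear : Clear cross n f p (suc p) (f p) (f (suc p))
    clear {k} r k≢p k≢p′ with zoneView {p} {suc p} ≤-refl k≢p k≢p′ | zoneView fp<fp′ (λ e → k≢p (injective F r rp e)) (λ e → k≢p′ (injective F r rp′ e))
    ... | middle gt lt′ _ | _ = ⊥-elim (<⇒≱ gt (≤-pred lt′))
    ... | _ | below lt′ _ = ⊥-elim (<-asym lt′ (smaller r k≢p))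
    ... | below _ q | middle _ _ q′ rewrite q | q′ = refl
    ... | below _ q | above _ q′ rewrite q | q′ = refl
    ... | above _ q | middle _ _ q′ rewrite q | q′ = refl
    ... | above _ q | above _ q′ rewrite q | q′ = refl

-- Reversals that exchange columns 1 and 2

swap₁₂ : Fin 3 → Fin 3
swap₁₂ zero = zero
swap₁₂ 1F = 2F
swap₁₂ 2F = 1F

swap₁₂-invol : ∀ a → swap₁₂ (swap₁₂ a) ≡ a
swap₁₂-invol zero = refl
swap₁₂-invol 1F = refl
swap₁₂-invol 2F = refl

swapColumns swapRows : Shading → Shading
swapColumns R a b = R (swap₁₂ a) b
swapRows R a b = R a (swap₁₂ b)

reverse-All : ∀ {P : ℕ → Set} {xs} → All P xs → All P (reverse xs)
reverse-All {xs = xs} ps = ↭.All-resp-↭ (↭-sym (↭.↭-reverse xs)) ps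

reverse-split : ∀ (Y : List ℕ) y Z → reverse (Y ++ y ∷ Z) ≡ reverse Z ++ y ∷ reverse Y
reverse-split Y y Z = trans (reverse-++ Y (y ∷ Z)) (trans (cong (_++ reverse Y) (unfold-reverse y Z)) (++-assoc (reverse Z) [ y ] (reverse Y)))

perm-resp-↭ : ∀ {n v w} → v ↭ w → IsPerm n v → IsPerm n w
perm-resp-↭ p P = ↭upto1⇒IsPerm (↭-trans (↭-sym p) (↭upto1 P))

reverseTail : List ℕ → List ℕ
reverseTail [] = []
reverseTail (m ∷ w) = m ∷ reverse w

-- Nothing may precede the first point, so it is the first entry, and columns 1 and 2 are the two
-- parts into which the second point cuts the tail. Reversing the tail exchanges these parts and
-- keeps all values.
~-column₀ : ∀ {R} → (∀ b → R zero b ≡ true) → R ~ swapColumns R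
~-column₀ {R} full = ~-involution {R} {swapColumns R} (λ _ → reverseTail) (perm-resp-↭ (↭-sym (tail↭ _))) (λ {n} {w} _ → invol w)
  (λ _ → turn {R} full) (λ _ o → Occ-mono (λ a b e → trans (cong (λ c → R c b) (sym (swap₁₂-invol a))) e) (turn {swapColumns R} full o))
  where
  tail↭ : ∀ w → reverseTail w ↭ w
  tail↭ [] = ↭-refl
  tail↭ (m ∷ w) = ↭-prep m (↭.↭-reverse w)
  invol : ∀ w → reverseTail (reverseTail w) ≡ w
  invol [] = refl
  invol (m ∷ w) = cong (m ∷_) (reverse-involutive w)
  turn : ∀ {R} → (∀ b → R zero b ≡ true) → ∀ {w} → Occ R w → Occ (swapColumns R) (reverseTail w)
  turn {R} full (occ {[]} {Y} {Z} {x} {y} refl lt _ m r) =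
    occ {X = []} {reverse Z} {reverse Y} (cong (x ∷_) (reverse-split Y y Z)) lt [] (reverse-All {Free R 2F x y} r) (reverse-All {Free R 1F x y} m)
  turn {R} full (occ {e ∷ X} {x = x} {y} _ _ (l ∷ _) _ _) with () ← trans (sym (full (zone x y e))) l

reverseAfter1 : List ℕ → List ℕ
reverseAfter1 [] = []
reverseAfter1 (m ∷ w) with m ≟ 1
... | yes _ = m ∷ reverse w
... | no _ = m ∷ reverseAfter1 w

-- Nothing may lie below the first point, so it is the entry 1. Reversing what follows 1 leaves
-- column 0 in place and exchanges columns 1 and 2.
~-row₀ : ∀ {R} → (∀ a → R a zero ≡ true) → R ~ swapColumns R
~-row₀ {R} full = ~-involution {R} {swapColumns R} (λ _ → reverseAfter1) (perm-resp-↭ (↭-sym (after↭ _))) (λ {n} {w} _ → invol w)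
  (turn {R} full) (λ P o → Occ-mono (λ a b e → trans (cong (λ c → R c b) (sym (swap₁₂-invol a))) e) (turn {swapColumns R} (λ a → full (swap₁₂ a)) P o))
  where
  after↭ : ∀ w → reverseAfter1 w ↭ w
  after↭ [] = ↭-refl
  after↭ (m ∷ w) with m ≟ 1
  ... | yes _ = ↭-prep m (↭.↭-reverse w)
  ... | no _ = ↭-prep m (after↭ w)
  invol : ∀ w → reverseAfter1 (reverseAfter1 w) ≡ w
  invol [] = refl
  invol (m ∷ w) with m ≟ 1 in eq
  ... | yes _ rewrite eq = cong (m ∷_) (reverse-involutive w)
  ... | no _ rewrite eq = cong (m ∷_) (invol w)
  after-split : ∀ {X} → 1 ∉ X → ∀ {r} → reverseAfter1 (X ++ 1 ∷ r) ≡ X ++ 1 ∷ reverse r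
  after-split {[]} _ = refl
  after-split {m ∷ X} 1∉ with m ≟ 1
  ... | yes e = ⊥-elim (1∉ (here (sym e)))
  ... | no _ = cong (m ∷_) (after-split (1∉ ∘ there))
  Unique-head∉ : ∀ X {r : List ℕ} {x} → Unique (X ++ x ∷ r) → x ∉ X
  Unique-head∉ (e ∷ X) (e∉ ∷ u) (here refl) = All.lookup e∉ (∈-++⁺ʳ X (here refl)) refl
  Unique-head∉ (e ∷ X) (e∉ ∷ u) (there p) = Unique-head∉ X u p
  absurd : ∀ {R} → (∀ a → R a zero ≡ true) → ∀ {a x y e} → e < x → Free R a x y e → ⊥
  absurd {R} full {a} {x} {y} {e} lt fr with () ← trans (sym (full a)) (trans (cong (R a) (sym (zone-below {x} {y} {e} lt))) fr)
  turn : ∀ {R} → (∀ a → R a zero ≡ true) → ∀ {n w} → IsPerm n w → Occ R w → Occ (swapColumns R) (reverseAfter1 w)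
  turn {R} full {n} {w} P (occ {X} {Y} {Z} {x} {y} refl lt l m r) with x ≟ 1
  ... | yes refl = occ {X = X} {reverse Z} {reverse Y}
    (trans (after-split (Unique-head∉ X (uniq P))) (cong (λ t → X ++ 1 ∷ t) (reverse-split Y y Z))) lt l (reverse-All {Free R 2F x y} r) (reverse-All {Free R 1F x y} m)
  -- Otherwise the entry 1 itself would lie in row 0, whichever column it stands in.
  ... | no x≢1 = ⊥-elim (where-is-1 (occurs P (≤-refl , ≤-trans (proj₁ x-range) (proj₂ x-range))))
    where
    x-range : InRange n x
    x-range = All.lookup (bnd P) (∈-++⁺ʳ X (here refl))
    1<x : 1 < x
    1<x = ≤∧≢⇒< (proj₁ x-range) (x≢1 ∘ sym)
    where-is-1 : 1 ∈ X ++ x ∷ Y ++ y ∷ Z → ⊥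
    where-is-1 p with ∈-++⁻ X p
    ... | inj₁ q = absurd {R} full {zero} {x} {y} 1<x (All.lookup l q)
    ... | inj₂ (here e) = x≢1 (sym e)
    ... | inj₂ (there q) with ∈-++⁻ Y q
    ...   | inj₁ q′ = absurd {R} full {suc zero} {x} {y} 1<x (All.lookup m q′)
    ...   | inj₂ (here refl) = <-asym 1<x lt
    ...   | inj₂ (there q′) = absurd {R} full {2F} {x} {y} 1<x (All.lookup r q′)

-- Counting by prepending entries

bump : ℕ → ℕ → ℕ
bump c x = if x <ᵇ c then x else suc x

bump-< : ∀ {c x} → x < c → bump c x ≡ x
bump-< lt rewrite <ᵇ-true lt = refl

bump-≥ : ∀ {c x} → c ≤ x → bump c x ≡ suc x
bump-≥ le rewrite <ᵇ-false le = refl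

bump-mono-< : ∀ c {x y} → x < y → bump c x < bump c y
bump-mono-< c {x} {y} lt with x <? c | y <? c
... | yes p | yes q rewrite bump-< p | bump-< q = lt
... | yes p | no q rewrite bump-< p | bump-≥ (≮⇒≥ q) = m<n⇒m<1+n lt
... | no p | yes q = ⊥-elim (p (<-trans lt q))
... | no p | no q rewrite bump-≥ (≮⇒≥ p) | bump-≥ (≮⇒≥ q) = s≤s lt

bump-cancel-< : ∀ c {x y} → bump c x < bump c y → x < y
bump-cancel-< c {x} {y} lt with <-cmp x y
... | tri< p _ _ = p
... | tri≈ _ refl _ = ⊥-elim (<-irrefl refl lt)
... | tri> _ _ p = ⊥-elim (<-asym lt (bump-mono-< c p))

bump-injective : ∀ c {x y} → bump c x ≡ bump c y → x ≡ y
bump-injective c {x} {y} e with <-cmp x y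
... | tri< p _ _ = ⊥-elim (<⇒≢ (bump-mono-< c p) e)
... | tri≈ _ p _ = p
... | tri> _ _ p = ⊥-elim (>⇒≢ (bump-mono-< c p) e)

bump-<ᵇ : ∀ c x y → (bump c x <ᵇ bump c y) ≡ (x <ᵇ y)
bump-<ᵇ c x y with x <? y
... | yes p rewrite <ᵇ-true p = <ᵇ-true (bump-mono-< c p)
... | no p rewrite <ᵇ-false (≮⇒≥ p) = <ᵇ-false (≮⇒≥ λ q → p (bump-cancel-< c q))

zone-bump : ∀ c u v t → zone (bump c u) (bump c v) (bump c t) ≡ zone u v t
zone-bump c u v t rewrite bump-<ᵇ c t u | bump-<ᵇ c t v = refl

c<bump : ∀ {c x} → c ≤ x → c < bump c x
c<bump le rewrite bump-≥ le = s≤s le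

bump<c : ∀ {c x} → x < c → bump c x < c
bump<c lt rewrite bump-< lt = lt

c<bump⁻ : ∀ {c x} → c < bump c x → c ≤ x
c<bump⁻ {c} {x} lt = ≮⇒≥ λ p → <-asym lt (bump<c p)

bump≢c : ∀ {c x} → bump c x ≢ c
bump≢c {c} {x} e with x <? c
... | yes p = <⇒≢ (bump<c p) e
... | no p = >⇒≢ (c<bump (≮⇒≥ p)) e

bump-range : ∀ {n c x} → InRange n x → InRange (suc n) (bump c x)
bump-range {n} {c} {x} (x≥1 , x≤n) with x <? c
... | yes p rewrite bump-< p = x≥1 , m≤n⇒m≤1+n x≤n
... | no p rewrite bump-≥ (≮⇒≥ p) = s≤s z≤n , s≤s x≤n

unbump : ℕ → ℕ → ℕ
unbump c x = if x <ᵇ c then x else pred x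

bump-unbump : ∀ {c x} → 1 ≤ x → x ≢ c → bump c (unbump c x) ≡ x
bump-unbump {c} {suc x} _ ne with suc x <? c
... | yes p rewrite <ᵇ-true p = bump-< p
... | no p rewrite <ᵇ-false (≮⇒≥ p) = bump-≥ (≤-pred (≤∧≢⇒< (≮⇒≥ p) (ne ∘ sym)))

unbump-range : ∀ {n c x} → InRange (suc n) c → InRange (suc n) x → x ≢ c → InRange n (unbump c x)
unbump-range {n} {c} {suc x} (c≥1 , c≤) (_ , s≤s x≤n) ne with suc x <? c
... | yes p rewrite <ᵇ-true p = s≤s z≤n , ≤-pred (≤-trans p c≤)
... | no p rewrite <ᵇ-false (≮⇒≥ p) = ≤-trans c≥1 (≤-pred (≤∧≢⇒< (≮⇒≥ p) (ne ∘ sym))) , x≤n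

-- `c` is the rank of the new first entry among all entries. Every permutation of length n + 1
-- arises from exactly one rank and one permutation of length n.
child : ℕ → List ℕ → List ℕ
child c w = c ∷ map (bump c) w

child-perm : ∀ {n c w} → InRange (suc n) c → IsPerm n w → IsPerm (suc n) (child c w)
child-perm {n} {c} {w} rc (isPerm l b u) = isPerm (cong suc (trans (length-map (bump c) w) l))
  (rc ∷ All.map⁺ (All.map (λ {x} → bump-range {n} {c} {x}) b))
  (All.map⁺ (All.tabulate λ {x} _ e → bump≢c {c} {x} (sym e)) ∷ Unique.map⁺ (bump-injective c) u)

unchild : ∀ {n w} → IsPerm (suc n) w → ∃[ c ] ∃[ v ] InRange (suc n) c × IsPerm n v × w ≡ child c v
unchild {n} {c ∷ w} (isPerm l (rc ∷ b) (c∉ ∷ u)) =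
  c , map (unbump c) w , rc , isPerm (trans (length-map _ w) (suc-injective l)) bnd′ uniq′ , cong (c ∷_) (sym bumped)
  where
  fix : ∀ {x} → x ∈ w → bump c (unbump c x) ≡ x
  fix x∈ = bump-unbump (proj₁ (All.lookup b x∈)) (All.lookup c∉ x∈ ∘ sym)
  bnd′ : All (InRange n) (map (unbump c) w)
  bnd′ = All.map⁺ (All.tabulate λ x∈ → unbump-range rc (All.lookup b x∈) (All.lookup c∉ x∈ ∘ sym))
  uniq′ : Unique (map (unbump c) w)
  uniq′ = map-unique (unbump c) (λ p q e → trans (sym (fix p)) (trans (cong (bump c) e) (fix q))) u
  map-id′ : ∀ xs → (∀ {x} → x ∈ xs → bump c (unbump c x) ≡ x) → map (bump c) (map (unbump c) xs) ≡ xs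
  map-id′ [] _ = refl
  map-id′ (x ∷ xs) h = cong₂ _∷_ (h (here refl)) (map-id′ xs (h ∘ there))
  bumped : map (bump c) (map (unbump c) w) ≡ w
  bumped = map-id′ w fix

child-injective : ∀ {c d v w} → child c v ≡ child d w → c ≡ d × v ≡ w
child-injective {c} {d} {v} {w} e with ∷-injective e
... | refl , e′ = refl , map-injective (bump-injective c) e′

S-children : ∀ n → S (suc n) ↭ cartesianProductWith (λ w c → child c w) (S n) (upto1 (suc n))
S-children n = unique-same-↭ (S-unique (suc n))
  (Unique.cartesianProductWith⁺ _ (λ e → swap (child-injective e)) (S-unique n) (upto1-unique (suc n))) to from
  where
  to : S (suc n) ⊆ cartesianProductWith (λ w c → child c w) (S n) (upto1 (suc n))
  to w∈ with unchild (∈S⇒IsPerm {suc n} w∈)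
  ... | c , v , rc , V , refl = ∈-cartesianProductWith⁺ (λ w c → child c w) {S n} {upto1 (suc n)} (IsPerm⇒∈S V) (∈-upto1⁺ rc)
  from : cartesianProductWith (λ w c → child c w) (S n) (upto1 (suc n)) ⊆ S (suc n)
  from w∈ with ∈-cartesianProductWith⁻ (λ w c → child c w) (S n) (upto1 (suc n)) w∈
  ... | v , c , v∈ , c∈ , refl = IsPerm⇒∈S (child-perm (∈-upto1⁻ {suc n} c∈) (∈S⇒IsPerm {n} v∈))

-- The factors come in the other order: the machines sum over the ranks for a fixed permutation,
-- whereas the mirror argument for valleys sums over the permutations for a fixed first entry.
S-children′ : ∀ n → S (suc n) ↭ cartesianProductWith child (upto1 (suc n)) (S n)
S-children′ n = unique-same-↭ (S-unique (suc n))
  (Unique.cartesianProductWith⁺ _ child-injective (upto1-unique (suc n)) (S-unique n)) to from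
  where
  to : S (suc n) ⊆ cartesianProductWith child (upto1 (suc n)) (S n)
  to w∈ with unchild (∈S⇒IsPerm {suc n} w∈)
  ... | c , v , rc , V , refl = ∈-cartesianProductWith⁺ child {upto1 (suc n)} {S n} (∈-upto1⁺ rc) (IsPerm⇒∈S V)
  from : cartesianProductWith child (upto1 (suc n)) (S n) ⊆ S (suc n)
  from w∈ with ∈-cartesianProductWith⁻ child (upto1 (suc n)) (S n) w∈
  ... | c , v , c∈ , v∈ , refl = IsPerm⇒∈S (child-perm (∈-upto1⁻ {suc n} c∈) (∈S⇒IsPerm {n} v∈))

-- Sums over permutations and over ranks

sumOf : ∀ {A : Set} → List A → (A → ℕ) → ℕ
sumOf xs h = sum (map h xs)

sumOf-cong : ∀ {A : Set} {f g : A → ℕ} xs → (∀ {x} → x ∈ xs → f x ≡ g x) → sumOf xs f ≡ sumOf xs g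
sumOf-cong [] _ = refl
sumOf-cong (x ∷ xs) h = cong₂ _+_ (h (here refl)) (sumOf-cong xs (h ∘ there))

sumOf-↭ : ∀ {A : Set} {xs ys : List A} {h : A → ℕ} → xs ↭ ys → sumOf xs h ≡ sumOf ys h
sumOf-↭ {h = h} p = sum-↭ (↭.map⁺ h p)

sumOf-++ : ∀ {A : Set} xs ys {h : A → ℕ} → sumOf (xs ++ ys) h ≡ sumOf xs h + sumOf ys h
sumOf-++ xs ys {h} = trans (cong sum (map-++ h xs ys)) (sum-++ (map h xs) (map h ys))

sumOf-map : ∀ {A B : Set} (f : A → B) xs {h : B → ℕ} → sumOf (map f xs) h ≡ sumOf xs (h ∘ f)
sumOf-map f xs = cong sum (sym (map-∘ xs))

sumOf-product : ∀ {A B C : Set} (f : A → B → C) xs ys {h : C → ℕ} →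
  sumOf (cartesianProductWith f xs ys) h ≡ sumOf xs λ x → sumOf ys λ y → h (f x y)
sumOf-product f [] ys = refl
sumOf-product f (x ∷ xs) ys = trans (sumOf-++ (map (f x) ys) _) (cong₂ _+_ (sumOf-map (f x) ys) (sumOf-product f xs ys))

indicator : Bool → ℕ
indicator b = if b then 1 else 0

length-filterᵇ : ∀ {A : Set} (f : A → Bool) xs → length (filterᵇ f xs) ≡ sumOf xs (indicator ∘ f)
length-filterᵇ f [] = refl
length-filterᵇ f (x ∷ xs) with f x
... | true = cong suc (length-filterᵇ f xs)
... | false = length-filterᵇ f xs

∑ : ℕ → (ℕ → ℕ) → ℕ
∑ n = sumOf (upto1 n)

∑-cong : ∀ {n f g} → (∀ {c} → InRange n c → f c ≡ g c) → ∑ n f ≡ ∑ n g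
∑-cong {n} h = sumOf-cong (upto1 n) λ c∈ → h (∈-upto1⁻ c∈)

upto1-suc : ∀ n → upto1 (suc n) ≡ 1 ∷ map suc (upto1 n)
upto1-suc n = cong (λ t → 1 ∷ map suc t) (sym (map-upTo suc n))

∑-suc : ∀ n f → ∑ (suc n) f ≡ f 1 + ∑ n (f ∘ suc)
∑-suc n f = trans (cong (λ t → sumOf t f) (upto1-suc n)) (cong (f 1 +_) (sumOf-map suc (upto1 n)))

∑-+ : ∀ m n f → ∑ (m + n) f ≡ ∑ m f + ∑ n (λ c → f (m + c))
∑-+ zero n f = refl
∑-+ (suc m) n f = trans (∑-suc (m + n) f) (trans (cong (f 1 +_) (∑-+ m n (f ∘ suc)))
  (trans (sym (+-assoc (f 1) _ _)) (cong (_+ ∑ n (λ c → f (suc m + c))) (sym (∑-suc m f)))))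

∑-last : ∀ n f → ∑ (suc n) f ≡ ∑ n f + f (suc n)
∑-last n f = trans (cong (λ t → ∑ t f) (+-comm 1 n)) (trans (∑-+ n 1 f)
  (cong (∑ n f +_) (trans (+-identityʳ _) (cong f (+-comm n 1)))))

∑-const : ∀ n k → ∑ n (λ _ → k) ≡ n * k
∑-const zero k = refl
∑-const (suc n) k = trans (∑-suc n (λ _ → k)) (cong (k +_) (∑-const n k))

∑-mirror : ∀ n f → ∑ n (f ∘ mirror n) ≡ ∑ n f
∑-mirror n f = trans (sym (sumOf-map (mirror n) (upto1 n) {f})) (sumOf-↭ {h = f} (↭upto1 (table-perm {n} mirror-perm)))

sumOf-S : ∀ n {h} → sumOf (S (suc n)) h ≡ sumOf (S n) λ w → ∑ (suc n) λ c → h (child c w)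
sumOf-S n {h} = trans (sumOf-↭ {h = h} (S-children n)) (sumOf-product (λ w c → child c w) (S n) (upto1 (suc n)) {h})

sumOf-S′ : ∀ n {h} → sumOf (S (suc n)) h ≡ ∑ (suc n) λ c → sumOf (S n) λ w → h (child c w)
sumOf-S′ n {h} = trans (sumOf-↭ {h = h} (S-children′ n)) (sumOf-product child (upto1 (suc n)) (S n) {h})

-- Counting avoiders by states

descendants : Shading → ℕ → List ℕ → ℕ
descendants R zero w = indicator (avoidsᵇ (p12 , R) (length w) w)
descendants R (suc k) w = ∑ (suc (length w)) λ c → descendants R k (child c w)

-- Each permutation of length k + n arises exactly once from one of length n by k prependings. For n
-- = 0 the whole count starts from the empty word.
s-descendants : ∀ R k n → s (k + n) (p12 , R) ≡ sumOf (S n) (descendants R k)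
s-descendants R zero n = trans (length-filterᵇ (avoidsᵇ (p12 , R) n) (S n))
  (sumOf-cong (S n) λ {w} w∈ → cong (λ m → indicator (avoidsᵇ (p12 , R) m w)) (sym (len (∈S⇒IsPerm {n} w∈))))
s-descendants R (suc k) n = trans (cong (λ m → s m (p12 , R)) (sym (+-suc k n))) (trans (s-descendants R k (suc n))
  (trans (sumOf-S n {descendants R k}) (sumOf-cong (S n) λ {w} w∈ → cong (λ m → ∑ (suc m) λ c → descendants R k (child c w)) (sym (len (∈S⇒IsPerm {n} w∈))))))

-- `next h q` stands for the sum of `h` over the successors of `q`. As a functional it can collect
-- equal successors with a multiplicity.
record Machine : Set₁ where
  field
    State  : Set
    accept : State → Bool
    next   : (State → ℕ) → State → ℕ

  run : ℕ → State → ℕ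
  run zero q = indicator (accept q)
  run (suc k) q = next (run k) q

-- `g` tells which rank leads to which state, and this may differ between two patterns. Since the
-- equation holds for every `h`, the multiset of successors depends on `q` alone, and that is what
-- the two patterns share.
Steps : (M : Machine) → (ℕ → List ℕ → Machine.State M → Set) → ℕ → List ℕ → Machine.State M → Set
Steps M Rel n w q = Σ (ℕ → State) λ g →
  (∀ {c} → InRange (suc n) c → Rel (suc n) (child c w) (g c)) × (∀ h → ∑ (suc n) (h ∘ g) ≡ next h q)
  where open Machine M

record Simulation (M : Machine) (R : Shading) : Set₁ where
  open Machine M
  field
    Rel     : ℕ → List ℕ → State → Set
    sound   : ∀ {n w q} → IsPerm n w → Rel n w q → accept q ≡ true → ¬ Occ R w
    complete : ∀ {n w q} → IsPerm n w → Rel n w q → accept q ≡ false → Occ R w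
    step    : ∀ {n w q} → IsPerm n w → Rel n w q → Steps M Rel n w q
    start   : State
    initial : Rel 0 [] start

  descendants-run : ∀ k {n w q} → IsPerm n w → Rel n w q → descendants R k w ≡ run k q
  descendants-run zero {n} {w} {q} P r with len P
  ... | refl with accept q in eq | containsᵇ (p12 , R) (length w) w in eq′
  ...   | true | false = refl
  ...   | false | true = refl
  ...   | true | true = ⊥-elim (sound P r eq (contains⇒occ P eq′))
  ...   | false | false with () ← trans (sym (occ⇒contains P (complete P r eq))) eq′
  descendants-run (suc k) {n} {w} P r with len P
  ... | refl with step P r
  ...   | g , rel , nx = trans (∑-cong λ rc → descendants-run k (child-perm rc P) (rel rc)) (nx (run k))

  s-run : ∀ n → s n (p12 , R) ≡ run n start
  s-run n = trans (cong (λ m → s m (p12 , R)) (sym (+-identityʳ n))) (trans (s-descendants R n 0)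
    (trans (+-identityʳ _) (descendants-run n (isPerm refl [] []) initial)))

~-simulation : ∀ {M R R′} (A : Simulation M R) (B : Simulation M R′) → Simulation.start A ≡ Simulation.start B → R ~ R′
~-simulation {M} A B e n = trans (Simulation.s-run A n) (trans (cong (Machine.run M n) e) (sym (Simulation.s-run B n)))

-- The effect of a prepended entry on occurrences

record OccAt (R : Shading) (x y : ℕ) (w : List ℕ) : Set where
  constructor occAt
  field
    {X Y Z} : List ℕ
    split   : w ≡ X ++ x ∷ Y ++ y ∷ Z
    x<y     : x < y
    left    : All (Free R zero x y) X
    mid     : All (Free R 1F x y) Y
    right   : All (Free R 2F x y) Z

occ⇒occAt : ∀ {R w} → Occ R w → ∃[ x ] ∃[ y ] OccAt R x y w
occ⇒occAt (occ e lt l m r) = _ , _ , occAt e lt l m r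

occAt⇒occ : ∀ {R w x y} → OccAt R x y w → Occ R w
occAt⇒occ (occAt e lt l m r) = occ e lt l m r

occAt-∈ : ∀ {R w x y} → OccAt R x y w → x ∈ w × y ∈ w
occAt-∈ (occAt {X} {Y} refl _ _ _ _) = ∈-++⁺ʳ X (here refl) , ∈-++⁺ʳ X (there (∈-++⁺ʳ Y (here refl)))

-- Prepending c to w creates an occurrence with second entry y; here c is read as the gap below the entry c of w.
record Head (R : Shading) (c y : ℕ) (w : List ℕ) : Set where
  constructor head
  field
    {Y Z} : List ℕ
    split : w ≡ Y ++ y ∷ Z
    c≤y   : c ≤ y
    mid   : All (Free R 1F c y) Y
    right : All (Free R 2F c y) Z

bump-<ᵇ-gap : ∀ c e → (bump c e <ᵇ c) ≡ (e <ᵇ c)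
bump-<ᵇ-gap c e with e <? c
... | yes p rewrite <ᵇ-true p = <ᵇ-true p
... | no p rewrite <ᵇ-false (≮⇒≥ p) = <ᵇ-false (m≤n⇒m≤1+n (≮⇒≥ p))

-- Prepending turns the gap `c` into the entry `c`, while the entries from `c` on move up; comparing
-- with the gap before is comparing with the entry after.
zone-gap : ∀ {c y} e → c ≤ y → zone c (bump c y) (bump c e) ≡ zone c y e
zone-gap {c} {y} e c≤y rewrite bump-<ᵇ-gap c e | bump-<ᵇ c e y = refl

map-All⁺ : ∀ {P Q : ℕ → Set} (f : ℕ → ℕ) → (∀ e → P e → Q (f e)) → ∀ {w} → All P w → All Q (map f w)
map-All⁺ f h ps = All.map⁺ (All.map (λ {e} → h e) ps)

map-All⁻ : ∀ {P Q : ℕ → Set} (f : ℕ → ℕ) → (∀ e → Q (f e) → P e) → ∀ {w} → All Q (map f w) → All P w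
map-All⁻ f h ps = All.map (λ {e} → h e) (All.map⁻ ps)

map-split : ∀ (f : ℕ → ℕ) w {Y y Z} → map f w ≡ Y ++ y ∷ Z →
  ∃[ Y₀ ] ∃[ y₀ ] ∃[ Z₀ ] w ≡ Y₀ ++ y₀ ∷ Z₀ × Y ≡ map f Y₀ × y ≡ f y₀ × Z ≡ map f Z₀
map-split f [] {[]} ()
map-split f [] {_ ∷ _} ()
map-split f (x ∷ w) {[]} e with ∷-injective e
... | refl , refl = [] , x , w , refl , refl , refl , refl
map-split f (x ∷ w) {_ ∷ Y} e with ∷-injective e
... | refl , e′ with map-split f w e′
... | Y₀ , y₀ , Z₀ , refl , refl , refl , refl = x ∷ Y₀ , y₀ , Z₀ , refl , refl , refl , refl

head⇒occAt : ∀ {R c y w} → Head R c y w → OccAt R c (bump c y) (child c w)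
head⇒occAt {R} {c} {y} (head {Y} {Z} refl le m r) = occAt {X = []} {map (bump c) Y} {map (bump c) Z}
  (cong (c ∷_) (map-++ (bump c) Y (y ∷ Z))) (c<bump le) []
  (map-All⁺ (bump c) (λ e → trans (cong (R _) (zone-gap e le))) m) (map-All⁺ (bump c) (λ e → trans (cong (R _) (zone-gap e le))) r)

occAt-child⁺ : ∀ {R c x y w} → R zero (zone (bump c x) (bump c y) c) ≡ false → OccAt R x y w → OccAt R (bump c x) (bump c y) (child c w)
occAt-child⁺ {R} {c} {x} {y} fr (occAt {X} {Y} {Z} refl lt l m r) =
  occAt {X = c ∷ map (bump c) X} {map (bump c) Y} {map (bump c) Z}
    (cong (c ∷_) (trans (map-++ (bump c) X _) (cong (λ t → map (bump c) X ++ bump c x ∷ t) (map-++ (bump c) Y (y ∷ Z)))))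
    (bump-mono-< c lt) (fr ∷ map-All⁺ (bump c) (λ e → trans (cong (R _) (zone-bump c x y e))) l)
    (map-All⁺ (bump c) (λ e → trans (cong (R _) (zone-bump c x y e))) m) (map-All⁺ (bump c) (λ e → trans (cong (R _) (zone-bump c x y e))) r)

-- Being first, the prepended entry can only be the first point of an occurrence. In every old
-- occurrence it stands in column 0, so a single box decides whether that occurrence survives.
data ChildOcc (R : Shading) (c : ℕ) (w : List ℕ) : ℕ → ℕ → Set where
  new       : ∀ {y} → Head R c y w → ChildOcc R c w c (bump c y)
  inherited : ∀ {x y} → R zero (zone (bump c x) (bump c y) c) ≡ false → OccAt R x y w → ChildOcc R c w (bump c x) (bump c y)

occAt-child⁻ : ∀ {R c u v w} → OccAt R u v (child c w) → ChildOcc R c w u v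
occAt-child⁻ {R} {c} {u} {v} {w} (occAt {[]} {Y} e lt _ m r) with ∷-injective e
... | refl , e′ with map-split (bump c) w e′
... | Y₀ , y₀ , Z₀ , refl , refl , refl , refl = new (head refl le
    (map-All⁻ (bump c) (λ e → trans (cong (R _) (sym (zone-gap e le)))) m) (map-All⁻ (bump c) (λ e → trans (cong (R _) (sym (zone-gap e le)))) r))
  where
  le = c<bump⁻ lt
occAt-child⁻ {R} {c} {u} {v} {w} (occAt {_ ∷ X} {Y} e lt (fr ∷ l) m r) with ∷-injective e
... | refl , e′ with map-split (bump c) w e′
... | X₀ , x₀ , r₀ , refl , refl , refl , e″ with map-split (bump c) r₀ (sym e″)
... | Y₀ , y₀ , Z₀ , refl , refl , refl , refl = inherited fr (occAt refl (bump-cancel-< c lt)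
  (map-All⁻ (bump c) (λ e → trans (cong (R _) (sym (zone-bump c x₀ y₀ e)))) l) (map-All⁻ (bump c) (λ e → trans (cong (R _) (sym (zone-bump c x₀ y₀ e)))) m) (map-All⁻ (bump c) (λ e → trans (cong (R _) (sym (zone-bump c x₀ y₀ e)))) r))

occAt-range : ∀ {R n w x y} → IsPerm n w → OccAt R x y w → InRange n x × InRange n y
occAt-range P o = All.lookup (bnd P) (proj₁ (occAt-∈ o)) , All.lookup (bnd P) (proj₂ (occAt-∈ o))

¬occ-[] : ∀ {R} → ¬ Occ R []
¬occ-[] (occ {[]} () _ _ _ _)
¬occ-[] (occ {_ ∷ _} () _ _ _ _)

¬head-[] : ∀ {R c y} → ¬ Head R c y []
¬head-[] (head {[]} () _ _ _)
¬head-[] (head {_ ∷ _} () _ _ _)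

zone-c-below : ∀ {c x y} → c ≤ x → x < y → zone (bump c x) (bump c y) c ≡ zero
zone-c-below {c} {x} {y} le lt = zone-below {bump c x} {bump c y} (c<bump le)

zone-c-middle : ∀ {c x y} → x < c → c ≤ y → zone (bump c x) (bump c y) c ≡ 1F
zone-c-middle lt le = zone-middle (<⇒≤ (bump<c lt)) (c<bump le)

zone-c-above : ∀ {c x y} → x < y → y < c → zone (bump c x) (bump c y) c ≡ 2F
zone-c-above {c} xy lt = zone-above (<⇒≤ (bump-mono-< c xy)) (<⇒≤ (bump<c lt))

∑-interval : ∀ x k r {f A B} → (∀ {c} → 1 ≤ c → c ≤ x → f c ≡ B) → (∀ {c} → x < c → c ≤ x + k → f c ≡ A) →
  (∀ {c} → x + k < c → c ≤ x + (k + r) → f c ≡ B) → ∑ (x + (k + r)) f ≡ k * A + (x + r) * B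
∑-interval x k r {f} {A} {B} h₁ h₂ h₃ = begin
  ∑ (x + (k + r)) f
    ≡⟨ trans (∑-+ x (k + r) f) (cong (∑ x f +_) (∑-+ k r _)) ⟩
  ∑ x f + (∑ k (λ c → f (x + c)) + ∑ r (λ c → f (x + (k + c))))
    ≡⟨ cong₂ _+_ (trans (∑-cong (λ (p , q) → h₁ p q)) (∑-const x B)) (cong₂ _+_
        (trans (∑-cong (λ (p , q) → h₂ (m<m+n x p) (+-monoʳ-≤ x q))) (∑-const k A))
        (trans (∑-cong (λ {c} (p , q) → h₃ (subst (x + k <_) (+-assoc x k c) (m<m+n (x + k) p)) (+-monoʳ-≤ x (+-monoʳ-≤ k q)))) (∑-const r B))) ⟩
  x * B + (k * A + r * B)
    ≡⟨ trans (sym (+-assoc (x * B) _ _)) (trans (cong (_+ r * B) (+-comm (x * B) (k * A))) (+-assoc (k * A) _ _)) ⟩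
  k * A + (x * B + r * B)
    ≡⟨ cong (k * A +_) (sym (*-distribʳ-+ B x r)) ⟩
  k * A + (x + r) * B ∎
  where open ≡-Reasoning

∑-single : ∀ {m d f A B} → InRange (suc m) d → f d ≡ A → (∀ {c} → c ≢ d → f c ≡ B) → ∑ (suc m) f ≡ A + m * B
∑-single {m} {suc x} {f} {A} {B} (_ , s≤s x≤m) at other with m≤n⇒∃[o]m+o≡n x≤m
... | r , x+r = trans (cong (λ k → ∑ k f) (sym (trans (+-suc x r) (cong suc x+r)))) (trans
  (∑-interval x 1 r (λ _ le → other (<⇒≢ (s≤s le))) (λ {c} lt le → trans (cong f (≤-antisym (subst (c ≤_) (+-comm x 1) le) lt)) at)
    (λ {c} lt _ → other (>⇒≢ (subst (_< c) (+-comm x 1) lt))))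
  (cong₂ _+_ (+-identityʳ A) (cong (_* B) x+r)))

-- Row by row from the top, each row from left to right.
shading : (t₀ t₁ t₂ m₀ m₁ m₂ b₀ b₁ b₂ : Bool) → Shading
shading t₀ t₁ t₂ m₀ m₁ m₂ b₀ b₁ b₂ zero             zero             = b₀
shading t₀ t₁ t₂ m₀ m₁ m₂ b₀ b₁ b₂ zero             1F       = m₀
shading t₀ t₁ t₂ m₀ m₁ m₂ b₀ b₁ b₂ zero             2F = t₀
shading t₀ t₁ t₂ m₀ m₁ m₂ b₀ b₁ b₂ 1F       zero             = b₁
shading t₀ t₁ t₂ m₀ m₁ m₂ b₀ b₁ b₂ 1F       1F       = m₁
shading t₀ t₁ t₂ m₀ m₁ m₂ b₀ b₁ b₂ 1F       2F = t₁
shading t₀ t₁ t₂ m₀ m₁ m₂ b₀ b₁ b₂ 2F zero             = b₂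
shading t₀ t₁ t₂ m₀ m₁ m₂ b₀ b₁ b₂ 2F 1F       = m₂
shading t₀ t₁ t₂ m₀ m₁ m₂ b₀ b₁ b₂ 2F 2F = t₂

pattern ■ = true
pattern □ = false

data GapView (c y e : ℕ) : Set where
  below  : e < c → zone c y e ≡ zero → GapView c y e
  middle : c ≤ e → e < y → zone c y e ≡ 1F → GapView c y e
  above  : y ≤ e → zone c y e ≡ 2F → GapView c y e

gapView : ∀ {c y} e → c ≤ y → GapView c y e
gapView {c} {y} e c≤y with e <? c | e <? y
... | yes p | _ = below p (zone-below {c} {y} p)
... | no p | yes q = middle (≮⇒≥ p) q (zone-middle (≮⇒≥ p) q)
... | no p | no q = above (≮⇒≥ q) (zone-above c≤y (≮⇒≥ q))


bump-mono-≤ : ∀ c {x y} → x ≤ y → bump c x ≤ bump c y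
bump-mono-≤ c le = [ (λ lt → <⇒≤ (bump-mono-< c lt)) , (λ { refl → ≤-refl }) ]′ (m≤n⇒m<n∨m≡n le)

perm-split : ∀ {n w v} → IsPerm n w → InRange n v → ∃[ Y ] ∃[ Z ] w ≡ Y ++ v ∷ Z ×
  All (λ e → InRange n e × e ≢ v) Y × All (λ e → InRange n e × e ≢ v) Z
perm-split {n} {w} {v} P rv with ∈-∃++ (occurs P rv)
... | Y , Z , refl with ↭.All-resp-↭ (↭.shift v Y Z) (bnd P) | Unique-resp-↭ (↭.shift v Y Z) (uniq P)
... | _ ∷ b | v∉ ∷ _ = Y , Z , refl , All.++⁻ˡ Y both , All.++⁻ʳ Y both
  where
  both : All (λ e → InRange n e × e ≢ v) (Y ++ Z)
  both = All.zip (b , All.map (λ ne e → ne (sym e)) v∉)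

head-∈ : ∀ {R c y w e} → Head R c y w → e ∈ w → e ≡ y ⊎ Free R 1F c y e ⊎ Free R 2F c y e
head-∈ (head {Y} refl _ m r) e∈ with ∈-++⁻ Y e∈
... | inj₁ p = inj₂ (inj₁ (All.lookup m p))
... | inj₂ (here e) = inj₁ e
... | inj₂ (there p) = inj₂ (inj₂ (All.lookup r p))

head-y∈ : ∀ {R c y w} → Head R c y w → y ∈ w
head-y∈ (head {Y} refl _ _ _) = ∈-++⁺ʳ Y (here refl)

-- In state (n , just k) an occurrence is present, and exactly k of the possible prependings destroy all occurrences;
-- in state (n , nothing) there is none, and a single prepending creates one, with k = size n.
pendingInterval : (ℕ → ℕ) → Machine
pendingInterval size = record { State = ℕ × Maybe ℕ ; accept = λ (_ , p) → is-nothing p ; next = next }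
  where
  next : (ℕ × Maybe ℕ → ℕ) → ℕ × Maybe ℕ → ℕ
  next h (n , just k) = k * h (suc n , nothing) + (suc n ∸ k) * h (suc n , just k)
  next h (zero , nothing) = h (1 , nothing)
  next h (suc n , nothing) = h (suc (suc n) , just (size (suc n))) + suc n * h (suc (suc n) , nothing)

-- The ranks in (x, x + k] destroy everything and create nothing; all others leave an obstruction
-- with the same `k`. The place `x` of the interval is not recorded in the state, since only its
-- length enters the count.
Interval : Shading → (ℕ → List ℕ → ℕ → Set) → ℕ → List ℕ → ℕ → Set
Interval R Pend n w k = ∃[ x ] ∃[ r ] x + (k + r) ≡ suc n ×
  (∀ {c} → x < c → c ≤ x + k → ¬ Occ R (child c w)) ×
  (∀ {c} → InRange (suc n) c → c ≤ x ⊎ x + k < c → Pend (suc n) (child c w) k)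

-- Creation is tracked only while there is no occurrence. With one pending, `pend-step` includes
-- that a further occurrence does not alter the number `k`.
record IntervalModel (size : ℕ → ℕ) (R : Shading) : Set₁ where
  field
    Pend       : ℕ → List ℕ → ℕ → Set
    pend⇒occ   : ∀ {n w k} → Pend n w k → Occ R w
    pend-step  : ∀ {n w k} → IsPerm n w → Pend n w k → Interval R Pend n w k
    creator    : List ℕ → ℕ
    creator-range : ∀ {n w} → IsPerm (suc n) w → InRange (suc (suc n)) (creator w)
    created    : ∀ {n w} → IsPerm (suc n) w → ¬ Occ R w → Pend (suc (suc n)) (child (creator w) w) (size (suc n))
    head⇒creator : ∀ {n w c y} → IsPerm (suc n) w → InRange (suc (suc n)) c → Head R c y w → c ≡ creator w

  Rel : ℕ → List ℕ → ℕ × Maybe ℕ → Set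
  Rel n w (m , nothing) = m ≡ n × ¬ Occ R w
  Rel n w (m , just k) = m ≡ n × Pend n w k

  no-new : ∀ {c w} → ¬ Occ R w → (∀ {y} → ¬ Head R c y w) → ¬ Occ R (child c w)
  no-new no-occ no-head o with occ⇒occAt o
  ... | _ , _ , o′ with occAt-child⁻ o′
  ...   | new h = no-head h
  ...   | inherited _ o″ = no-occ (occAt⇒occ o″)

  step : ∀ {n w q} → IsPerm n w → Rel n w q → Steps (pendingInterval size) Rel n w q
  step {zero} {[]} {_ , nothing} P (refl , no-occ) = (λ _ → 1 , nothing) , (λ _ → refl , no-new no-occ ¬head-[]) , λ h → +-identityʳ _
  step {suc n} {w} {_ , nothing} P (refl , no-occ) = g , rel , λ h → ∑-single (creator-range P) (cong h at) (λ ne → cong h (other ne))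
    where
    g : ℕ → ℕ × Maybe ℕ
    g c = suc (suc n) , (if ⌊ c ≟ creator w ⌋ then just (size (suc n)) else nothing)
    rel : ∀ {c} → InRange (suc (suc n)) c → Rel (suc (suc n)) (child c w) (g c)
    rel {c} rc with c ≟ creator w
    ... | yes refl = refl , created P no-occ
    ... | no ne = refl , no-new no-occ λ h → ne (head⇒creator P rc h)
    at : g (creator w) ≡ (suc (suc n) , just (size (suc n)))
    at with creator w ≟ creator w
    ... | yes _ = refl
    ... | no ne = ⊥-elim (ne refl)
    other : ∀ {c} → c ≢ creator w → g c ≡ (suc (suc n) , nothing)
    other {c} ne with c ≟ creator w
    ... | yes e = ⊥-elim (ne e)
    ... | no _ = refl
  step {n} {w} {_ , just k} P (refl , p) with pend-step P p
  ... | x , r , x+k+r , inside , outside = g , rel , total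
    where
    g : ℕ → ℕ × Maybe ℕ
    g c = suc n , (if ⌊ (x <? c) ×-dec (c ≤? x + k) ⌋ then nothing else just k)
    rel : ∀ {c} → InRange (suc n) c → Rel (suc n) (child c w) (g c)
    rel {c} rc with x <? c | c ≤? x + k
    ... | yes lt | yes le = refl , inside lt le
    ... | yes _ | no gt = refl , outside rc (inj₂ (≰⇒> gt))
    ... | no le | _ = refl , outside rc (inj₁ (≮⇒≥ le))
    at-in : ∀ {c} → x < c → c ≤ x + k → g c ≡ (suc n , nothing)
    at-in {c} lt le with x <? c | c ≤? x + k
    ... | yes _ | yes _ = refl
    ... | yes _ | no q = ⊥-elim (q le)
    ... | no q | _ = ⊥-elim (q lt)
    at-low : ∀ {c} → c ≤ x → g c ≡ (suc n , just k)
    at-low {c} le with x <? c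
    ... | yes q = ⊥-elim (<⇒≱ q le)
    ... | no _ = refl
    at-high : ∀ {c} → x + k < c → g c ≡ (suc n , just k)
    at-high {c} lt with x <? c | c ≤? x + k
    ... | yes _ | yes q = ⊥-elim (<⇒≱ lt q)
    ... | yes _ | no _ = refl
    ... | no _ | _ = refl
    rest : x + r ≡ suc n ∸ k
    rest = sym (trans (cong (_∸ k) (trans (sym x+k+r) (trans (sym (+-assoc x k r)) (trans (cong (_+ r) (+-comm x k)) (+-assoc k x r))))) (m+n∸m≡n k (x + r)))
    total : ∀ h → ∑ (suc n) (h ∘ g) ≡ k * h (suc n , nothing) + (suc n ∸ k) * h (suc n , just k)
    total h = trans (cong (λ m → ∑ m (h ∘ g)) (sym x+k+r)) (trans
      (∑-interval x k r (λ _ q → cong h (at-low q)) (λ p q → cong h (at-in p q)) (λ p _ → cong h (at-high p)))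
      (cong (λ m → k * h (suc n , nothing) + m * h (suc n , just k)) rest))

  simulation : Simulation (pendingInterval size) R
  simulation = record { Rel = Rel ; sound = sound ; complete = complete ; step = step ; start = 0 , nothing ; initial = refl , ¬occ-[] }
    where
    sound : ∀ {n w q} → IsPerm n w → Rel n w q → is-nothing (proj₂ q) ≡ true → ¬ Occ R w
    sound {q = _ , nothing} _ (_ , no-occ) _ = no-occ
    complete : ∀ {n w q} → IsPerm n w → Rel n w q → is-nothing (proj₂ q) ≡ false → Occ R w
    complete {q = _ , just _} _ (_ , p) _ = pend⇒occ p

-- With column 0 unshaded, prepending preserves occurrences.
permanent : ∀ {R} → (∀ b → R zero b ≡ false) → (creator : List ℕ → ℕ) →
  (∀ {n w} → IsPerm (suc n) w → InRange (suc (suc n)) (creator w)) →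
  (∀ {n w} → IsPerm (suc n) w → ∃[ y ] Head R (creator w) y w) →
  (∀ {n w c y} → IsPerm (suc n) w → InRange (suc (suc n)) c → Head R c y w → c ≡ creator w) → IntervalModel (λ _ → 0) R
permanent {R} free creator range′ creates unique = record
  { Pend = Pend ; pend⇒occ = proj₂ ; pend-step = pend-step ; creator = creator ; creator-range = range′
  ; created = λ P _ → refl , occAt⇒occ (head⇒occAt (proj₂ (creates P))) ; head⇒creator = unique }
  where
  Pend : ℕ → List ℕ → ℕ → Set
  Pend n w k = k ≡ 0 × Occ R w
  pend-step : ∀ {n w k} → IsPerm n w → Pend n w k → Interval R Pend n w k
  pend-step {n} {w} P (refl , o) with occ⇒occAt o
  ... | _ , _ , o′ = suc n , 0 , +-identityʳ (suc n) ,
    (λ lt le → ⊥-elim (<⇒≱ lt (≤-trans le (≤-reflexive (+-identityʳ (suc n)))))) , λ _ _ → refl , occAt⇒occ (occAt-child⁺ (free _) o′)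

-- Pairs with a single creating rank

headOr : List ℕ → ℕ
headOr [] = 0
headOr (x ∷ _) = x

stepShading minShading : Shading
stepShading = shading □ ■ □  □ ■ ■  □ ■ □
minShading  = shading □ ■ □  □ ■ □  □ ■ ■

-- Column 1 is fully shaded, so a new occurrence uses the first two entries of the child. For
-- `stepShading` no later value may lie between them, so the new entry is one less than its
-- neighbour; for `minShading` no later value may lie below it, so it is 1. Either way exactly one
-- rank creates, and column 0 is unshaded, so no occurrence is ever destroyed.
stepShading~minShading : stepShading ~ minShading
stepShading~minShading = ~-simulation (IntervalModel.simulation stepModel) (IntervalModel.simulation minModel) refl
  where
  1∈ : ∀ {n w} → IsPerm (suc n) w → 1 ∈ w
  1∈ P = occurs P (≤-refl , s≤s z≤n)
  stepModel : IntervalModel (λ _ → 0) stepShading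
  stepModel = permanent (λ { zero → refl ; 1F → refl ; 2F → refl })
    headOr
    (λ { {w = x ∷ w} (isPerm _ ((p , q) ∷ _) _) → p , m≤n⇒m≤1+n q })
    (λ { {w = x ∷ w} P → x , head {Y = []} refl ≤-refl [] (All.tabulate λ {e} _ → free x e) })
    unique
    where
    free : ∀ x e → Free stepShading 2F x x e
    free x e with gapView {x} {x} e ≤-refl
    ... | below _ z rewrite z = refl
    ... | middle p q _ = ⊥-elim (<⇒≱ q p)
    ... | above _ z rewrite z = refl
    unique : ∀ {n w c y} → IsPerm (suc n) w → InRange (suc (suc n)) c → Head stepShading c y w → c ≡ headOr w
    unique {n} {x ∷ w} {c} P (c≥1 , _) (head {[]} refl le _ r) with m≤n⇒m<n∨m≡n le
    ... | inj₂ e = e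
    ... | inj₁ lt with occurs P (c≥1 , ≤-trans le (proj₂ (All.head (bnd P))))
    ...   | here e = ⊥-elim (<⇒≢ lt e)
    ...   | there c∈ with gapView {c} {x} c le | All.lookup r c∈
    ...     | below p _ | _ = ⊥-elim (<-irrefl refl p)
    ...     | above p _ | _ = ⊥-elim (<⇒≱ lt p)
    ...     | middle _ _ z | fr rewrite z with () ← fr
    unique {c = c} {y} P _ (head {e ∷ _} refl le (m ∷ _) _) with gapView {c} {y} e le
    ... | below _ z rewrite z with () ← m
    ... | middle _ _ z rewrite z with () ← m
    ... | above _ z rewrite z with () ← m
  minModel : IntervalModel (λ _ → 0) minShading
  minModel = permanent (λ { zero → refl ; 1F → refl ; 2F → refl })
    (λ _ → 1)
    (λ _ → ≤-refl , s≤s z≤n)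
    (λ { {w = x ∷ w} (isPerm _ ((x≥1 , _) ∷ b) _) → x , head {Y = []} refl x≥1 [] (All.map (λ {e} (e≥1 , _) → free x≥1 e≥1) b) })
    unique
    where
    free : ∀ {x e} → 1 ≤ x → 1 ≤ e → Free minShading 2F 1 x e
    free {x} {e} x≥1 e≥1 with gapView {1} {x} e x≥1
    ... | below p z = ⊥-elim (<⇒≱ p e≥1)
    ... | middle p q z rewrite z = refl
    ... | above _ z rewrite z = refl
    unique : ∀ {n w c y} → IsPerm (suc n) w → InRange (suc (suc n)) c → Head minShading c y w → c ≡ 1
    unique {n} {x ∷ w} {c} P (c≥1 , _) (head {[]} refl le _ r) with m≤n⇒m<n∨m≡n c≥1
    ... | inj₂ e = sym e
    ... | inj₁ lt with 1∈ P
    ...   | here refl = ⊥-elim (<⇒≱ lt le)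
    ...   | there 1∈w with gapView {c} {x} 1 le | All.lookup r 1∈w
    ...     | middle p _ _ | _ = ⊥-elim (<⇒≱ lt p)
    ...     | above p _ | _ = ⊥-elim (<⇒≱ lt (≤-trans le p))
    ...     | below _ z | fr rewrite z with () ← fr
    unique {c = c} {y} P _ (head {e ∷ _} refl le (m ∷ _) _) with gapView {c} {y} e le
    ... | below _ z rewrite z with () ← m
    ... | middle _ _ z rewrite z with () ← m
    ... | above _ z rewrite z with () ← m

-- An occurrence of `sumShading` cuts the permutation into a direct sum, its first point ending the
-- lower summand and its second being the least entry of the upper one. An occurrence of
-- `blockShading` says that the entries from the first point on fill an interval of values, the
-- first point being the least of them and the second the greatest.
sumShading blockShading : Shading
sumShading   = shading ■ □ □  □ ■ ■  □ ■ ■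
blockShading = shading □ ■ ■  ■ □ □  □ ■ ■

-- To the right of the first point row 0 is shaded in both patterns, so only the rank 1 creates. If
-- `w` has length n, a fresh occurrence in the child is destroyed by n ranks: those above the entry
-- 2 for `sumShading`, and those from 2 to n + 1 for `blockShading`.
sumShading~blockShading : sumShading ~ blockShading
sumShading~blockShading = ~-simulation (IntervalModel.simulation sumModel) (IntervalModel.simulation blockModel) refl
  where
  sumModel : IntervalModel id sumShading
  sumModel = record
    { Pend = Pend ; pend⇒occ = λ (_ , _ , o , _) → occAt⇒occ o ; pend-step = pend-step
    ; creator = λ _ → 1 ; creator-range = λ _ → ≤-refl , s≤s z≤n ; created = fresh
    ; head⇒creator = λ P (c≥1 , _) h → ≤-antisym (≮⇒≥ λ gt → no-head P gt h) c≥1 }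
    where
    -- The occurrence with the greatest second value decides: the ranks above that value destroy all
    -- the others as well.
    Pend : ℕ → List ℕ → ℕ → Set
    Pend n w k = ∃[ x ] ∃[ y ] OccAt sumShading x y w × (∀ {u v} → OccAt sumShading u v w → v ≤ y) × y + k ≡ suc n
    head-1 : ∀ {n w c y} → IsPerm n w → Head sumShading c y w → y ≡ 1
    head-1 {n} {w} {c} {y} P h with head-∈ h (occurs P (≤-refl , ≤-trans (proj₁ ry) (proj₂ ry)))
      where ry = All.lookup (bnd P) (head-y∈ h)
    ... | inj₁ e = sym e
    ... | inj₂ fr with gapView {c} {y} 1 (Head.c≤y h)
    ...   | below _ z rewrite z with fr
    ...     | inj₁ ()
    ...     | inj₂ ()
    head-1 {n} {w} {c} {y} P h | inj₂ fr | middle _ _ z rewrite z with fr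
    ...     | inj₁ ()
    ...     | inj₂ ()
    head-1 P h | inj₂ fr | above le _ = ≤-antisym le (proj₁ (All.lookup (bnd P) (head-y∈ h)))
    no-head : ∀ {n w c y} → IsPerm n w → 1 < c → ¬ Head sumShading c y w
    no-head P gt h = <⇒≱ gt (≤-trans (Head.c≤y h) (≤-reflexive (head-1 P h)))
    fresh : ∀ {n w} → IsPerm (suc n) w → ¬ Occ sumShading w → Pend (suc (suc n)) (child 1 w) (suc n)
    fresh {n} {w} P no-occ with perm-split P (≤-refl , s≤s z≤n)
    ... | Y , Z , refl , bY , bZ = 1 , 2 , head⇒occAt (head refl ≤-refl (All.map (free _) bY) (All.map (free′ _) bZ)) , least , refl
      where
      free : ∀ e → InRange (suc n) e × e ≢ 1 → Free sumShading 1F 1 1 e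
      free e ((e≥1 , _) , _) rewrite zone-above {1} {1} {e} ≤-refl e≥1 = refl
      free′ : ∀ e → InRange (suc n) e × e ≢ 1 → Free sumShading 2F 1 1 e
      free′ e ((e≥1 , _) , _) rewrite zone-above {1} {1} {e} ≤-refl e≥1 = refl
      least : ∀ {u v} → OccAt sumShading u v (child 1 w) → v ≤ 2
      least o with occAt-child⁻ o
      ... | new h rewrite head-1 P h = ≤-refl
      ... | inherited _ o′ = ⊥-elim (no-occ (occAt⇒occ o′))
    pend-step : ∀ {n w k} → IsPerm n w → Pend n w k → Interval sumShading Pend n w k
    pend-step {n} {w} {k} P (x , y , o , least , y+k) = y , 0 , trans (cong (y +_) (+-identityʳ k)) y+k , inside , outside
      where
      y≥1 = proj₁ (proj₂ (occAt-range P o))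
      inside : ∀ {c} → y < c → c ≤ y + k → ¬ Occ sumShading (child c w)
      inside {c} lt _ oc with occAt-child⁻ (proj₂ (proj₂ (occ⇒occAt oc)))
      ... | new h = no-head P (≤-<-trans y≥1 lt) h
      ... | inherited fr o′ rewrite zone-c-above (OccAt.x<y o′) (≤-<-trans (least o′) lt) with () ← fr
      outside : ∀ {c} → InRange (suc n) c → c ≤ y ⊎ y + k < c → Pend (suc n) (child c w) k
      outside {c} (_ , c≤n) (inj₂ gt) = ⊥-elim (<⇒≱ gt (≤-trans c≤n (≤-reflexive (sym y+k))))
      outside {c} rc (inj₁ le) = bump c x , bump c y , occAt-child⁺ free o , least′ , trans (cong (_+ k) (bump-≥ le)) (cong suc y+k)
        where
        free : sumShading zero (zone (bump c x) (bump c y) c) ≡ false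
        free with c ≤? x
        ... | yes p rewrite zone-c-below p (OccAt.x<y o) = refl
        ... | no p rewrite zone-c-middle (≰⇒> p) le = refl
        least′ : ∀ {u v} → OccAt sumShading u v (child c w) → v ≤ bump c y
        least′ o′ with occAt-child⁻ o′
        ... | new h rewrite head-1 P h = bump-mono-≤ c y≥1
        ... | inherited _ o″ = bump-mono-≤ c (least o″)
  blockModel : IntervalModel id blockShading
  blockModel = record
    { Pend = Pend ; pend⇒occ = λ (_ , _ , o , _) → occAt⇒occ o ; pend-step = pend-step
    ; creator = λ _ → 1 ; creator-range = λ _ → ≤-refl , s≤s z≤n ; created = fresh
    ; head⇒creator = λ P (c≥1 , _) h → ≤-antisym (≮⇒≥ λ gt → no-head P gt h) c≥1 }
    where
    -- The value intervals of the occurrences are nested. The narrowest decides, since a rank inside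
    -- it is inside all of them.
    Pend : ℕ → List ℕ → ℕ → Set
    Pend n w k = ∃[ x ] ∃[ y ] OccAt blockShading x y w × (∀ {u v} → OccAt blockShading u v w → u ≤ x × y ≤ v) × x + k ≡ y
    head-all : ∀ {n w c y e} → IsPerm n w → Head blockShading c y w → InRange n e → c ≤ e × e ≤ y
    head-all {c = c} {y} {e} P h re with head-∈ h (occurs P re)
    ... | inj₁ refl = Head.c≤y h , ≤-refl
    ... | inj₂ fr with gapView {c} {y} e (Head.c≤y h)
    ...   | middle p q _ = p , <⇒≤ q
    ...   | below _ z rewrite z with fr
    ...     | inj₁ ()
    ...     | inj₂ ()
    head-all P h re | inj₂ fr | above _ z rewrite z with fr
    ...     | inj₁ ()
    ...     | inj₂ ()
    n≥1 : ∀ {R n w c y} → IsPerm n w → Head R c y w → 1 ≤ n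
    n≥1 P h = ≤-trans (proj₁ ry) (proj₂ ry)
      where ry = All.lookup (bnd P) (head-y∈ h)
    no-head : ∀ {n w c y} → IsPerm n w → 1 < c → ¬ Head blockShading c y w
    no-head P gt h = <⇒≱ gt (proj₁ (head-all P h (≤-refl , n≥1 P h)))
    new-widest : ∀ {n w c y x v} → IsPerm n w → Head blockShading c y w → InRange n x → InRange n v → c ≤ bump c x × bump c v ≤ bump c y
    new-widest {c = c} P h rx rv = <⇒≤ (c<bump (proj₁ (head-all P h rx))) , bump-mono-≤ c (proj₂ (head-all P h rv))
    fresh : ∀ {n w} → IsPerm (suc n) w → ¬ Occ blockShading w → Pend (suc (suc n)) (child 1 w) (suc n)
    fresh {n} {w} P no-occ with perm-split P (s≤s z≤n , ≤-refl)
    ... | Y , Z , refl , bY , bZ = 1 , suc (suc n) , head⇒occAt (head refl (s≤s z≤n) (All.map (free _) bY) (All.map (free′ _) bZ)) , widest , refl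
      where
      free : ∀ e → InRange (suc n) e × e ≢ suc n → Free blockShading 1F 1 (suc n) e
      free e ((e≥1 , e≤n) , ne) rewrite zone-middle {1} {suc n} {e} e≥1 (≤∧≢⇒< e≤n ne) = refl
      free′ : ∀ e → InRange (suc n) e × e ≢ suc n → Free blockShading 2F 1 (suc n) e
      free′ e ((e≥1 , e≤n) , ne) rewrite zone-middle {1} {suc n} {e} e≥1 (≤∧≢⇒< e≤n ne) = refl
      widest : ∀ {u v} → OccAt blockShading u v (child 1 w) → u ≤ 1 × suc (suc n) ≤ v
      widest o with occAt-child⁻ o
      ... | inherited _ o′ = ⊥-elim (no-occ (occAt⇒occ o′))
      ... | new h = ≤-refl , bump-mono-≤ 1 (proj₂ (head-all P h (s≤s z≤n , ≤-refl)))
    pend-step : ∀ {n w k} → IsPerm n w → Pend n w k → Interval blockShading Pend n w k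
    pend-step {n} {w} {k} P (x , y , o , widest , refl) = x , suc n ∸ (x + k) ,
      trans (sym (+-assoc x k _)) (m+[n∸m]≡n (m≤n⇒m≤1+n (proj₂ (proj₂ (occAt-range P o))))) , inside , outside
      where
      rx = proj₁ (occAt-range P o)
      ry = proj₂ (occAt-range P o)
      inside : ∀ {c} → x < c → c ≤ x + k → ¬ Occ blockShading (child c w)
      inside {c} lt le oc with occAt-child⁻ (proj₂ (proj₂ (occ⇒occAt oc)))
      ... | new h = no-head P (≤-<-trans (proj₁ rx) lt) h
      ... | inherited fr o′ rewrite zone-c-middle (≤-<-trans (proj₁ (widest o′)) lt) (≤-trans le (proj₂ (widest o′))) with () ← fr
      outside : ∀ {c} → InRange (suc n) c → c ≤ x ⊎ x + k < c → Pend (suc n) (child c w) k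
      outside {c} rc out = bump c x , bump c (x + k) , occAt-child⁺ (free out) o , widest′ , size out
        where
        free : c ≤ x ⊎ x + k < c → blockShading zero (zone (bump c x) (bump c (x + k)) c) ≡ false
        free (inj₁ le) rewrite zone-c-below le (OccAt.x<y o) = refl
        free (inj₂ gt) rewrite zone-c-above (OccAt.x<y o) gt = refl
        size : c ≤ x ⊎ x + k < c → bump c x + k ≡ bump c (x + k)
        size (inj₁ le) rewrite bump-≥ le | bump-≥ (≤-trans le (m≤m+n x k)) = refl
        size (inj₂ gt) rewrite bump-< gt | bump-< (≤-<-trans (m≤m+n x k) gt) = refl
        widest′ : ∀ {u v} → OccAt blockShading u v (child c w) → u ≤ bump c x × bump c (x + k) ≤ v
        widest′ o′ with occAt-child⁻ o′
        ... | new h = new-widest P h rx ry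
        ... | inherited _ o″ = bump-mono-≤ c (proj₁ (widest o″)) , bump-mono-≤ c (proj₂ (widest o″))

-- Innermost pending occurrences

data Pending : Set where
  none dead : Pending
  current older : ℕ → Pending

record Window : Set where
  constructor window
  field
    size lower upper : ℕ
    pending : Pending

-- Prepending index e creates an occurrence iff lower < e ≤ upper.  Of the pending occurrences only the innermost one
-- matters: `current x` is destroyed by the indices above x, `older k` by k indices, all of them above the window;
-- `dead` is an occurrence that nothing destroys.
module WindowMachine (t₀ t₁ s₁ : Bool) where

  -- A prepended entry that is not a new maximum stands in column 1 of an occurrence created next.
  -- If `t₀` holds, the creating index must then not exceed `e`; if `t₁` holds, it must exceed `e`.
  -- The minimum in `lower′` normalises an empty window to `lower = upper`.
  upper′ : ℕ → ℕ → ℕ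
  upper′ e u = if t₀ then bump e u ⊓ e else bump e u

  lower′ : ℕ → ℕ → ℕ → ℕ
  lower′ e l u = (if t₁ then bump e l ⊔ e else bump e l) ⊓ upper′ e u

  -- The value of `lower′` once `e` lies above the window: with `t₁` the window closes.
  beyondLower : ℕ → ℕ → ℕ
  beyondLower l u = if t₁ then u else l

  eligible? : ∀ e l u → Dec (l < e × e ≤ u)
  eligible? e l u = (l <? e) ×-dec (e ≤? u)

  created : Bool → ℕ → Pending
  created false e = none
  created true e = if s₁ then current e else dead

  pending′ : Bool → ℕ → Pending → Pending
  pending′ b e none = created b e
  pending′ b e dead = dead
  pending′ b e (current x) = if x <ᵇ e then created b e else current (suc x)
  pending′ b e (older k) = older k

  -- A new maximum resets the window to the single index 1. The n - x indices that destroy the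
  -- current occurrence then lie above the window, and their number is all that is kept.
  promote : ℕ → Pending → Pending
  promote n (current x) = older (n ∸ x)
  promote n p = p

  move : ℕ → ℕ → ℕ → ℕ → Pending → Window
  move n l u e p = window (suc n) (lower′ e l u) (upper′ e u) p

  next : (Window → ℕ) → Window → ℕ
  -- All indices beyond `u` act on the window alike and none creates, so they are merely counted:
  -- `k` of them destroy, the rest do not.
  next h (window n l u (older k)) =
    (∑ u (λ e → h (move n l u e (older k))) +
      (k * h (window (suc n) (beyondLower l u) u none) + (n ∸ u ∸ k) * h (window (suc n) (beyondLower l u) u (older k)))) +
    h (window (suc n) 0 1 (older k))
  next h (window n l u p) = ∑ n (λ e → h (move n l u e (pending′ ⌊ eligible? e l u ⌋ e p))) + h (window (suc n) 0 1 (promote n p))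

  isNone : Pending → Bool
  isNone none = true
  isNone _ = false

  machine : Machine
  machine = record { State = Window ; accept = isNone ∘ Window.pending ; next = next }

  upper′-far : ∀ {e u} → u < e → upper′ e u ≡ u
  upper′-far {e} {u} lt = go t₀
    where
    go : ∀ b → (if b then bump e u ⊓ e else bump e u) ≡ u
    go true rewrite bump-< lt = m≤n⇒m⊓n≡m (<⇒≤ lt)
    go false = bump-< lt

  lower′-far : ∀ {e l u} → l ≤ u → u < e → lower′ e l u ≡ beyondLower l u
  lower′-far {e} {l} {u} le lt = trans (cong ((if t₁ then bump e l ⊔ e else bump e l) ⊓_) (upper′-far lt)) (go t₁)
    where
    go : ∀ b → (if b then bump e l ⊔ e else bump e l) ⊓ u ≡ (if b then u else l)
    go true = m≥n⇒m⊓n≡n (≤-trans (<⇒≤ lt) (m≤n⊔m (bump e l) e))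
    go false rewrite bump-< (≤-<-trans le lt) = m≤n⇒m⊓n≡m le

  upper′-≤ : ∀ {e u} → upper′ e u ≤ suc u
  upper′-≤ {e} {u} = go t₀
    where
    bump≤ : bump e u ≤ suc u
    bump≤ with u <ᵇ e
    ... | true = n≤1+n u
    ... | false = ≤-refl
    go : ∀ b → (if b then bump e u ⊓ e else bump e u) ≤ suc u
    go true = ≤-trans (m⊓n≤m (bump e u) e) bump≤
    go false = bump≤

  lower′≤upper′ : ∀ {e l u} → lower′ e l u ≤ upper′ e u
  lower′≤upper′ {e} {l} {u} = m⊓n≤n (if t₁ then bump e l ⊔ e else bump e l) (upper′ e u)

  -- `index` reads ranks from below for one pattern and from above for the other, so that one set of
  -- window rules fits both. In `Pend n w a k` the destroying indices are those in (a, a + k].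
  record Model (R : Shading) : Set₁ where
    field
      index       : ℕ → ℕ → ℕ
      index-range : ∀ {n c} → InRange n c → InRange n (index n c)
      ∑-index     : ∀ n f → ∑ n (f ∘ index n) ≡ ∑ n f
      head-max    : ∀ {n w c y} → IsPerm n w → Head R c y w → y ≡ n

    Creates : ℕ → List ℕ → ℕ → ℕ → Set
    Creates n w l u = ∀ {c} → InRange n c → (Head R c n w → l < index n c × index n c ≤ u) × (l < index n c × index n c ≤ u → Head R c n w)

    AllBlocked : ℕ → List ℕ → Set
    AllBlocked c w = ∀ {x y} → OccAt R x y w → R zero (zone (bump c x) (bump c y) c) ≡ true

    field
      creates-child : ∀ {n w d l u} → IsPerm n w → InRange n d → Creates n w l u →
        Creates (suc n) (child d w) (lower′ (index n d) l u) (upper′ (index n d) u)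
      creates-max   : ∀ {n w} → IsPerm n w → Creates (suc n) (child (suc n) w) 0 1
      -- `s₁` is the one box of column 0 that can be shaded, so without it every occurrence is
      -- permanent, which is the status `dead`.
      never-blocked : s₁ ≡ false → ∀ b → R zero b ≡ false
      Pend          : ℕ → List ℕ → ℕ → ℕ → Set
      pend⇒occ      : ∀ {n w a k} → Pend n w a k → Occ R w
      pend-range    : ∀ {n w a k} → IsPerm n w → Pend n w a k → a + k ≤ n
      pend-new      : ∀ {n w c} → s₁ ≡ true → IsPerm n w → InRange n c → AllBlocked c w → Head R c n w →
        Pend (suc n) (child c w) (index n c) (suc n ∸ index n c)
      pend-below    : ∀ {n w a k c} → s₁ ≡ true → IsPerm n w → InRange n c → Pend n w a k → index n c ≤ a → Pend (suc n) (child c w) (suc a) k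
      pend-inside   : ∀ {n w a k c} → s₁ ≡ true → IsPerm n w → InRange n c → Pend n w a k → a < index n c → index n c ≤ a + k → AllBlocked c w
      pend-above    : ∀ {n w a k c} → s₁ ≡ true → IsPerm n w → InRange n c → Pend n w a k → a + k < index n c → ¬ Head R c n w → Pend (suc n) (child c w) a k
      pend-max      : ∀ {n w a k} → s₁ ≡ true → IsPerm n w → Pend n w a k → ∃[ a′ ] 1 ≤ a′ × Pend (suc n) (child (suc n) w) a′ k

    -- For `older`, the bound `u ≤ a` keeps creating and destroying indices apart. For `current`
    -- they may overlap: an index can destroy the old occurrences and create a new one at once.
    Status : ℕ → List ℕ → ℕ → Pending → Set
    Status n w u none = ¬ Occ R w
    Status n w u dead = s₁ ≡ false × Occ R w
    Status n w u (current x) = s₁ ≡ true × Pend n w x (n ∸ x)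
    Status n w u (older k) = s₁ ≡ true × (∃[ a ] u ≤ a × Pend n w a k)

    Rel : ℕ → List ℕ → Window → Set
    Rel n w (window m l u p) = m ≡ n × l ≤ u × Creates n w l u × Status n w u p

    inherit : ∀ {c w} → s₁ ≡ false → Occ R w → Occ R (child c w)
    inherit e o with occ⇒occAt o
    ... | _ , _ , o′ = occAt⇒occ (occAt-child⁺ (never-blocked e _) o′)

    no-new : ∀ {n w c} → IsPerm n w → AllBlocked c w → ¬ Head R c n w → ¬ Occ R (child c w)
    no-new P blocked no-head o with occ⇒occAt o
    ... | _ , _ , o′ with occAt-child⁻ o′
    ...   | new h = no-head (subst (λ y → Head R _ y _) (head-max P h) h)
    ...   | inherited fr o″ = true≢false (trans (sym (blocked o″)) fr)

    no-head-max : ∀ {n w} → ¬ Head R (suc n) n w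
    no-head-max h = <-irrefl refl (Head.c≤y h)

    vacuous : ∀ {c w} → ¬ Occ R w → AllBlocked c w
    vacuous no-occ o = ⊥-elim (no-occ (occAt⇒occ o))

    status-created : ∀ {n w l u c} → IsPerm n w → Creates n w l u → InRange n c → AllBlocked c w →
      Status (suc n) (child c w) (upper′ (index n c) u) (created ⌊ eligible? (index n c) l u ⌋ (index n c))
    status-created {n} {w} {l} {u} {c} P cr rc blocked with eligible? (index n c) l u
    ... | no ne = no-new P blocked λ h → ne (proj₁ (cr rc) h)
    ... | yes el = go s₁ refl
      where
      go : ∀ b → s₁ ≡ b → Status (suc n) (child c w) (upper′ (index n c) u) (if b then current (index n c) else dead)
      go true eq = eq , pend-new eq P rc blocked (proj₂ (cr rc) el)
      go false eq = eq , occAt⇒occ (head⇒occAt (proj₂ (cr rc) el))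

    status-move : ∀ {n w l u c p} → IsPerm n w → Creates n w l u → InRange n c → (∀ {k} → p ≢ older k) → Status n w u p →
      Status (suc n) (child c w) (upper′ (index n c) u) (pending′ ⌊ eligible? (index n c) l u ⌋ (index n c) p)
    status-move {c = c} {none} P cr rc _ no-occ = status-created P cr rc (vacuous {c} no-occ)
    status-move {p = dead} P cr rc _ (e , o) = e , inherit e o
    status-move {n} {w} {l} {u} {c} {current x} P cr rc _ (e , pd) with x <? index n c
    ... | yes lt = subst (λ t → Status (suc n) (child c w) (upper′ (index n c) u) (if t then created ⌊ eligible? (index n c) l u ⌋ (index n c) else current (suc x)))
      (sym (<ᵇ-true lt)) (status-created P cr rc (pend-inside e P rc pd lt
        (≤-trans (proj₂ (index-range rc)) (≤-reflexive (sym (m+[n∸m]≡n (≤-trans (m≤m+n x (n ∸ x)) (pend-range P pd))))))))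
    ... | no le = subst (λ t → Status (suc n) (child c w) (upper′ (index n c) u) (if t then created ⌊ eligible? (index n c) l u ⌋ (index n c) else current (suc x)))
      (sym (<ᵇ-false (≮⇒≥ le))) (e , pend-below e P rc pd (≮⇒≥ le))
    status-move {p = older k} P cr rc ne _ = ⊥-elim (ne refl)

    status-max : ∀ {n w u p} → IsPerm n w → Status n w u p → Status (suc n) (child (suc n) w) 1 (promote n p)
    status-max {n} {p = none} P no-occ = no-new P (vacuous {suc n} no-occ) no-head-max
    status-max {p = dead} P (e , o) = e , inherit e o
    status-max {p = current x} P (e , pd) = e , pend-max e P pd
    status-max {p = older k} P (e , a , _ , pd) = e , pend-max e P pd

    rel-max : ∀ {n w l u p} → IsPerm n w → Rel n w (window n l u p) → Rel (suc n) (child (suc n) w) (window (suc n) 0 1 (promote n p))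
    rel-max {p = p} P (_ , _ , _ , st) = refl , z≤n , creates-max P , status-max {p = p} P st

    choose : ℕ → (ℕ → Window) → Window → ℕ → Window
    choose n f m c = if c <ᵇ suc n then f (index n c) else m

    choose-low : ∀ {n f m c} → c ≤ n → choose n f m c ≡ f (index n c)
    choose-low le rewrite <ᵇ-true (s≤s le) = refl

    choose-max : ∀ {n f m} → choose n f m (suc n) ≡ m
    choose-max {n} rewrite <ᵇ-false {suc n} {suc n} ≤-refl = refl

    ∑-choose : ∀ n f m h → ∑ (suc n) (h ∘ choose n f m) ≡ ∑ n (h ∘ f) + h m
    ∑-choose n f m h = trans (∑-last n _) (cong₂ _+_
      (trans (∑-cong (λ (_ , c≤n) → cong h (choose-low {n} {f} {m} c≤n))) (∑-index n (h ∘ f))) (cong h (choose-max {n} {f} {m})))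

    choose-rel : ∀ {n w f m} → (∀ {c} → InRange n c → Rel (suc n) (child c w) (f (index n c))) → Rel (suc n) (child (suc n) w) m →
      ∀ {c} → InRange (suc n) c → Rel (suc n) (child c w) (choose n f m c)
    choose-rel {n} {w} {f} {m} lesser top {c} (c≥1 , c≤) with m≤n⇒m<n∨m≡n c≤
    ... | inj₁ lt = subst (Rel (suc n) (child c w)) (sym (choose-low {n} {f} {m} (≤-pred lt))) (lesser (c≥1 , ≤-pred lt))
    ... | inj₂ refl = subst (Rel (suc n) (child c w)) (sym (choose-max {n} {f} {m})) top

    step-simple : ∀ {n w l u p} → (P : IsPerm n w) → (∀ {k} → p ≢ older k) → Rel n w (window n l u p) → Σ (ℕ → Window) λ g →
      (∀ {c} → InRange (suc n) c → Rel (suc n) (child c w) (g c)) ×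
      (∀ h → ∑ (suc n) (h ∘ g) ≡ ∑ n (λ e → h (move n l u e (pending′ ⌊ eligible? e l u ⌋ e p))) + h (window (suc n) 0 1 (promote n p)))
    step-simple {n} {w} {l} {u} {p} P simple r@(_ , le , cr , st) = choose n f m ,
      choose-rel {n} {w} {f} {m} lesser (rel-max {p = p} P r) , ∑-choose n f m
      where
      f : ℕ → Window
      f e = move n l u e (pending′ ⌊ eligible? e l u ⌋ e p)
      m = window (suc n) 0 1 (promote n p)
      lesser : ∀ {c} → InRange n c → Rel (suc n) (child c w) (f (index n c))
      lesser {c} rc = refl , lower′≤upper′ {index n c} , creates-child P rc cr , status-move {p = p} P cr rc simple st

    step-older : ∀ {n w l u k} → IsPerm n w → Rel n w (window n l u (older k)) → Steps machine Rel n w (window n l u (older k))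
    step-older {n} {w} {l} {u} {k} P r@(_ , l≤u , cr , e₁ , a , u≤a , pd) = choose n f m ,
      choose-rel {n} {w} {f} {m} lesser (rel-max {p = older k} P r) , λ h → trans (∑-choose n f m h) (cong (_+ h m) (total h))
      where
      f : ℕ → Window
      f e = move n l u e (if ⌊ (a <? e) ×-dec (e ≤? a + k) ⌋ then none else older k)
      m = window (suc n) 0 1 (older k)
      not-eligible : ∀ {c} → InRange n c → a < index n c → ¬ Head R c n w
      not-eligible rc lt h = <⇒≱ lt (≤-trans (proj₂ (proj₁ (cr rc) h)) u≤a)
      lesser : ∀ {c} → InRange n c → Rel (suc n) (child c w) (f (index n c))
      lesser {c} rc = refl , lower′≤upper′ {index n c} , creates-child P rc cr , status
        where
        status : Status (suc n) (child c w) (upper′ (index n c) u) (if ⌊ (a <? index n c) ×-dec (index n c ≤? a + k) ⌋ then none else older k)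
        status with a <? index n c | index n c ≤? a + k
        ... | yes p | yes q = no-new P (pend-inside e₁ P rc pd p q) (not-eligible rc p)
        ... | yes p | no q = e₁ , a , ≤-trans (≤-reflexive (upper′-far (≤-<-trans u≤a p))) u≤a ,
          pend-above e₁ P rc pd (≰⇒> q) (not-eligible rc p)
        ... | no p | _ = e₁ , suc a , ≤-trans (upper′-≤ {index n c}) (s≤s u≤a) , pend-below e₁ P rc pd (≮⇒≥ p)
      inside : ∀ {e} → a < e → e ≤ a + k → f e ≡ window (suc n) (beyondLower l u) u none
      inside {e} p q with a <? e | e ≤? a + k
      ... | yes _ | yes _ = cong₂ (λ x y → window (suc n) x y none) (lower′-far l≤u (≤-<-trans u≤a p)) (upper′-far (≤-<-trans u≤a p))
      ... | yes _ | no q′ = ⊥-elim (q′ q)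
      ... | no p′ | _ = ⊥-elim (p′ p)
      outside : ∀ {e} → e ≤ a ⊎ a + k < e → f e ≡ move n l u e (older k)
      outside {e} out with a <? e | e ≤? a + k | out
      ... | yes p | yes q | inj₁ le = ⊥-elim (<⇒≱ p le)
      ... | yes p | yes q | inj₂ gt = ⊥-elim (<⇒≱ gt q)
      ... | yes _ | no _ | _ = refl
      ... | no _ | _ | _ = refl
      beyond : ∀ {e} → u < e → move n l u e (older k) ≡ window (suc n) (beyondLower l u) u (older k)
      beyond lt = cong₂ (λ x y → window (suc n) x y (older k)) (lower′-far l≤u lt) (upper′-far lt)
      -- `a′` counts the indices between the window and the destroying interval, `r′` those beyond
      -- that interval. Only their sum enters, which is why the state can forget `a`.
      a′ = a ∸ u
      r′ = n ∸ (a + k)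
      u+a′ : u + a′ ≡ a
      u+a′ = m+[n∸m]≡n u≤a
      split : u + (a′ + (k + r′)) ≡ n
      split = trans (sym (+-assoc u a′ _)) (trans (cong (_+ (k + r′)) u+a′) (trans (sym (+-assoc a k r′)) (m+[n∸m]≡n (pend-range P pd))))
      rest : a′ + r′ ≡ n ∸ u ∸ k
      rest = sym (trans (cong (λ t → t ∸ u ∸ k) (sym split)) (trans (cong (_∸ k) (m+n∸m≡n u _))
        (trans (cong (_∸ k) (trans (sym (+-assoc a′ k r′)) (trans (cong (_+ r′) (+-comm a′ k)) (+-assoc k a′ r′)))) (m+n∸m≡n k _))))
      total : ∀ h → ∑ n (h ∘ f) ≡ ∑ u (λ e → h (move n l u e (older k))) +
        (k * h (window (suc n) (beyondLower l u) u none) + (n ∸ u ∸ k) * h (window (suc n) (beyondLower l u) u (older k)))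
      total h = trans (cong (λ t → ∑ t (h ∘ f)) (sym split)) (trans (∑-+ u _ (h ∘ f)) (cong₂ _+_
        (∑-cong λ (_ , e≤u) → cong h (outside (inj₁ (≤-trans e≤u u≤a))))
        (trans (∑-interval a′ k r′
            (λ {c} c≥1 c≤a′ → cong h (trans (outside (inj₁ (≤-trans (+-monoʳ-≤ u c≤a′) (≤-reflexive u+a′)))) (beyond (m<m+n u c≥1))))
            (λ {c} gt le → cong h (inside (subst (_< u + c) u+a′ (+-monoʳ-< u gt))
              (≤-trans (+-monoʳ-≤ u le) (≤-reflexive (trans (sym (+-assoc u a′ k)) (cong (_+ k) u+a′))))))
            (λ {c} gt _ → cong h (trans (outside (inj₂ (subst (_< u + c) (trans (sym (+-assoc u a′ k)) (cong (_+ k) u+a′)) (+-monoʳ-< u gt))))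
              (beyond (m<m+n u (≤-trans (s≤s z≤n) gt))))))
          (cong (λ t → k * h (window (suc n) (beyondLower l u) u none) + t * h (window (suc n) (beyondLower l u) u (older k))) rest))))

    simulation : Simulation machine R
    simulation = record
      { Rel = Rel ; sound = sound ; complete = complete ; step = step
      ; start = window 0 0 0 none ; initial = refl , z≤n , (λ { (c≥1 , c≤0) → ⊥-elim (<⇒≱ c≥1 c≤0) }) , ¬occ-[] }
      where
      sound : ∀ {n w q} → IsPerm n w → Rel n w q → isNone (Window.pending q) ≡ true → ¬ Occ R w
      sound {q = window _ _ _ none} _ (_ , _ , _ , no-occ) _ = no-occ
      complete : ∀ {n w q} → IsPerm n w → Rel n w q → isNone (Window.pending q) ≡ false → Occ R w
      complete {q = window _ _ _ dead} _ (_ , _ , _ , _ , o) _ = o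
      complete {q = window _ _ _ (current _)} _ (_ , _ , _ , _ , pd) _ = pend⇒occ pd
      complete {q = window _ _ _ (older _)} _ (_ , _ , _ , _ , _ , _ , pd) _ = pend⇒occ pd
      step : ∀ {n w q} → IsPerm n w → Rel n w q → Steps machine Rel n w q
      step {q = window _ _ _ none} P r@(refl , _) = step-simple {p = none} P (λ ()) r
      step {q = window _ _ _ dead} P r@(refl , _) = step-simple {p = dead} P (λ ()) r
      step {q = window _ _ _ p@(current _)} P r@(refl , _) = step-simple {p = p} P (λ ()) r
      step {q = window _ _ _ (older _)} P r@(refl , _) = step-older P r

-- The gap `d` of `w` is split by the new entry `d` into the gaps `d` and `d + 1` of the child.
-- Hence `unbump (suc d)` translates gaps of the child into gaps of `w`.
unbump-suc-<ᵇ : ∀ d e {c} → 1 ≤ c → (bump d e <ᵇ c) ≡ (e <ᵇ unbump (suc d) c)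
unbump-suc-<ᵇ d e {suc c} _ with c <? d | e <? d
... | yes p | yes q rewrite <ᵇ-true p | <ᵇ-true q = refl
... | yes p | no q rewrite <ᵇ-true p | <ᵇ-false (≮⇒≥ q) = trans (<ᵇ-false (≤-trans (<⇒≤ p) (≮⇒≥ q))) (sym (<ᵇ-false {e} {suc c} (≤-trans p (≮⇒≥ q))))
... | no p | yes q rewrite <ᵇ-false (≮⇒≥ p) | <ᵇ-true q = trans (<ᵇ-true (m<n⇒m<1+n (<-≤-trans q (≮⇒≥ p)))) (sym (<ᵇ-true (<-≤-trans q (≮⇒≥ p))))
... | no p | no q rewrite <ᵇ-false (≮⇒≥ p) | <ᵇ-false (≮⇒≥ q) = refl

unbump-suc-> : ∀ {d e c} → 1 ≤ c → bump d e < c → e < unbump (suc d) c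
unbump-suc-> {d} {e} {c} c≥1 lt = <ᵇ-true⁻ (trans (sym (unbump-suc-<ᵇ d e c≥1)) (<ᵇ-true lt))

unbump-suc->⁻ : ∀ {d e c} → 1 ≤ c → e < unbump (suc d) c → bump d e < c
unbump-suc->⁻ {d} {e} {c} c≥1 lt = <ᵇ-true⁻ (trans (unbump-suc-<ᵇ d e c≥1) (<ᵇ-true lt))

unbump-suc-range : ∀ {n d c} → InRange n d → InRange (suc n) c → InRange n (unbump (suc d) c)
unbump-suc-range {n} {d} {suc c} (d≥1 , d≤n) (_ , s≤s c≤n) with c <? d
... | yes p rewrite <ᵇ-true p = s≤s z≤n , ≤-trans p d≤n
... | no p rewrite <ᵇ-false (≮⇒≥ p) = ≤-trans d≥1 (≮⇒≥ p) , c≤n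

zone-child : ∀ {n d c} e → d ≤ n → 1 ≤ c → zone c (suc n) (bump d e) ≡ zone (unbump (suc d) c) n e
zone-child {n} {d} {c} e d≤n c≥1 rewrite sym (bump-≥ d≤n) | unbump-suc-<ᵇ d e c≥1 | bump-<ᵇ d e n = refl

-- As `d` is not a new maximum, the maximum of `w` becomes n + 1 and remains the second point. The
-- one additional condition concerns `d`, which joins column 1.
head-child⁻ : ∀ {R n w d c} → IsPerm n w → InRange n d → InRange (suc n) c →
  Head R c (suc n) (child d w) → Head R (unbump (suc d) c) n w × Free R 1F c (suc n) d
head-child⁻ P (_ , d≤n) _ (head {[]} e _ _ _) with ∷-injective e
... | refl , _ = ⊥-elim (<-irrefl refl d≤n)
head-child⁻ {R} {n} {w} {d} {c} P rd rc (head {_ ∷ Y} e _ (fr ∷ m) r) with ∷-injective e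
... | refl , e′ with map-split (bump d) w e′
... | Y₀ , y₀ , Z₀ , refl , refl , e″ , refl with bump-injective d (trans (sym e″) (sym (bump-≥ (proj₂ rd))))
... | refl = head refl (proj₂ (unbump-suc-range rd rc))
    (map-All⁻ (bump d) (λ z → trans (cong (R _) (sym (zone-child z (proj₂ rd) (proj₁ rc))))) m)
    (map-All⁻ (bump d) (λ z → trans (cong (R _) (sym (zone-child z (proj₂ rd) (proj₁ rc))))) r) , fr

head-child⁺ : ∀ {R n w d c} → InRange n d → InRange (suc n) c →
  Head R (unbump (suc d) c) n w → Free R 1F c (suc n) d → Head R c (suc n) (child d w)
head-child⁺ {R} {n} {w} {d} {c} rd rc (head {Y} {Z} refl _ m r) fr = head {Y = d ∷ map (bump d) Y}
  (cong (d ∷_) (trans (map-++ (bump d) Y (n ∷ Z)) (cong (λ t → map (bump d) Y ++ t ∷ map (bump d) Z) (bump-≥ (proj₂ rd)))))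
  (proj₂ rc)
  (fr ∷ map-All⁺ (bump d) (λ z → trans (cong (R _) (zone-child z (proj₂ rd) (proj₁ rc)))) m)
  (map-All⁺ (bump d) (λ z → trans (cong (R _) (zone-child z (proj₂ rd) (proj₁ rc)))) r)

-- The maximum is now the first entry, so all of `w` stands in column 2.
head-new-max⁻ : ∀ {R n w c} → IsPerm n w → Head R c (suc n) (child (suc n) w) → ∀ {e} → e ∈ w → Free R 2F c (suc n) e
head-new-max⁻ {R} {n} {w} {c} P (head {[]} e le _ r) {z} z∈ with ∷-injective e
... | refl , refl = subst (Free R _ c (suc n)) (bump-< (s≤s (proj₂ (All.lookup (bnd P) z∈)))) (All.lookup r (∈-map⁺ (bump (suc n)) z∈))
head-new-max⁻ {n = n} {w} P (head {_ ∷ Y} e _ _ _) with ∷-injective e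
... | refl , e′ with ∈-map⁻ (bump (suc n)) (subst (suc n ∈_) (sym e′) (∈-++⁺ʳ Y (here refl)))
... | z , _ , e″ = ⊥-elim (bump≢c {suc n} {z} (sym e″))

head-new-max⁺ : ∀ {R n w c} → IsPerm n w → c ≤ suc n → (∀ {e} → InRange n e → Free R 2F c (suc n) e) → Head R c (suc n) (child (suc n) w)
head-new-max⁺ {R} {n} {w} {c} P le h = head {Y = []} refl le []
  (All.map⁺ (All.map (λ {e} re → subst (Free R _ c (suc n)) (sym (bump-< (s≤s (proj₂ re)))) (h re)) (bnd P)))

-- The two models of the window machine

module WindowAlgebra (t₀ t₁ s₁ : Bool) where

  open WindowMachine t₀ t₁ s₁

  window⁺ : ∀ {e x l u} → 1 ≤ x → l < unbump (suc e) x → unbump (suc e) x ≤ u → (t₀ ≡ true → x ≤ e) → (t₁ ≡ true → e < x) →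
    lower′ e l u < x × x ≤ upper′ e u
  window⁺ {e} {x} {l} {u} x≥1 lo hi h₀ h₁ = ≤-<-trans (m⊓n≤m _ (upper′ e u)) (go₁ t₁ h₁) , go₀ t₀ h₀
    where
    go₀ : ∀ b → (b ≡ true → x ≤ e) → x ≤ (if b then bump e u ⊓ e else bump e u)
    go₀ true h = ⊓-glb (≮⇒≥ λ lt → <⇒≱ (unbump-suc-> x≥1 lt) hi) (h refl)
    go₀ false _ = ≮⇒≥ λ lt → <⇒≱ (unbump-suc-> x≥1 lt) hi
    go₁ : ∀ b → (b ≡ true → e < x) → (if b then bump e l ⊔ e else bump e l) < x
    go₁ true h = ⊔-lub (unbump-suc->⁻ x≥1 lo) (h refl)
    go₁ false _ = unbump-suc->⁻ x≥1 lo

  window⁻ : ∀ {e x l u} → 1 ≤ x → lower′ e l u < x → x ≤ upper′ e u →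
    (l < unbump (suc e) x × unbump (suc e) x ≤ u) × (t₀ ≡ true → x ≤ e) × (t₁ ≡ true → e < x)
  window⁻ {e} {x} {l} {u} x≥1 lo hi = (proj₁ (go₁ t₁ lo′) , proj₁ (go₀ t₀ hi)) , proj₂ (go₀ t₀ hi) , proj₂ (go₁ t₁ lo′)
    where
    lo′ : (if t₁ then bump e l ⊔ e else bump e l) < x
    lo′ = ≰⇒> λ le → <⇒≱ lo (⊓-glb le hi)
    below-u : x ≤ bump e u → unbump (suc e) x ≤ u
    below-u le = ≮⇒≥ λ lt → <⇒≱ (unbump-suc->⁻ {e} {u} x≥1 lt) le
    go₀ : ∀ b → x ≤ (if b then bump e u ⊓ e else bump e u) → unbump (suc e) x ≤ u × (b ≡ true → x ≤ e)
    go₀ true le = below-u (≤-trans le (m⊓n≤m (bump e u) e)) , λ _ → ≤-trans le (m⊓n≤n (bump e u) e)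
    go₀ false le = below-u le , λ ()
    go₁ : ∀ b → (if b then bump e l ⊔ e else bump e l) < x → l < unbump (suc e) x × (b ≡ true → e < x)
    go₁ true lt = unbump-suc-> x≥1 (≤-<-trans (m≤m⊔n (bump e l) e) lt) , λ _ → ≤-<-trans (m≤n⊔m (bump e l) e) lt
    go₁ false lt = unbump-suc-> x≥1 lt , λ ()

-- After the prepended entry only columns 1 and 2 remain, and their top boxes are shaded.
max-head : ∀ {R n w c y} → (∀ {a} → R (suc a) 2F ≡ true) → IsPerm n w → Head R c y w → y ≡ n
max-head {R} {n} {w} {c} {y} full P h with All.lookup (bnd P) (head-y∈ h)
... | y≥1 , y≤n with head-∈ h (occurs P (≤-trans y≥1 y≤n , ≤-refl))
... | inj₁ e = sym e
... | inj₂ fr with m≤n⇒m<n∨m≡n y≤n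
...   | inj₂ e = e
...   | inj₁ lt = ⊥-elim ([ absurd , absurd ]′ fr)
  where
  absurd : ∀ {a} → Free R (suc a) c y n → ⊥
  absurd {a} f with () ← trans (sym (full {a})) (trans (cong (R (suc a)) (sym (zone-above (Head.c≤y h) (<⇒≤ lt)))) f)

-- The two differ by exchanging the lower rows. The entries to the right of the maximum must lie
-- above the gap in one pattern and below it in the other, which leaves an initial or a final
-- segment of gaps; `t₀` and `t₁` cut it down further by the entries before the maximum.
prefixShading suffixShading : (t₀ t₁ s₁ : Bool) → Shading
prefixShading t₀ t₁ s₁ = shading □ ■ ■  s₁ t₁ □  □ t₀ ■
suffixShading t₀ t₁ s₁ = shading □ ■ ■  □ t₀ ■  s₁ t₁ □

module Models (t₀ t₁ s₁ : Bool) where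

  open WindowMachine t₀ t₁ s₁
  open WindowAlgebra t₀ t₁ s₁

  prefix-model : Model (prefixShading t₀ t₁ s₁)
  prefix-model = record
    { index = λ _ c → c ; index-range = id ; ∑-index = λ _ _ → refl
    ; head-max = max-head full
    ; creates-child = λ P rd cr rc → creates⁻ P rd cr rc , creates⁺ rd cr rc
    ; creates-max = λ P rc → creates-max⁻ P rc , creates-max⁺ P rc
    ; never-blocked = λ { e zero → refl ; e 1F → e ; e 2F → refl }
    ; Pend = Pend
    ; pend⇒occ = λ (_ , o , _) → occAt⇒occ o
    ; pend-range = λ { P (_ , o , refl , _) → proj₂ (proj₂ (occAt-range P o)) }
    ; pend-new = λ _ → pend-new
    ; pend-below = λ _ → pend-below
    ; pend-inside = pend-inside
    ; pend-above = λ _ → pend-above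
    ; pend-max = λ _ → pend-max }
    where
    R : Shading
    R = prefixShading t₀ t₁ s₁
    full : ∀ {a} → R (suc a) 2F ≡ true
    full {zero} = refl
    full {suc zero} = refl
    Creates : ℕ → List ℕ → ℕ → ℕ → Set
    Creates n w l u = ∀ {c} → InRange n c → (Head R c n w → l < c × c ≤ u) × (l < c × c ≤ u → Head R c n w)
    free⁻ : ∀ {n d c} → InRange n d → c ≤ suc n → Free R 1F c (suc n) d → (t₀ ≡ true → c ≤ d) × (t₁ ≡ true → d < c)
    free⁻ {n} {d} {c} (_ , d≤n) c≤ fr with gapView {c} {suc n} d c≤
    ... | above le _ = ⊥-elim (<⇒≱ le d≤n)
    ... | below lt z rewrite z = (λ e → ⊥-elim (true≢false (trans (sym e) fr))) , λ _ → lt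
    ... | middle le _ z rewrite z = (λ _ → le) , λ e → ⊥-elim (true≢false (trans (sym e) fr))
    free⁺ : ∀ {n d c} → InRange n d → c ≤ suc n → (t₀ ≡ true → c ≤ d) → (t₁ ≡ true → d < c) → Free R 1F c (suc n) d
    free⁺ {n} {d} {c} (_ , d≤n) c≤ h₀ h₁ with gapView {c} {suc n} d c≤
    ... | above le _ = ⊥-elim (<⇒≱ le d≤n)
    ... | below lt z rewrite z = ¬-not λ e → <⇒≱ lt (h₀ e)
    ... | middle le _ z rewrite z = ¬-not λ e → <⇒≱ (h₁ e) le
    creates⁻ : ∀ {n w d l u} → IsPerm n w → InRange n d → Creates n w l u → ∀ {c} → InRange (suc n) c →
      Head R c (suc n) (child d w) → lower′ d l u < c × c ≤ upper′ d u
    creates⁻ P rd cr rc h with head-child⁻ P rd rc h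
    ... | h′ , fr with proj₁ (cr (unbump-suc-range rd rc)) h′ | free⁻ rd (proj₂ rc) fr
    ...   | lo , hi | f₀ , f₁ = window⁺ (proj₁ rc) lo hi f₀ f₁
    creates⁺ : ∀ {n w d l u} → InRange n d → Creates n w l u → ∀ {c} → InRange (suc n) c →
      lower′ d l u < c × c ≤ upper′ d u → Head R c (suc n) (child d w)
    creates⁺ {d = d} {l} {u} rd cr rc (lo , hi) with window⁻ {d} {_} {l} {u} (proj₁ rc) lo hi
    ... | w , f₀ , f₁ = head-child⁺ rd rc (proj₂ (cr (unbump-suc-range rd rc)) w) (free⁺ rd (proj₂ rc) f₀ f₁)
    creates-max⁻ : ∀ {n w c} → IsPerm n w → InRange (suc n) c → Head R c (suc n) (child (suc n) w) → 0 < c × c ≤ 1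
    creates-max⁻ {n} {w} {c} P (c≥1 , c≤) h = c≥1 , ≮⇒≥ λ lt →
      absurd lt (head-new-max⁻ P h (occurs P (≤-refl , ≤-pred (≤-trans lt c≤))))
      where
      absurd : 1 < c → Free R 2F c (suc n) 1 → ⊥
      absurd lt fr rewrite zone-below {c} {suc n} lt with () ← fr
    creates-max⁺ : ∀ {n w c} → IsPerm n w → InRange (suc n) c → 0 < c × c ≤ 1 → Head R c (suc n) (child (suc n) w)
    creates-max⁺ {n} {w} {c} P rc (_ , c≤1) = head-new-max⁺ P (proj₂ rc) free
      where
      free : ∀ {e} → InRange n e → Free R 2F c (suc n) e
      free {e} (e≥1 , e≤n) rewrite zone-middle {c} {suc n} {e} (≤-trans c≤1 e≥1) (s≤s e≤n) = refl
    -- The destroying ranks are those in row 1, from `a + 1` to `y`. The occurrences are nested, so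
    -- the narrowest pair decides.
    Pend : ℕ → List ℕ → ℕ → ℕ → Set
    Pend n w a k = ∃[ y ] OccAt R a y w × a + k ≡ y × (∀ {u v} → OccAt R u v w → u ≤ a × y ≤ v)
    pend-new : ∀ {n w c} → IsPerm n w → InRange n c → (∀ {x y} → OccAt R x y w → R zero (zone (bump c x) (bump c y) c) ≡ true) →
      Head R c n w → Pend (suc n) (child c w) c (suc n ∸ c)
    pend-new {n} {w} {c} P (_ , c≤n) blocked h = bump c n , head⇒occAt h , trans (m+[n∸m]≡n (m≤n⇒m≤1+n c≤n)) (sym (bump-≥ c≤n)) , narrowest
      where
      narrowest : ∀ {u v} → OccAt R u v (child c w) → u ≤ c × bump c n ≤ v
      narrowest o with occAt-child⁻ o
      ... | new h′ rewrite max-head full P h′ = ≤-refl , ≤-refl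
      ... | inherited fr o′ = ⊥-elim (true≢false (trans (sym (blocked o′)) fr))
    pend-below : ∀ {n w a k c} → IsPerm n w → InRange n c → Pend n w a k → c ≤ a → Pend (suc n) (child c w) (suc a) k
    pend-below {n} {w} {a} {k} {c} P rc (y , o , refl , narrowest) c≤a =
      bump c y , subst (λ t → OccAt R t (bump c y) (child c w)) (bump-≥ c≤a) (occAt-child⁺ free o) ,
      sym (bump-≥ (≤-trans c≤a (m≤m+n a k))) , narrowest′
      where
      free : R zero (zone (bump c a) (bump c y) c) ≡ false
      free rewrite zone-c-below c≤a (OccAt.x<y o) = refl
      narrowest′ : ∀ {u v} → OccAt R u v (child c w) → u ≤ suc a × bump c y ≤ v
      narrowest′ o′ with occAt-child⁻ o′
      ... | new h rewrite max-head full P h = m≤n⇒m≤1+n c≤a , bump-mono-≤ c (proj₂ (proj₂ (occAt-range P o)))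
      ... | inherited _ o″ = ≤-trans (bump-mono-≤ c (proj₁ (narrowest o″))) (≤-reflexive (bump-≥ c≤a)) , bump-mono-≤ c (proj₂ (narrowest o″))
    pend-inside : ∀ {n w a k c} → s₁ ≡ true → IsPerm n w → InRange n c → Pend n w a k → a < c → c ≤ a + k →
      ∀ {x y} → OccAt R x y w → R zero (zone (bump c x) (bump c y) c) ≡ true
    pend-inside e P rc (y , o , refl , narrowest) lt le o′
      rewrite zone-c-middle (≤-<-trans (proj₁ (narrowest o′)) lt) (≤-trans le (proj₂ (narrowest o′))) = e
    pend-above : ∀ {n w a k c} → IsPerm n w → InRange n c → Pend n w a k → a + k < c → ¬ Head R c n w → Pend (suc n) (child c w) a k
    pend-above {n} {w} {a} {k} {c} P rc (y , o , refl , narrowest) lt no-head =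
      y , subst₂ (λ s t → OccAt R s t (child c w)) (bump-< a<c) (bump-< lt) (occAt-child⁺ free o) , refl , narrowest′
      where
      a<c : a < c
      a<c = ≤-<-trans (m≤m+n a k) lt
      free : R zero (zone (bump c a) (bump c y) c) ≡ false
      free rewrite zone-c-above (OccAt.x<y o) lt = refl
      narrowest′ : ∀ {u v} → OccAt R u v (child c w) → u ≤ a × y ≤ v
      narrowest′ o′ with occAt-child⁻ o′
      ... | new h = ⊥-elim (no-head (subst (λ y → Head R c y w) (max-head full P h) h))
      ... | inherited _ o″ = ≤-trans (bump-mono-≤ c (proj₁ (narrowest o″))) (≤-reflexive (bump-< a<c)) ,
        ≤-trans (≤-reflexive (sym (bump-< lt))) (bump-mono-≤ c (proj₂ (narrowest o″)))
    pend-max : ∀ {n w a k} → IsPerm n w → Pend n w a k → ∃[ a′ ] 1 ≤ a′ × Pend (suc n) (child (suc n) w) a′ k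
    pend-max {n} {w} {a} {k} P (y , o , refl , narrowest) = a , proj₁ (proj₁ (occAt-range P o)) , y ,
      subst₂ (λ s t → OccAt R s t (child (suc n) w)) (bump-< a<) (bump-< y<) (occAt-child⁺ free o) , refl , narrowest′
      where
      y< : y < suc n
      y< = s≤s (proj₂ (proj₂ (occAt-range P o)))
      a< : a < suc n
      a< = ≤-<-trans (m≤m+n a k) y<
      free : R zero (zone (bump (suc n) a) (bump (suc n) y) (suc n)) ≡ false
      free rewrite zone-c-above (OccAt.x<y o) y< = refl
      narrowest′ : ∀ {u v} → OccAt R u v (child (suc n) w) → u ≤ a × y ≤ v
      narrowest′ o′ with occAt-child⁻ o′
      ... | new h = ⊥-elim (<⇒≱ (Head.c≤y h) (proj₂ (All.lookup (bnd P) (head-y∈ h))))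
      ... | inherited _ o″ = ≤-trans (bump-mono-≤ (suc n) (proj₁ (narrowest o″))) (≤-reflexive (bump-< a<)) ,
        ≤-trans (≤-reflexive (sym (bump-< y<))) (bump-mono-≤ (suc n) (proj₂ (narrowest o″)))

  suffix-model : Model (suffixShading t₀ t₁ s₁)
  suffix-model = record
    { index = mirror ; index-range = mirror-range ; ∑-index = ∑-mirror
    ; head-max = max-head full
    ; creates-child = λ P rd cr rc → creates⁻ P rd cr rc , creates⁺ rd cr rc
    ; creates-max = λ P rc → creates-max⁻ P rc , creates-max⁺ P rc
    ; never-blocked = λ { e zero → e ; e 1F → refl ; e 2F → refl }
    ; Pend = Pend
    ; pend⇒occ = λ (_ , o , _) → occAt⇒occ o
    ; pend-range = λ { P (_ , _ , e , _) → ≤-reflexive e }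
    ; pend-new = λ _ → pend-new
    ; pend-below = λ _ → pend-below
    ; pend-inside = λ e P rc pd lt _ → pend-inside e P rc pd lt
    ; pend-above = λ { _ P rc (_ , _ , e , _) lt _ → ⊥-elim (<⇒≱ lt (≤-trans (proj₂ (mirror-range rc)) (≤-reflexive (sym e)))) }
    ; pend-max = λ _ → pend-max }
    where
    R : Shading
    R = suffixShading t₀ t₁ s₁
    full : ∀ {a} → R (suc a) 2F ≡ true
    full {zero} = refl
    full {suc zero} = refl
    Creates : ℕ → List ℕ → ℕ → ℕ → Set
    Creates n w l u = ∀ {c} → InRange n c → (Head R c n w → l < mirror n c × mirror n c ≤ u) × (l < mirror n c × mirror n c ≤ u → Head R c n w)
    mirror-≤ : ∀ {n d c} → d < c → mirror (suc n) c ≤ mirror n d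
    mirror-≤ {n} {d} lt = ∸-monoʳ-≤ (suc (suc n)) lt
    mirror-> : ∀ {n d c} → c ≤ suc n → c ≤ d → mirror n d < mirror (suc n) c
    mirror-> {n} {d} {c} c≤ le = ≤-trans (s≤s (∸-monoʳ-≤ (suc n) le)) (≤-reflexive (sym (+-∸-assoc 1 c≤)))
    unbump-mirror : ∀ {n d c} → InRange (suc n) c → unbump (suc (mirror n d)) (mirror (suc n) c) ≡ mirror n (unbump (suc d) c)
    unbump-mirror {n} {d} {suc c} (_ , s≤s c≤n) with c <? d
    ... | yes p rewrite <ᵇ-true p | <ᵇ-false {mirror (suc n) (suc c)} {suc (mirror n d)} (mirror-> (s≤s c≤n) p) =
      cong pred (+-∸-assoc 1 c≤n)
    ... | no p rewrite <ᵇ-false (≮⇒≥ p) | <ᵇ-true {mirror (suc n) (suc c)} {suc (mirror n d)} (s≤s (mirror-≤ {n} {d} (s≤s (≮⇒≥ p)))) = refl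
    free⁻ : ∀ {n d c} → InRange n d → c ≤ suc n → Free R 1F c (suc n) d →
      (t₀ ≡ true → mirror (suc n) c ≤ mirror n d) × (t₁ ≡ true → mirror n d < mirror (suc n) c)
    free⁻ {n} {d} {c} (_ , d≤n) c≤ fr with gapView {c} {suc n} d c≤
    ... | above le _ = ⊥-elim (<⇒≱ le d≤n)
    ... | below lt z rewrite z = (λ _ → mirror-≤ lt) , λ e → ⊥-elim (true≢false (trans (sym e) fr))
    ... | middle le _ z rewrite z = (λ e → ⊥-elim (true≢false (trans (sym e) fr))) , λ _ → mirror-> c≤ le
    free⁺ : ∀ {n d c} → InRange n d → c ≤ suc n → (t₀ ≡ true → mirror (suc n) c ≤ mirror n d) → (t₁ ≡ true → mirror n d < mirror (suc n) c) →
      Free R 1F c (suc n) d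
    free⁺ {n} {d} {c} (_ , d≤n) c≤ h₀ h₁ with gapView {c} {suc n} d c≤
    ... | above le _ = ⊥-elim (<⇒≱ le d≤n)
    ... | below lt z rewrite z = ¬-not λ e → <⇒≱ (h₁ e) (mirror-≤ lt)
    ... | middle le _ z rewrite z = ¬-not λ e → <⇒≱ (mirror-> c≤ le) (h₀ e)
    creates⁻ : ∀ {n w d l u} → IsPerm n w → InRange n d → Creates n w l u → ∀ {c} → InRange (suc n) c →
      Head R c (suc n) (child d w) → lower′ (mirror n d) l u < mirror (suc n) c × mirror (suc n) c ≤ upper′ (mirror n d) u
    creates⁻ {n} {w} {d} {l} {u} P rd cr {c} rc h with head-child⁻ P rd rc h
    ... | h′ , fr with proj₁ (cr (unbump-suc-range rd rc)) h′ | free⁻ rd (proj₂ rc) fr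
    ...   | lo , hi | f₀ , f₁ = window⁺ (proj₁ (mirror-range rc))
      (subst (l <_) (sym (unbump-mirror rc)) lo) (subst (_≤ u) (sym (unbump-mirror rc)) hi) f₀ f₁
    creates⁺ : ∀ {n w d l u} → InRange n d → Creates n w l u → ∀ {c} → InRange (suc n) c →
      lower′ (mirror n d) l u < mirror (suc n) c × mirror (suc n) c ≤ upper′ (mirror n d) u → Head R c (suc n) (child d w)
    creates⁺ {n} {w} {d} {l} {u} rd cr rc (lo , hi) with window⁻ {mirror n d} {_} {l} {u} (proj₁ (mirror-range rc)) lo hi
    ... | (lo′ , hi′) , f₀ , f₁ = head-child⁺ rd rc
      (proj₂ (cr (unbump-suc-range rd rc)) (subst (l <_) (unbump-mirror rc) lo′ , subst (_≤ u) (unbump-mirror rc) hi′)) (free⁺ rd (proj₂ rc) f₀ f₁)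
    creates-max⁻ : ∀ {n w c} → IsPerm n w → InRange (suc n) c → Head R c (suc n) (child (suc n) w) →
      0 < mirror (suc n) c × mirror (suc n) c ≤ 1
    creates-max⁻ {n} {w} {c} P rc@(c≥1 , c≤) h with m≤n⇒m<n∨m≡n c≤
    ... | inj₂ refl = proj₁ (mirror-range rc) , ≤-reflexive (m+n∸n≡m 1 (suc n))
    ... | inj₁ lt = ⊥-elim (absurd (head-new-max⁻ P h (occurs P (≤-trans c≥1 (≤-pred lt) , ≤-refl))))
      where
      absurd : Free R 2F c (suc n) n → ⊥
      absurd fr rewrite zone-middle {c} {suc n} {n} (≤-pred lt) ≤-refl with () ← fr
    creates-max⁺ : ∀ {n w c} → IsPerm n w → InRange (suc n) c → 0 < mirror (suc n) c × mirror (suc n) c ≤ 1 → Head R c (suc n) (child (suc n) w)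
    creates-max⁺ {n} {w} {c} P rc (_ , le) = head-new-max⁺ P (proj₂ rc) free
      where
      n<c : suc n ≤ c
      n<c = ≮⇒≥ λ lt → <⇒≱ (mirror-< {suc n} ≤-refl lt) (≤-trans le (≤-reflexive (sym (m+n∸n≡m 1 (suc n)))))
      free : ∀ {e} → InRange n e → Free R 2F c (suc n) e
      free {e} (e≥1 , e≤n) rewrite zone-below {c} {suc n} {e} (≤-trans (s≤s e≤n) n<c) = refl
    -- The destroying ranks are those up to the first point, so the least first value `k` decides.
    -- Read from above, these ranks have the last `k` indices, whence `a + k = n`.
    Pend : ℕ → List ℕ → ℕ → ℕ → Set
    Pend n w a k = ∃[ y ] OccAt R k y w × a + k ≡ n × (∀ {u v} → OccAt R u v w → k ≤ u)
    pend-new : ∀ {n w c} → IsPerm n w → InRange n c → (∀ {x y} → OccAt R x y w → R zero (zone (bump c x) (bump c y) c) ≡ true) →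
      Head R c n w → Pend (suc n) (child c w) (mirror n c) (suc n ∸ mirror n c)
    pend-new {n} {w} {c} P rc@(_ , c≤n) blocked h rewrite mirror-invol rc =
      bump c n , head⇒occAt h , m∸n+n≡m (m≤n⇒m≤1+n c≤n) , lowest
      where
      lowest : ∀ {u v} → OccAt R u v (child c w) → c ≤ u
      lowest o with occAt-child⁻ o
      ... | new _ = ≤-refl
      ... | inherited fr o′ = ⊥-elim (true≢false (trans (sym (blocked o′)) fr))
    mirror-above : ∀ {n a k c} → a + k ≡ n → mirror n c ≤ a → k < c
    mirror-above {n} {a} {k} {c} refl le = ≰⇒> λ c≤k → <⇒≱ (≤-refl {suc a})
      (≤-trans (≤-reflexive (sym (m+n∸n≡m (suc a) k))) (≤-trans (∸-monoʳ-≤ (suc (a + k)) c≤k) le))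
    mirror-below : ∀ {n a k c} → a + k ≡ n → a < mirror n c → c ≤ k
    mirror-below {n} {a} {k} {c} refl lt = ≮⇒≥ λ k<c → <⇒≱ lt (≤-trans (∸-monoʳ-≤ (suc (a + k)) k<c) (≤-reflexive (m+n∸n≡m a k)))
    pend-below : ∀ {n w a k c} → IsPerm n w → InRange n c → Pend n w a k → mirror n c ≤ a → Pend (suc n) (child c w) (suc a) k
    pend-below {n} {w} {a} {k} {c} P rc (y , o , e , lowest) le =
      bump c y , subst (λ t → OccAt R t (bump c y) (child c w)) (bump-< k<c) (occAt-child⁺ free o) , cong suc e , lowest′
      where
      k<c : k < c
      k<c = mirror-above e le
      free : R zero (zone (bump c k) (bump c y) c) ≡ false
      free with c ≤? y
      ... | yes p rewrite zone-c-middle k<c p = refl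
      ... | no p rewrite zone-c-above (OccAt.x<y o) (≰⇒> p) = refl
      lowest′ : ∀ {u v} → OccAt R u v (child c w) → k ≤ u
      lowest′ o′ with occAt-child⁻ o′
      ... | new _ = <⇒≤ k<c
      ... | inherited _ o″ = ≤-trans (≤-reflexive (sym (bump-< k<c))) (bump-mono-≤ c (lowest o″))
    pend-inside : ∀ {n w a k c} → s₁ ≡ true → IsPerm n w → InRange n c → Pend n w a k → a < mirror n c →
      ∀ {x y} → OccAt R x y w → R zero (zone (bump c x) (bump c y) c) ≡ true
    pend-inside {c = c} e P rc (y , o , e′ , lowest) lt o′ =
      trans (cong (R zero) (zone-c-below {c} (≤-trans (mirror-below e′ lt) (lowest o′)) (OccAt.x<y o′))) e
    pend-max : ∀ {n w a k} → IsPerm n w → Pend n w a k → ∃[ a′ ] 1 ≤ a′ × Pend (suc n) (child (suc n) w) a′ k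
    pend-max {n} {w} {a} {k} P (y , o , e , lowest) = suc a , s≤s z≤n , y ,
      subst₂ (λ s t → OccAt R s t (child (suc n) w)) (bump-< k<) (bump-< y<) (occAt-child⁺ free o) , cong suc e , lowest′
      where
      y< : y < suc n
      y< = s≤s (proj₂ (proj₂ (occAt-range P o)))
      k< : k < suc n
      k< = <-trans (OccAt.x<y o) y<
      free : R zero (zone (bump (suc n) k) (bump (suc n) y) (suc n)) ≡ false
      free rewrite zone-c-above (OccAt.x<y o) y< = refl
      lowest′ : ∀ {u v} → OccAt R u v (child (suc n) w) → k ≤ u
      lowest′ o′ with occAt-child⁻ o′
      ... | new h = ⊥-elim (<⇒≱ (Head.c≤y h) (proj₂ (All.lookup (bnd P) (head-y∈ h))))
      ... | inherited _ o″ = ≤-trans (≤-reflexive (sym (bump-< k<))) (bump-mono-≤ (suc n) (lowest o″))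

prefix~suffix : ∀ t₀ t₁ s₁ → prefixShading t₀ t₁ s₁ ~ suffixShading t₀ t₁ s₁
prefix~suffix t₀ t₁ s₁ = ~-simulation (Model.simulation prefix-model) (Model.simulation suffix-model) refl
  where
  open WindowMachine t₀ t₁ s₁
  open Models t₀ t₁ s₁

-- Mirroring above the left-to-right minima

-- The shaded boxes of the bottom row say that nothing smaller precedes the first point or stands
-- between the two points. So the first point is the last left-to-right minimum before the second,
-- and the second determines the first.
valleyShading : (r₁₁ r₁₂ r₂₁ r₂₂ : Bool) → Shading
valleyShading r₁₁ r₁₂ r₂₁ r₂₂ = shading □ r₁₂ r₂₂  □ r₁₁ r₂₁  ■ ■ □

all-cong : ∀ {A : Set} {f g : A → Bool} xs → (∀ {x} → x ∈ xs → f x ≡ g x) → all f xs ≡ all g xs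
all-cong [] _ = refl
all-cong (x ∷ xs) h = cong₂ _∧_ (h (here refl)) (all-cong xs (h ∘ there))

all-map : ∀ {A B : Set} (f : B → Bool) (g : A → B) xs → all f (map g xs) ≡ all (f ∘ g) xs
all-map f g [] = refl
all-map f g (x ∷ xs) = cong (f (g x) ∧_) (all-map f g xs)

bool-ext : ∀ {a b} → (a ≡ true → b ≡ true) → (b ≡ true → a ≡ true) → a ≡ b
bool-ext {true} f _ = sym (f refl)
bool-ext {false} {true} _ g = g refl
bool-ext {false} {false} _ _ = refl

-- Reading w from left to right, m is the last left-to-right minimum and B lists the entries since then.  Both are
-- only compared with later entries through _<ᵇ_, so they may as well be gaps (g standing between g and g + 1).
module Valley (r₁₁ r₁₂ r₂₁ r₂₂ : Bool) where

  R : Shading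
  R = valleyShading r₁₁ r₁₂ r₂₁ r₂₂

  midOK : ℕ → ℕ → Bool
  midOK y g = not (if g <ᵇ y then r₁₁ else r₁₂)

  endOK : ℕ → ℕ → ℕ → Bool
  endOK m y x = not (if m <ᵇ x then (if x <ᵇ y then r₂₁ else r₂₂) else false)

  -- `y` as second point with the current minimum `m` as first: `B` is then column 1 and `w` is
  -- column 2.
  event : ℕ → List ℕ → ℕ → List ℕ → Bool
  event m B y w = all (midOK y) B ∧ all (endOK m y) w

  good : ℕ → List ℕ → List ℕ → Bool
  good m B [] = true
  good m B (y ∷ w) = if m <ᵇ y then not (event m B y w) ∧ good m (y ∷ B) w else good y [] w

  -- The first point of an occurrence is either the minimum `m` read before, which is this record,
  -- or it is still to be read. In the latter case, `Low`, it is a new left-to-right minimum and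
  -- cannot exceed `m`.
  record Completed (m : ℕ) (B w : List ℕ) : Set where
    constructor completed
    field
      {Y Z}    : List ℕ
      {y}      : ℕ
      split    : w ≡ Y ++ y ∷ Z
      m<y      : m < y
      m<Y      : All (m <_) Y
      since    : All (λ e → midOK y e ≡ true) B
      mid      : All (λ e → midOK y e ≡ true) Y
      right    : All (λ e → endOK m y e ≡ true) Z

  record Low (m : ℕ) (w : List ℕ) : Set where
    constructor isLow
    field
      {X Y Z} : List ℕ
      {x y}   : ℕ
      split   : w ≡ X ++ x ∷ Y ++ y ∷ Z
      x≤m     : x ≤ m
      x<y     : x < y
      left    : All (Free R zero x y) X
      mid     : All (Free R 1F x y) Y
      right   : All (Free R 2F x y) Z

  all-true-All⁻ : ∀ {f : ℕ → Bool} w → all f w ≡ true → All (λ e → f e ≡ true) w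
  all-true-All⁻ {f} w e = All.tabulate (all-true⁻ f w e)

  all-true-All⁺ : ∀ {f : ℕ → Bool} w → All (λ e → f e ≡ true) w → all f w ≡ true
  all-true-All⁺ {f} w h = all-true⁺ f w (All.lookup h)

  free-left : ∀ {x y e} → x < y → x ≤ e → Free R zero x y e
  free-left {x} {y} {e} lt le with gapView {x} {y} e (<⇒≤ lt)
  ... | below p _ = ⊥-elim (<⇒≱ p le)
  ... | middle _ _ z rewrite z = refl
  ... | above _ z rewrite z = refl

  free-left⁻ : ∀ {x y e} → x < y → Free R zero x y e → x ≤ e
  free-left⁻ {x} {y} {e} lt fr = ≮⇒≥ λ p → true≢false (trans (sym (cong (R zero) (zone-below {x} {y} p))) fr)

  free-mid : ∀ {x y e} → x < y → x < e → midOK y e ≡ true → Free R 1F x y e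
  free-mid {x} {y} {e} lt x<e ok with gapView {x} {y} e (<⇒≤ lt)
  ... | below p _ = ⊥-elim (<-asym p x<e)
  ... | middle _ q z rewrite z | <ᵇ-true q = not-true⁻ ok
  ... | above q z rewrite z | <ᵇ-false q = not-true⁻ ok

  free-mid⁻ : ∀ {x y e} → x < y → e ≢ x → Free R 1F x y e → x < e × midOK y e ≡ true
  free-mid⁻ {x} {y} {e} lt ne fr with gapView {x} {y} e (<⇒≤ lt)
  ... | below p z rewrite z with () ← fr
  free-mid⁻ {x} {y} {e} lt ne fr | middle p q z rewrite z | <ᵇ-true q = ≤∧≢⇒< p (ne ∘ sym) , cong not fr
  ... | above q z rewrite z | <ᵇ-false q = <-≤-trans lt q , cong not fr

  free-right : ∀ {x y e} → x < y → e ≢ x → endOK x y e ≡ true → Free R 2F x y e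
  free-right {x} {y} {e} lt ne ok with gapView {x} {y} e (<⇒≤ lt)
  ... | below p z rewrite z = refl
  ... | middle p q z rewrite z | <ᵇ-true (≤∧≢⇒< p (ne ∘ sym)) | <ᵇ-true q = not-true⁻ ok
  ... | above q z rewrite z | <ᵇ-true (<-≤-trans lt q) | <ᵇ-false q = not-true⁻ ok

  free-right⁻ : ∀ {x y e} → x < y → e ≢ x → Free R 2F x y e → endOK x y e ≡ true
  free-right⁻ {x} {y} {e} lt ne fr with gapView {x} {y} e (<⇒≤ lt)
  ... | below p z rewrite <ᵇ-false (<⇒≤ p) = refl
  ... | middle p q z rewrite z | <ᵇ-true (≤∧≢⇒< p (ne ∘ sym)) | <ᵇ-true q = cong not fr
  ... | above q z rewrite z | <ᵇ-true (<-≤-trans lt q) | <ᵇ-false q = cong not fr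

  distinct : ∀ {x : ℕ} {Y : List ℕ} {y : ℕ} {Z : List ℕ} → All (x ≢_) (Y ++ y ∷ Z) → All (_≢ x) Y × All (_≢ x) Z
  distinct {Y = Y} ne = All.map (_∘ sym) (All.++⁻ˡ Y ne) , All.map (_∘ sym) (All.tail (All.++⁻ʳ Y ne))

  mids⁺ : ∀ x y {Y} → x < y → All (x <_) Y → All (λ e → midOK y e ≡ true) Y → All (Free R 1F x y) Y
  mids⁺ x y lt [] [] = []
  mids⁺ x y lt (_∷_ {e} p ps) (q ∷ qs) = free-mid {x} {y} {e} lt p q ∷ mids⁺ x y lt ps qs

  mids⁻ : ∀ x y {Y} → x < y → All (_≢ x) Y → All (Free R 1F x y) Y → All (x <_) Y × All (λ e → midOK y e ≡ true) Y
  mids⁻ x y lt [] [] = [] , []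
  mids⁻ x y lt (_∷_ {e} p ps) (q ∷ qs) with free-mid⁻ {x} {y} {e} lt p q | mids⁻ x y lt ps qs
  ... | a , b | as , bs = a ∷ as , b ∷ bs

  rights⁺ : ∀ x y {Z} → x < y → All (_≢ x) Z → All (λ e → endOK x y e ≡ true) Z → All (Free R 2F x y) Z
  rights⁺ x y lt [] [] = []
  rights⁺ x y lt (_∷_ {e} p ps) (q ∷ qs) = free-right {x} {y} {e} lt p q ∷ rights⁺ x y lt ps qs

  rights⁻ : ∀ x y {Z} → x < y → All (_≢ x) Z → All (Free R 2F x y) Z → All (λ e → endOK x y e ≡ true) Z
  rights⁻ x y lt [] [] = []
  rights⁻ x y lt (_∷_ {e} p ps) (q ∷ qs) = free-right⁻ {x} {y} {e} lt p q ∷ rights⁻ x y lt ps qs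

  bad⇒ : ∀ {m B} w → Unique w → good m B w ≡ false → Completed m B w ⊎ Low m w
  bad⇒ {m} {B} (y ∷ w) (y∉ ∷ u) e with m <? y
  ... | yes lt rewrite <ᵇ-true lt with event m B y w in ev
  ...   | true with ∧-true {all (midOK y) B} ev
  ...     | eB , ew = inj₁ (completed {Y = []} refl lt [] (all-true-All⁻ B eB) [] (all-true-All⁻ w ew))
  bad⇒ {m} {B} (y ∷ w) (y∉ ∷ u) e | yes lt | false with bad⇒ w u e
  ...     | inj₁ (completed refl m<v m<Y (okB ∷ since) mid right) = inj₁ (completed {Y = y ∷ _} refl m<v (lt ∷ m<Y) since (okB ∷ mid) right)
  ...     | inj₂ (isLow {x = x} {v} refl x≤m x<v left mid right) =
    inj₂ (isLow {X = y ∷ _} refl x≤m x<v (free-left {x} {v} {y} x<v (<⇒≤ (≤-<-trans x≤m lt)) ∷ left) mid right)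
  bad⇒ {m} {B} (y ∷ w) (y∉ ∷ u) e | no ge rewrite <ᵇ-false (≮⇒≥ ge) with bad⇒ w u e
  ...   | inj₁ (completed {Y} {Z} {v} refl y<v y<Y _ mid right) = inj₂ (isLow {X = []} refl (≮⇒≥ ge) y<v []
    (mids⁺ y v y<v y<Y mid) (rights⁺ y v y<v (proj₂ (distinct {y} {Y} {v} {Z} y∉)) right))
  ...   | inj₂ (isLow {x = x} {v} refl x≤y x<v left mid right) =
    inj₂ (isLow {X = y ∷ _} refl (≤-trans x≤y (≮⇒≥ ge)) x<v (free-left {x} {v} {y} x<v x≤y ∷ left) mid right)

  ⇒bad : ∀ {m B} w → Unique w → Completed m B w ⊎ Low m w → good m B w ≡ false
  ⇒bad [] _ (inj₁ (completed {[]} () _ _ _ _ _))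
  ⇒bad [] _ (inj₁ (completed {_ ∷ _} () _ _ _ _ _))
  ⇒bad [] _ (inj₂ (isLow {[]} () _ _ _ _ _))
  ⇒bad [] _ (inj₂ (isLow {_ ∷ _} () _ _ _ _ _))
  ⇒bad {m} {B} (y ∷ w) (y∉ ∷ u) bad with m <? y
  ⇒bad {m} {B} (y ∷ w) (y∉ ∷ u) (inj₁ (completed {[]} refl m<y _ since _ right)) | yes lt
    rewrite <ᵇ-true lt | all-true-All⁺ B since | all-true-All⁺ w right = refl
  ⇒bad {m} {B} (y ∷ w) (y∉ ∷ u) (inj₁ (completed {_ ∷ _} refl m<v (_ ∷ m<Y) since (ok ∷ mid) right)) | yes lt
    rewrite <ᵇ-true lt | ⇒bad {m} {y ∷ B} w u (inj₁ (completed refl m<v m<Y (ok ∷ since) mid right)) = ∧-zeroʳ _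
  ⇒bad {m} {B} (y ∷ w) (y∉ ∷ u) (inj₂ (isLow {[]} refl x≤m _ _ _ _)) | yes lt = ⊥-elim (<⇒≱ lt x≤m)
  ⇒bad {m} {B} (y ∷ w) (y∉ ∷ u) (inj₂ (isLow {_ ∷ _} refl x≤m x<v (_ ∷ left) mid right)) | yes lt
    rewrite <ᵇ-true lt | ⇒bad {m} {y ∷ B} w u (inj₂ (isLow refl x≤m x<v left mid right)) = ∧-zeroʳ _
  ⇒bad {m} {B} (y ∷ w) (y∉ ∷ u) (inj₁ (completed {[]} refl m<y _ _ _ _)) | no ge = ⊥-elim (ge m<y)
  ⇒bad {m} {B} (y ∷ w) (y∉ ∷ u) (inj₁ (completed {_ ∷ _} refl _ (m<y ∷ _) _ _ _)) | no ge = ⊥-elim (ge m<y)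
  ⇒bad {m} {B} (y ∷ w) (y∉ ∷ u) (inj₂ (isLow {[]} {Y} {Z} {y = v} refl _ y<v _ mid right)) | no ge
    rewrite <ᵇ-false (≮⇒≥ ge) with mids⁻ y v y<v (proj₁ (distinct {y} {Y} {v} {Z} y∉)) mid
  ... | y<Y , oks = ⇒bad w u (inj₁ (completed {Y = Y} {Z} refl y<v y<Y [] oks (rights⁻ y v y<v (proj₂ (distinct {y} {Y} {v} {Z} y∉)) right)))
  ⇒bad {m} {B} (y ∷ w) (y∉ ∷ u) (inj₂ (isLow {_ ∷ _} {x = x} {v} refl _ x<v (fr ∷ left) mid right)) | no ge
    rewrite <ᵇ-false (≮⇒≥ ge) = ⇒bad {y} {[]} w u (inj₂ (isLow refl (free-left⁻ {x} {v} {y} x<v fr) x<v left mid right))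

  -- Starting from `m = n` amounts to having no minimum yet: no entry exceeds n, so the first entry
  -- read becomes the minimum.
  avoids-good : ∀ {n w} → IsPerm n w → avoidsᵇ (p12 , R) n w ≡ good n [] w
  avoids-good {n} {w} P with good n [] w in eq
  ... | true with containsᵇ (p12 , R) n w in eq′
  ...   | false = refl
  ...   | true with contains⇒occ {R} P eq′
  ...     | occ {X} {Y} {Z} {x} {y} refl lt l m r with () ← trans (sym (⇒bad {n} {[]} w (uniq P) (inj₂ (isLow {X = X} {Y} {Z} {x} {y} refl (proj₂ (All.lookup (bnd P) (∈-++⁺ʳ X (here refl)))) lt l m r)))) eq
  avoids-good {n} {w} P | false with bad⇒ {n} {[]} w (uniq P) eq
  ... | inj₁ (completed {Y} refl n<y _ _ _ _) = ⊥-elim (<⇒≱ n<y (proj₂ (All.lookup (bnd P) (∈-++⁺ʳ Y (here refl)))))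
  ... | inj₂ (isLow {X} {Y} {Z} {x} {y} refl _ lt l m r) = cong not (occ⇒contains {R} P (occ {X = X} {Y} {Z} {x} {y} refl lt l m r))

  -- `g` is a gap here. When the value `c` is removed from the scale, the gaps at or above `c` move
  -- down by one.
  <ᵇ-bump : ∀ c g x → 1 ≤ c → (g <ᵇ bump c x) ≡ (unbump c g <ᵇ x)
  <ᵇ-bump c g x c≥1 with g <? c | x <? c
  ... | yes p | yes q rewrite <ᵇ-true p | <ᵇ-true q = refl
  ... | yes p | no q rewrite <ᵇ-true p | <ᵇ-false (≮⇒≥ q) =
    trans (<ᵇ-true (m<n⇒m<1+n (<-≤-trans p (≮⇒≥ q)))) (sym (<ᵇ-true (<-≤-trans p (≮⇒≥ q))))
  <ᵇ-bump c zero x c≥1 | no p | _ = ⊥-elim (p c≥1)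
  <ᵇ-bump c (suc g) x c≥1 | no p | yes q rewrite <ᵇ-false (≮⇒≥ p) | <ᵇ-true q =
    trans (<ᵇ-false (<⇒≤ (<-≤-trans q (≮⇒≥ p)))) (sym (<ᵇ-false (≤-pred (<-≤-trans q (≮⇒≥ p)))))
  <ᵇ-bump c (suc g) x c≥1 | no p | no q rewrite <ᵇ-false (≮⇒≥ p) | <ᵇ-false (≮⇒≥ q) = refl

  unbump-bump : ∀ c x → unbump c (bump c x) ≡ x
  unbump-bump c x with x <? c
  ... | yes p rewrite <ᵇ-true p | <ᵇ-true p = refl
  ... | no p rewrite <ᵇ-false (≮⇒≥ p) | <ᵇ-false {suc x} {c} (m≤n⇒m≤1+n (≮⇒≥ p)) = refl

  good-bump : ∀ c m B w → 1 ≤ c → good m B (map (bump c) w) ≡ good (unbump c m) (map (unbump c) B) w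
  good-bump c m B [] _ = refl
  good-bump c m B (y ∷ w) c≥1 = cong₂ (λ s (t : Bool × Bool) → if s then proj₁ t else proj₂ t) (<ᵇ-bump c m y c≥1)
    (cong₂ _,_ (cong₂ (λ s t → not s ∧ t) event-bump
        (trans (good-bump c m (bump c y ∷ B) w c≥1) (cong (λ t → good (unbump c m) (t ∷ map (unbump c) B) w) (unbump-bump c y))))
      (trans (good-bump c (bump c y) [] w c≥1) (cong (λ t → good t [] w) (unbump-bump c y))))
    where
    event-bump : event m B (bump c y) (map (bump c) w) ≡ event (unbump c m) (map (unbump c) B) y w
    event-bump = cong₂ _∧_
      (trans (all-cong B λ {g} _ → cong (λ t → not (if t then r₁₁ else r₁₂)) (<ᵇ-bump c g y c≥1)) (sym (all-map (midOK y) (unbump c) B)))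
      (trans (all-map (endOK m (bump c y)) (bump c) w) (all-cong w λ {x} _ →
        cong₂ (λ s t → not (if s then (if t then r₂₁ else r₂₂) else false)) (<ᵇ-bump c m x c≥1) (bump-<ᵇ c x y)))

  count : ℕ → List ℕ → ℕ → ℕ
  count b B r = sumOf (S r) (indicator ∘ good b B)

  first : ℕ → List ℕ → ℕ → ℕ → ℕ
  first b B r c = sumOf (S r) (λ w → indicator (good b B (child c w)))

  count-suc : ∀ b B r → count b B (suc r) ≡ ∑ (suc r) (first b B r)
  count-suc b B r = sumOf-S′ r {indicator ∘ good b B}

  unbump-self : ∀ c → unbump c c ≡ pred c
  unbump-self c rewrite <ᵇ-false {c} {c} ≤-refl = refl

  first-low : ∀ {b B r c} → 1 ≤ c → c ≤ b → first b B r c ≡ count (pred c) [] r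
  first-low {b} {B} {r} {c} c≥1 c≤b = sumOf-cong (S r) λ {w} _ → cong indicator (step w)
    where
    step : ∀ w → good b B (child c w) ≡ good (pred c) [] w
    step w rewrite <ᵇ-false c≤b = trans (good-bump c c [] w c≥1) (cong (λ t → good t [] w) (unbump-self c))

  afterwards : ℕ → List ℕ → List ℕ
  afterwards c B = pred c ∷ map (unbump c) B

  -- Whether `c` completes an occurrence depends on the set of the later entries and not on their
  -- order, so one truth value `e` serves for all `w`.
  first-high : ∀ {b B r c} e → b < c → (∀ {w} → IsPerm r w → event b B c (map (bump c) w) ≡ e) →
    first b B r c ≡ sumOf (S r) (λ w → indicator (not e ∧ good b (afterwards c B) w))
  first-high {b} {B} {r} {c} e b<c ev = sumOf-cong (S r) λ {w} w∈ → cong indicator (step w (ev (∈S⇒IsPerm {r} w∈)))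
    where
    step : ∀ w → event b B c (map (bump c) w) ≡ e → good b B (child c w) ≡ not e ∧ good b (afterwards c B) w
    step w refl rewrite <ᵇ-true b<c = cong (not (event b B c (map (bump c) w)) ∧_)
      (trans (good-bump c b (c ∷ B) w (≤-trans (s≤s z≤n) b<c))
        (cong₂ (λ s t → good s (t ∷ map (unbump c) B) w) (unbump-< b<c) (unbump-self c)))
      where
      unbump-< : ∀ {b} → b < c → unbump c b ≡ b
      unbump-< lt rewrite <ᵇ-true lt = refl

  EndsOK : ℕ → ℕ → ℕ → Set
  EndsOK b c r = ∀ {x} → InRange (suc r) x → x ≢ c → endOK b c x ≡ true

  ends⁻ : ∀ {b c r w} → IsPerm r w → InRange (suc r) c → all (endOK b c) (map (bump c) w) ≡ true → EndsOK b c r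
  ends⁻ {b} {c} {r} {w} P rc e {x} rx ne = subst (λ t → endOK b c t ≡ true) (bump-unbump (proj₁ rx) ne)
    (all-true⁻ (endOK b c) (map (bump c) w) e (∈-map⁺ (bump c) (occurs P (unbump-range rc rx ne))))

  ends⁺ : ∀ {b c r w} → IsPerm r w → EndsOK b c r → all (endOK b c) (map (bump c) w) ≡ true
  ends⁺ {b} {c} {r} {w} P ok = trans (all-map (endOK b c) (bump c) w) (all-true⁺ _ w λ {x} x∈ →
    ok (bump-range {r} {c} (All.lookup (bnd P) x∈)) (bump≢c {c} {x}))

-- With this constant the mirror reverses the values from b + 1 to r + 1 among themselves, so lying
-- between `b` and `c` and lying above `c` change places.
ends-mirror : ∀ r₁₁ r₁₂ r₂₁ r₂₂ {b c r} → b < c → c ≤ suc r → Valley.EndsOK r₁₁ r₁₂ r₂₁ r₂₂ b c r →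
  Valley.EndsOK r₁₂ r₁₁ r₂₂ r₂₁ b (mirror (suc r + b) c) r
ends-mirror r₁₁ r₁₂ r₂₁ r₂₂ {b} {c} {r} b<c c≤ ok {y} (y≥1 , y≤) ne with b <? y
... | no p rewrite <ᵇ-false (≮⇒≥ p) = refl
... | yes p rewrite <ᵇ-true p = compare (<-cmp y c′)
  where
  N = suc r + b
  c′ = mirror N c
  x = mirror N y
  b<x : b < x
  b<x = ≤-trans (≤-reflexive (sym (m+n∸m≡n (suc r) (suc b)))) (≤-trans (∸-monoʳ-≤ (suc r + suc b) y≤) (≤-reflexive (cong (_∸ y) (+-suc (suc r) b))))
  rx : InRange (suc r) x
  rx = ≤-trans (s≤s z≤n) b<x , ≤-trans (∸-monoʳ-≤ (suc N) p) (≤-reflexive (m+n∸n≡m (suc r) b))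
  y≤N : y ≤ N
  y≤N = ≤-trans y≤ (m≤m+n (suc r) b)
  rc : InRange N c
  rc = ≤-trans (s≤s z≤n) b<c , ≤-trans c≤ (m≤m+n (suc r) b)
  x≢c : x ≢ c
  x≢c e = ne (trans (sym (mirror-invol (y≥1 , y≤N))) (cong (mirror N) e))
  okx : not (if x <ᵇ c then r₂₁ else r₂₂) ≡ true
  okx = trans (cong (λ t → not (if t then (if x <ᵇ c then r₂₁ else r₂₂) else false)) (sym (<ᵇ-true b<x))) (ok rx x≢c)
  compare : _ → not (if y <ᵇ c′ then r₂₂ else r₂₁) ≡ true
  compare (tri≈ _ e _) = ⊥-elim (ne e)
  compare (tri< lt _ _) = trans (cong (λ t → not (if t then r₂₂ else r₂₁)) (<ᵇ-true lt))
    (trans (cong (λ t → not (if t then r₂₁ else r₂₂)) (sym (<ᵇ-false (<⇒≤ c<x)))) okx)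
    where
    c<x : c < x
    c<x = subst (_< x) (mirror-invol rc) (mirror-< (proj₂ (mirror-range rc)) lt)
  compare (tri> _ _ gt) = trans (cong (λ t → not (if t then r₂₂ else r₂₁)) (<ᵇ-false (<⇒≤ gt)))
    (trans (cong (λ t → not (if t then r₂₁ else r₂₂)) (sym (<ᵇ-true x<c))) okx)
    where
    x<c : x < c
    x<c = subst (x <_) (mirror-invol rc) (mirror-< y≤N gt)

-- Reversing the order of the entries above the current left-to-right minimum exchanges the two upper rows.
module ValleyMirror (r₁₁ r₁₂ r₂₁ r₂₂ : Bool) where

  module V = Valley r₁₁ r₁₂ r₂₁ r₂₂
  module V′ = Valley r₁₂ r₁₁ r₂₂ r₂₁

  mid-mirror : ∀ {N y g} → g ≤ N → V.midOK y g ≡ V′.midOK (mirror N y) (N ∸ g)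
  mid-mirror {N} {y} {g} g≤N with g <? y
  ... | yes p rewrite <ᵇ-true p | <ᵇ-false {N ∸ g} {suc N ∸ y} (∸-monoʳ-≤ (suc N) p) = refl
  ... | no p rewrite <ᵇ-false (≮⇒≥ p) | <ᵇ-true {N ∸ g} {suc N ∸ y}
    (≤-trans (s≤s (∸-monoʳ-≤ N (≮⇒≥ p))) (≤-reflexive (sym (+-∸-assoc 1 (≤-trans (≮⇒≥ p) g≤N))))) = refl

  -- Where an entry `y` goes to N + 1 - y, the gap between g and g + 1 goes to the gap N - g.
  mirror-context : ℕ → List ℕ → List ℕ
  mirror-context N = map (N ∸_)

  event-mirror : ∀ {b B c r v w} → b < c → c ≤ suc r → All (_≤ suc r + b) B → IsPerm r v → IsPerm r w →
    V.event b B c (map (bump c) v) ≡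
    V′.event b (mirror-context (suc r + b) B) (mirror (suc r + b) c) (map (bump (mirror (suc r + b) c)) w)
  event-mirror {b} {B} {c} {r} {v} {w} b<c c≤ bB P Q = cong₂ _∧_
    (trans (all-cong B λ {g} g∈ → mid-mirror {N} {c} {g} (All.lookup bB g∈)) (sym (all-map (V′.midOK (mirror N c)) (N ∸_) B)))
    (bool-ext (λ e → V′.ends⁺ Q (ends-mirror r₁₁ r₁₂ r₂₁ r₂₂ b<c c≤ (V.ends⁻ P rc e)))
      (λ e → V.ends⁺ P (subst (λ t → V.EndsOK b t r) (mirror-invol rcN)
        (ends-mirror r₁₂ r₁₁ r₂₂ r₂₁ b<c′ c′≤ (V′.ends⁻ Q rc′ e)))))
    where
    N = suc r + b
    c′ = mirror N c
    rc : InRange (suc r) c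
    rc = ≤-trans (s≤s z≤n) b<c , c≤
    rcN : InRange N c
    rcN = proj₁ rc , ≤-trans c≤ (m≤m+n (suc r) b)
    b<c′ : b < c′
    b<c′ = ≤-trans (≤-reflexive (sym (m+n∸m≡n (suc r) (suc b)))) (≤-trans (∸-monoʳ-≤ (suc r + suc b) c≤) (≤-reflexive (cong (_∸ c) (+-suc (suc r) b))))
    c′≤ : c′ ≤ suc r
    c′≤ = ≤-trans (∸-monoʳ-≤ (suc N) b<c) (≤-reflexive (m+n∸n≡m (suc r) b))
    rc′ : InRange (suc r) c′
    rc′ = ≤-trans (s≤s z≤n) b<c′ , c′≤

  pred-suc∸ : ∀ {m d} → d ≤ m → pred (suc m ∸ d) ≡ m ∸ d
  pred-suc∸ d≤m = cong pred (+-∸-assoc 1 d≤m)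

  -- One value has been used up, so the constant of the mirror drops by one; the gap left by `c`
  -- goes to the gap left by its mirror image.
  afterwards-mirror : ∀ {r b c} B → b < c → c ≤ suc r → All (λ g → b ≤ g × g ≤ suc r) B →
    mirror-context (r + b) (V.afterwards c B) ≡ V′.afterwards (mirror (suc r + b) c) (mirror-context (suc r + b) B)
  afterwards-mirror {r} {b} {suc d} B b<c c≤ bB = cong₂ _∷_ (sym (pred-suc∸ d≤)) (trans (sym (map-∘ B)) (trans (map-cong-∈ B bB) (map-∘ B)))
    where
    d≤ : d ≤ r + b
    d≤ = ≤-trans (≤-pred c≤) (m≤m+n r b)
    c = suc d
    N = suc r + b
    c′ = mirror N c
    entry : ∀ {g} → b ≤ g × g ≤ suc r → r + b ∸ unbump c g ≡ unbump c′ (N ∸ g)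
    entry {g} (b≤g , g≤) with g <? c
    ... | yes p rewrite <ᵇ-true p | <ᵇ-false {N ∸ g} {c′} (∸-monoʳ-≤ (suc N) p) = sym (pred-suc∸ (≤-trans (≤-pred p) d≤))
    entry {zero} (b≤g , g≤) | no p = ⊥-elim (p (s≤s z≤n))
    entry {suc g} (b≤g , g≤) | no p rewrite <ᵇ-false (≮⇒≥ p) | <ᵇ-true {N ∸ suc g} {c′}
      (≤-trans (s≤s (∸-monoʳ-≤ (r + b) (≤-pred (≮⇒≥ p)))) (≤-reflexive (sym (+-∸-assoc 1 d≤)))) = refl
    map-cong-∈ : ∀ B → All (λ g → b ≤ g × g ≤ suc r) B → map (λ g → r + b ∸ unbump c g) B ≡ map (λ g → unbump c′ (N ∸ g)) B
    map-cong-∈ [] [] = refl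
    map-cong-∈ (g ∷ B) (h ∷ hs) = cong₂ _∷_ (entry h) (map-cong-∈ B hs)

  afterwards-range : ∀ {r b c B} → b < c → c ≤ suc r → All (λ g → b ≤ g × g ≤ suc r) B → All (λ g → b ≤ g × g ≤ r) (V.afterwards c B)
  afterwards-range {r} {b} {suc d} {B} (s≤s b≤d) (s≤s d≤r) bB = (b≤d , d≤r) ∷ All.map⁺ (All.map entry bB)
    where
    entry : ∀ {g} → b ≤ g × g ≤ suc r → b ≤ unbump (suc d) g × unbump (suc d) g ≤ r
    entry {g} (b≤g , g≤) with g <? suc d
    ... | yes p rewrite <ᵇ-true p = b≤g , ≤-trans (≤-pred p) d≤r
    ... | no p rewrite <ᵇ-false (≮⇒≥ p) = ≤-trans b≤d (≤-trans (pred-mono-≤ (≮⇒≥ p)) ≤-refl) , pred-mono-≤ g≤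

  -- Induction on the number of entries still to be read. A first entry up to `b` is a new minimum,
  -- which clears the context on both sides; a first entry above `b` is matched with its mirror
  -- image.
  count-mirror : ∀ r b B → b ≤ r → All (λ g → b ≤ g × g ≤ r) B → V.count b B r ≡ V′.count b (mirror-context (r + b) B) r
  count-mirror zero b B _ _ = refl
  count-mirror (suc r) b B b≤ bB = trans (V.count-suc b B r) (trans (subst (λ m → ∑ m (V.first b B r) ≡ ∑ m (V′.first b B′ r)) b+k terms) (sym (V′.count-suc b B′ r)))
    where
    N = suc r + b
    B′ = mirror-context N B
    k = suc r ∸ b
    b+k : b + k ≡ suc r
    b+k = m+[n∸m]≡n b≤
    early : ∀ {c} → InRange b c → V.first b B r c ≡ V′.first b B′ r c
    early {suc d} (c≥1 , c≤b) = trans (V.first-low {b} {B} {r} c≥1 c≤b) (trans (count-mirror r d [] (≤-pred (≤-trans c≤b b≤)) [])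
      (sym (V′.first-low {b} {B′} {r} c≥1 c≤b)))
    mirror-index : ∀ {i} → InRange k i → mirror N (b + i) ≡ b + mirror k i
    mirror-index {i} (_ , i≤k) = begin
      suc (suc r + b) ∸ (b + i)   ≡⟨ cong (λ t → suc (t + b) ∸ (b + i)) (sym b+k) ⟩
      suc (b + k + b) ∸ (b + i)   ≡⟨ cong (λ t → suc t ∸ (b + i)) (trans (+-assoc b k b) (cong (b +_) (+-comm k b))) ⟩
      suc (b + (b + k)) ∸ (b + i) ≡⟨ cong (_∸ (b + i)) (sym (+-suc b (b + k))) ⟩
      b + suc (b + k) ∸ (b + i)   ≡⟨ [m+n]∸[m+o]≡n∸o b (suc (b + k)) i ⟩
      suc (b + k) ∸ i             ≡⟨ cong (_∸ i) (sym (+-suc b k)) ⟩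
      b + suc k ∸ i               ≡⟨ +-∸-assoc b (m≤n⇒m≤1+n i≤k) ⟩
      b + (suc k ∸ i)             ∎
      where open ≡-Reasoning
    late : ∀ {c} → b < c → c ≤ suc r → V.first b B r c ≡ V′.first b B′ r (mirror N c)
    -- `event-mirror` allows unrelated orders on its two sides. Used for `w` and for the identity
    -- against the same right side, it shows that the event is the same for all orders; the identity
    -- is only a sample.
    late {c} b<c c≤ = trans (V.first-high e b<c (λ {w} P → trans (event-mirror b<c c≤ bN P I) (sym (event-mirror b<c c≤ bN I I))))
      (trans (compare e) (sym (V′.first-high e b<c′ λ P → sym (event-mirror b<c c≤ bN I P))))
      where
      I : IsPerm r (upto1 r)
      I = ↭upto1⇒IsPerm ↭-refl
      e = V.event b B c (map (bump c) (upto1 r))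
      bN : All (_≤ N) B
      bN = All.map (λ (_ , g≤) → ≤-trans g≤ (m≤m+n (suc r) b)) bB
      b<c′ : b < mirror N c
      b<c′ = ≤-trans (≤-reflexive (sym (m+n∸m≡n (suc r) (suc b)))) (≤-trans (∸-monoʳ-≤ (suc r + suc b) c≤) (≤-reflexive (cong (_∸ c) (+-suc (suc r) b))))
      compare : ∀ e → sumOf (S r) (λ w → indicator (not e ∧ V.good b (V.afterwards c B) w)) ≡
        sumOf (S r) (λ w → indicator (not e ∧ V′.good b (V′.afterwards (mirror N c) B′) w))
      compare true = refl
      compare false = trans (count-mirror r b (V.afterwards c B) (≤-pred (≤-trans b<c c≤)) (afterwards-range b<c c≤ bB))
        (cong (λ t → V′.count b t r) (afterwards-mirror B b<c c≤ bB))
    terms : ∑ (b + k) (V.first b B r) ≡ ∑ (b + k) (V′.first b B′ r)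
    terms = trans (∑-+ b k _) (trans (cong₂ _+_ (∑-cong early)
      (trans (∑-cong λ {i} ri → trans (late (m<m+n b (proj₁ ri)) (≤-trans (+-monoʳ-≤ b (proj₂ ri)) (≤-reflexive b+k))) (cong (V′.first b B′ r) (mirror-index ri)))
        (∑-mirror k (λ i → V′.first b B′ r (b + i))))) (sym (∑-+ b k _)))

valley-mirror : ∀ r₁₁ r₁₂ r₂₁ r₂₂ → valleyShading r₁₁ r₁₂ r₂₁ r₂₂ ~ valleyShading r₁₂ r₁₁ r₂₂ r₂₁
valley-mirror r₁₁ r₁₂ r₂₁ r₂₂ n = trans (counted r₁₁ r₁₂ r₂₁ r₂₂) (trans (count-mirror n n [] ≤-refl []) (sym (counted r₁₂ r₁₁ r₂₂ r₂₁)))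
  where
  open ValleyMirror r₁₁ r₁₂ r₂₁ r₂₂
  counted : ∀ r₁₁ r₁₂ r₂₁ r₂₂ → s n (p12 , valleyShading r₁₁ r₁₂ r₂₁ r₂₂) ≡ Valley.count r₁₁ r₁₂ r₂₁ r₂₂ n [] n
  counted r₁₁ r₁₂ r₂₁ r₂₂ = trans (length-filterᵇ (avoidsᵇ (p12 , R) n) (S n))
    (sumOf-cong (S n) λ {w} w∈ → cong indicator (avoids-good (∈S⇒IsPerm {n} w∈)))
    where open Valley r₁₁ r₁₂ r₂₁ r₂₂

-- The classification

-- The exhaustive check runs over bit vectors, as shadings are functions and can be listed only up
-- to pointwise equality; `~-pointwise` makes up for that.
allVec : ∀ k → (Vec Bool k → Bool) → Bool
allVec zero f = f []
allVec (suc k) f = allVec k (λ v → f (true ∷ v)) ∧ allVec k (λ v → f (false ∷ v))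

allVec⁻ : ∀ k f → allVec k f ≡ true → ∀ v → f v ≡ true
allVec⁻ zero f e [] = e
allVec⁻ (suc k) f e (true ∷ v) = allVec⁻ k (λ v → f (true ∷ v)) (proj₁ (∧-true {allVec k (λ v → f (true ∷ v))} e)) v
allVec⁻ (suc k) f e (false ∷ v) = allVec⁻ k (λ v → f (false ∷ v)) (proj₂ (∧-true {allVec k (λ v → f (true ∷ v))} e)) v

all₃ : (Fin 3 → Bool) → Bool
all₃ f = all f allFin3

all₃⁻ : ∀ f → all₃ f ≡ true → ∀ a → f a ≡ true
all₃⁻ f e a = all-true⁻ f allFin3 e (∈-allFin3 a)

allBoxes : (Fin 3 → Fin 3 → Bool) → Bool
allBoxes f = all₃ λ a → all₃ (f a)

allBoxes⁻ : ∀ f → allBoxes f ≡ true → ∀ a b → f a b ≡ true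
allBoxes⁻ f e a = all₃⁻ (f a) (all₃⁻ (λ c → all₃ (f c)) e a)

_≐ᵇ_ _⊑ᵇ_ : Shading → Shading → Bool
R ≐ᵇ R′ = allBoxes λ a b → if R a b then R′ a b else not (R′ a b)
R ⊑ᵇ R′ = allBoxes λ a b → not (R a b) ∨ R′ a b

≐ᵇ⁻ : ∀ R R′ → (R ≐ᵇ R′) ≡ true → ∀ a b → R a b ≡ R′ a b
≐ᵇ⁻ R R′ e a b with R a b | R′ a b | allBoxes⁻ (λ c d → if R c d then R′ c d else not (R′ c d)) e a b
... | true | true | _ = refl
... | false | false | _ = refl

⊑ᵇ⁻ : ∀ R R′ → (R ⊑ᵇ R′) ≡ true → R ⊑ R′
⊑ᵇ⁻ R R′ e a b f with R a b | R′ a b | allBoxes⁻ (λ c d → not (R c d) ∨ R′ c d) e a b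
... | false | _ | _ = refl
... | true | false | ()

≐⇒~ : ∀ R R′ → (R ≐ᵇ R′) ≡ true → R ~ R′
≐⇒~ R R′ e = ~-pointwise {R} {R′} (≐ᵇ⁻ R R′ e)

implies : ∀ {a b} → not a ∨ b ≡ true → a ≡ true → b ≡ true
implies {true} e refl = e

record Move : Set where
  constructor move
  field
    applies : Shading → Shading → Bool
    sound   : ∀ R R′ → applies R R′ ≡ true → R ~ R′

uniformMove : (target : Shading → Shading) → (∀ R → R ~ target R) → Move
uniformMove target h = move (λ R R′ → target R ≐ᵇ R′) λ R R′ e → ~-trans {R} {target R} {R′} (h R) (≐⇒~ (target R) R′ e)

guardedMove : (guard : Shading → Bool) (target : Shading → Shading) → (∀ R → guard R ≡ true → R ~ target R) → Move
guardedMove guard target h = move (λ R R′ → guard R ∧ (target R ≐ᵇ R′)) λ R R′ e →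
  ~-trans {R} {target R} {R′} (h R (proj₁ (∧-true {guard R} e))) (≐⇒~ (target R) R′ (proj₂ (∧-true {guard R} e)))

shadeMove : Side → Side → Move
shadeMove dx dy = guardedMove guard (shadeBox (near dx) (near dy)) λ R e → sound R e
  where
  guard : Shading → Bool
  guard R = not (R (far dx) (far dy)) ∧ not (R (far dx) (near dy)) ∧
    (not (not (R 2F (near dy))) ∨ not (R 2F (far dy))) ∧
    (not (not (R (near dx) 2F)) ∨ not (R (far dx) 2F))
  sound : ∀ R → guard R ≡ true → R ~ shadeBox (near dx) (near dy) R
  sound R e with ∧-true {not (R (far dx) (far dy))} e
  ... | e₁ , e′ with ∧-true {not (R (far dx) (near dy))} e′
  ... | e₂ , e″ with ∧-true {not (not (R 2F (near dy))) ∨ not (R 2F (far dy))} e″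
  ... | e₃ , e₄ = shading-lemma {R} dx dy (not-true⁻ e₁) (not-true⁻ e₂)
    (λ f → not-true⁻ (implies {not (R 2F (near dy))} e₃ (cong not f)))
    (λ f → not-true⁻ (implies {not (R (near dx) 2F)} e₄ (cong not f)))

-- A family with parameters is recognised by reading the parameters off boxes of `R` and comparing
-- `R` with the member they determine.
schemeMove : (source target : Shading → Shading) → (∀ R → source R ~ target R) → Move
schemeMove source target h = guardedMove (λ R → R ≐ᵇ source R) target λ R e →
  ~-trans {R} {source R} {target R} (≐⇒~ R (source R) e) (h R)

moves : List Move
moves =
    uniformMove transpose ~-transpose
  ∷ uniformMove rotate ~-rotate
  ∷ shadeMove low low ∷ shadeMove low high ∷ shadeMove high low ∷ shadeMove high high
  ∷ guardedMove (λ R → all₃ (R zero)) swapColumns (λ R e → ~-column₀ {R} (all₃⁻ (R zero) e))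
  ∷ guardedMove (λ R → all₃ λ a → R a zero) swapColumns (λ R e → ~-row₀ {R} (all₃⁻ (λ a → R a zero) e))
  ∷ guardedMove (_⊑ᵇ peakShading) (λ _ → empty) (λ R e → ~-empty {R} (⊑ᵇ⁻ R peakShading e))
  ∷ guardedMove (λ R → (corner ⊑ᵇ R) ∧ (R ⊑ᵇ cross)) (λ _ → corner)
      (λ R e → ~-corner {R} (⊑ᵇ⁻ corner R (proj₁ (∧-true {corner ⊑ᵇ R} e))) (⊑ᵇ⁻ R cross (proj₂ (∧-true {corner ⊑ᵇ R} e))))
  ∷ schemeMove (λ R → valleyShading (R 1F 1F) (R 1F 2F) (R 2F 1F) (R 2F 2F))
      (λ R → valleyShading (R 1F 2F) (R 1F 1F) (R 2F 2F) (R 2F 1F))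
      (λ R → valley-mirror (R 1F 1F) (R 1F 2F) (R 2F 1F) (R 2F 2F))
  ∷ schemeMove (λ R → prefixShading (R 1F zero) (R 1F 1F) (R zero 1F))
      (λ R → suffixShading (R 1F zero) (R 1F 1F) (R zero 1F))
      (λ R → prefix~suffix (R 1F zero) (R 1F 1F) (R zero 1F))
  ∷ schemeMove (λ _ → sumShading) (λ _ → blockShading) (λ _ → sumShading~blockShading)
  ∷ schemeMove (λ _ → stepShading) (λ _ → minShading) (λ _ → stepShading~minShading)
  ∷ []

adjacent : Shading → Shading → Bool
adjacent R R′ = any (λ m → Move.applies m R R′ ∨ Move.applies m R′ R) moves

adjacent⁻ : ∀ R R′ → adjacent R R′ ≡ true → R ~ R′
adjacent⁻ R R′ e = found (any-true⁻ (λ m → Move.applies m R R′ ∨ Move.applies m R′ R) moves e)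
  where
  either : ∀ m {b b′} → Move.applies m R R′ ≡ b → Move.applies m R′ R ≡ b′ → b ∨ b′ ≡ true → R ~ R′
  either m {true} e _ _ = Move.sound m R R′ e
  either m {false} {true} _ e _ = ~-sym {R′} {R} (Move.sound m R′ R e)
  found : ∃[ m ] m ∈ moves × Move.applies m R R′ ∨ Move.applies m R′ R ≡ true → R ~ R′
  found (m , _ , e) = either m refl refl e

-- The table of classes and its verification

bit : ℕ → ℕ → Bool
bit n zero = n % 2 ≡ᵇ 1
bit n (suc k) = bit (n / 2) k

-- The box in column a and row b is bit 3a + b of the code.
decode : ℕ → Shading
decode n = shading (bit n 2) (bit n 5) (bit n 8) (bit n 1) (bit n 4) (bit n 7) (bit n 0) (bit n 3) (bit n 6)

encode : Shading → ℕ
encode R = value (R zero zero) 0 + value (R zero 1F) 1 + value (R zero 2F) 2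
  + value (R 1F zero) 3 + value (R 1F 1F) 4 + value (R 1F 2F) 5
  + value (R 2F zero) 6 + value (R 2F 1F) 7 + value (R 2F 2F) 8
  where
  value : Bool → ℕ → ℕ
  value b k = if b then 2 ^ k else 0

-- Within each class every code is adjacent to an earlier one.
classes : List (ℕ × List ℕ)
classes =
    (0 , 1 ∷ 3 ∷ 2 ∷ 8 ∷ 24 ∷ 16 ∷ 18 ∷ 144 ∷ 48 ∷ 32 ∷ 40 ∷ 56 ∷ 146 ∷ 130 ∷ 128 ∷ 9 ∷ 288 ∷ 296 ∷ 41 ∷ 25 ∷
     19 ∷ 400 ∷ 304 ∷ 312 ∷ 57 ∷ 147 ∷ 402 ∷ 384 ∷ 386 ∷ 131 ∷ 129 ∷ 33 ∷ 264 ∷ 256 ∷ 257 ∷ 259 ∷ 258 ∷ 265 ∷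
     137 ∷ 35 ∷ 392 ∷ 290 ∷ 408 ∷ 51 ∷ 153 ∷ 297 ∷ 387 ∷ 385 ∷ 289 ∷ 306 ∷ 272 ∷ 17 ∷ 280 ∷ 49 ∷ 145 ∷ 274 ∷
     34 ∷ 136 ∷ 152 ∷ 50 ∷ 291 ∷ 393 ∷ [])
  ∷ (4 , 5 ∷ 7 ∷ 6 ∷ 72 ∷ 36 ∷ 37 ∷ 39 ∷ 38 ∷ 200 ∷ 192 ∷ 193 ∷ 195 ∷ 45 ∷ 360 ∷ 352 ∷ 13 ∷ 67 ∷ 66 ∷ 12 ∷ 96 ∷
     64 ∷ 65 ∷ 260 ∷ 261 ∷ 263 ∷ 262 ∷ 328 ∷ 320 ∷ 321 ∷ 329 ∷ 105 ∷ 135 ∷ 23 ∷ 89 ∷ 201 ∷ 294 ∷ 292 ∷ 73 ∷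
     293 ∷ 295 ∷ 457 ∷ 121 ∷ 151 ∷ 466 ∷ 316 ∷ 300 ∷ 450 ∷ 448 ∷ 449 ∷ 451 ∷ 301 ∷ 361 ∷ 391 ∷ 55 ∷ 217 ∷ 310 ∷
     472 ∷ 456 ∷ 464 ∷ 308 ∷ 389 ∷ 323 ∷ 269 ∷ 353 ∷ 322 ∷ 133 ∷ 97 ∷ 268 ∷ 80 ∷ 20 ∷ 88 ∷ 22 ∷ 208 ∷ 52 ∷ 60 ∷
     44 ∷ 104 ∷ 134 ∷ 132 ∷ 194 ∷ 120 ∷ 112 ∷ 28 ∷ 82 ∷ 148 ∷ 150 ∷ 210 ∷ 184 ∷ 58 ∷ 154 ∷ 178 ∷ 168 ∷ 42 ∷
     138 ∷ 162 ∷ 216 ∷ 54 ∷ 81 ∷ 21 ∷ 336 ∷ 276 ∷ 344 ∷ 53 ∷ 209 ∷ 278 ∷ 113 ∷ 149 ∷ 338 ∷ 284 ∷ 388 ∷ 390 ∷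
     416 ∷ 11 ∷ 432 ∷ 27 ∷ [])
  ∷ (10 , 160 ∷ 176 ∷ 26 ∷ [])
  ∷ (14 , 74 ∷ 164 ∷ 166 ∷ 202 ∷ 46 ∷ 232 ∷ 224 ∷ 240 ∷ 30 ∷ 90 ∷ 180 ∷ 248 ∷ 62 ∷ 218 ∷ 182 ∷ [])
  ∷ (15 , 71 ∷ 70 ∷ 76 ∷ 100 ∷ 101 ∷ 197 ∷ 196 ∷ 198 ∷ 108 ∷ 199 ∷ 31 ∷ 91 ∷ 203 ∷ 47 ∷ 327 ∷ 326 ∷ 332 ∷ 333 ∷
     109 ∷ 364 ∷ 356 ∷ 77 ∷ 357 ∷ 453 ∷ 452 ∷ 454 ∷ 455 ∷ 63 ∷ 219 ∷ 438 ∷ 504 ∷ 488 ∷ 422 ∷ 420 ∷ 75 ∷ 436 ∷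
     496 ∷ 480 ∷ 365 ∷ [])
  ∷ (29 , 83 ∷ 404 ∷ 368 ∷ 376 ∷ 61 ∷ 211 ∷ 406 ∷ 440 ∷ 59 ∷ 155 ∷ 434 ∷ 424 ∷ 43 ∷ 139 ∷ 418 ∷ [])
  ∷ (68 , 69 ∷ 324 ∷ 325 ∷ [])
  ∷ (78 , 228 ∷ 229 ∷ 231 ∷ 230 ∷ 206 ∷ 110 ∷ 236 ∷ 252 ∷ 126 ∷ 222 ∷ 246 ∷ 244 ∷ 94 ∷ 237 ∷ 349 ∷ 343 ∷ 175 ∷
     235 ∷ 347 ∷ 287 ∷ 497 ∷ 437 ∷ 430 ∷ 490 ∷ 469 ∷ 373 ∷ 366 ∷ 462 ∷ 334 ∷ [])
  ∷ (79 , 484 ∷ 485 ∷ 335 ∷ 111 ∷ 207 ∷ 95 ∷ 500 ∷ 508 ∷ 127 ∷ 223 ∷ 502 ∷ 463 ∷ 367 ∷ 493 ∷ 381 ∷ 471 ∷ 191 ∷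
     251 ∷ 446 ∷ 506 ∷ 475 ∷ 319 ∷ 487 ∷ 486 ∷ 492 ∷ 505 ∷ 439 ∷ [])
  ∷ (84 , [])
  ∷ (85 , 340 ∷ [])
  ∷ (86 , 92 ∷ 116 ∷ 124 ∷ 214 ∷ 212 ∷ [])
  ∷ (87 , 93 ∷ 205 ∷ 103 ∷ 102 ∷ 204 ∷ 271 ∷ 331 ∷ 107 ∷ 143 ∷ 482 ∷ 428 ∷ 444 ∷ 123 ∷ 159 ∷ 215 ∷ 125 ∷ 380 ∷
     372 ∷ 468 ∷ 470 ∷ 461 ∷ 359 ∷ 303 ∷ 459 ∷ 423 ∷ 311 ∷ 473 ∷ 249 ∷ 183 ∷ 407 ∷ 377 ∷ 317 ∷ 467 ∷ 489 ∷ 474 ∷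
     318 ∷ 421 ∷ 481 ∷ 358 ∷ 460 ∷ 498 ∷ [])
  ∷ (98 , 140 ∷ [])
  ∷ (99 , 141 ∷ 354 ∷ 396 ∷ 417 ∷ 267 ∷ [])
  ∷ (106 , 142 ∷ 226 ∷ 172 ∷ 188 ∷ 122 ∷ 158 ∷ 242 ∷ [])
  ∷ (114 , 156 ∷ [])
  ∷ (115 , 157 ∷ 370 ∷ 412 ∷ 425 ∷ 299 ∷ 395 ∷ 419 ∷ 409 ∷ 307 ∷ [])
  ∷ (117 , 213 ∷ 342 ∷ 348 ∷ [])
  ∷ (118 , 220 ∷ 362 ∷ 173 ∷ 227 ∷ 398 ∷ 433 ∷ 283 ∷ [])
  ∷ (119 , 221 ∷ 374 ∷ 476 ∷ 399 ∷ 363 ∷ 429 ∷ 483 ∷ [])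
  ∷ (161 , 266 ∷ [])
  ∷ (163 , 169 ∷ 281 ∷ 275 ∷ 401 ∷ 305 ∷ 298 ∷ 394 ∷ [])
  ∷ (165 , 167 ∷ 233 ∷ 302 ∷ 458 ∷ 345 ∷ 279 ∷ 465 ∷ 309 ∷ 225 ∷ 270 ∷ 330 ∷ [])
  ∷ (170 , [])
  ∷ (171 , 426 ∷ [])
  ∷ (174 , 234 ∷ [])
  ∷ (177 , 282 ∷ [])
  ∷ (179 , 185 ∷ 313 ∷ 403 ∷ 314 ∷ 410 ∷ [])
  ∷ (181 , 241 ∷ 286 ∷ 346 ∷ [])
  ∷ (186 , [])
  ∷ (187 , 442 ∷ [])
  ∷ (189 , 243 ∷ 414 ∷ 378 ∷ 441 ∷ 315 ∷ 411 ∷ 435 ∷ [])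
  ∷ (190 , 250 ∷ [])
  ∷ (238 , [])
  ∷ (239 , 351 ∷ 501 ∷ 494 ∷ [])
  ∷ (245 , 350 ∷ [])
  ∷ (247 , 253 ∷ 382 ∷ 478 ∷ 477 ∷ 375 ∷ 431 ∷ 491 ∷ 379 ∷ 415 ∷ 499 ∷ 445 ∷ [])
  ∷ (254 , [])
  ∷ (255 , 479 ∷ 383 ∷ 495 ∷ 509 ∷ 503 ∷ 447 ∷ 507 ∷ 510 ∷ [])
  ∷ (273 , [])
  ∷ (277 , 337 ∷ [])
  ∷ (285 , 339 ∷ 405 ∷ 369 ∷ [])
  ∷ (341 , [])
  ∷ (355 , 397 ∷ [])
  ∷ (371 , 413 ∷ [])
  ∷ (427 , [])
  ∷ (443 , [])
  ∷ (511 , [])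
  ∷ []

connected : List ℕ → List ℕ → Bool
connected seen [] = true
connected seen (c ∷ cs) = any (λ d → adjacent (decode d) (decode c)) seen ∧ connected (c ∷ seen) cs

connected⁻ : ∀ {r} seen cs → (∀ {c} → c ∈ seen → decode r ~ decode c) → connected seen cs ≡ true →
  ∀ {c} → c ∈ cs → decode r ~ decode c
connected⁻ {r} seen (c ∷ cs) linked e {d} d∈ with ∧-true {any (λ d → adjacent (decode d) (decode c)) seen} {connected (c ∷ seen) cs} e
... | e₁ , e₂ with any-true⁻ (λ d → adjacent (decode d) (decode c)) seen e₁
... | b , b∈ , e₃ = reach d∈
  where
  link : decode r ~ decode c
  link = ~-trans {decode r} {decode b} {decode c} (linked b∈) (adjacent⁻ (decode b) (decode c) e₃)
  linked′ : ∀ {x} → x ∈ c ∷ seen → decode r ~ decode x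
  linked′ (here refl) = link
  linked′ (there x∈) = linked x∈
  reach : d ∈ c ∷ cs → decode r ~ decode d
  reach (here refl) = link
  reach (there p) = connected⁻ {r} (c ∷ seen) cs (λ {x} → linked′ {x}) e₂ p

classConnected : ℕ × List ℕ → Bool
classConnected (r , cs) = connected (r ∷ []) cs

classes-connected : all classConnected classes ≡ true
classes-connected = refl

inClass : ℕ → ℕ × List ℕ → Bool
inClass n (r , cs) = any (n ≡ᵇ_) (r ∷ cs)

fromVec : Vec Bool 9 → Shading
fromVec (t₀ ∷ t₁ ∷ t₂ ∷ m₀ ∷ m₁ ∷ m₂ ∷ b₀ ∷ b₁ ∷ b₂ ∷ []) = shading t₀ t₁ t₂ m₀ m₁ m₂ b₀ b₁ b₂

toVec : Shading → Vec Bool 9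
toVec R = R zero 2F ∷ R 1F 2F ∷ R 2F 2F
  ∷ R zero 1F ∷ R 1F 1F ∷ R 2F 1F
  ∷ R zero zero ∷ R 1F zero ∷ R 2F zero ∷ []

fromVec-toVec : ∀ R a b → R a b ≡ fromVec (toVec R) a b
fromVec-toVec R zero zero = refl
fromVec-toVec R zero 1F = refl
fromVec-toVec R zero 2F = refl
fromVec-toVec R 1F zero = refl
fromVec-toVec R 1F 1F = refl
fromVec-toVec R 1F 2F = refl
fromVec-toVec R 2F zero = refl
fromVec-toVec R 2F 1F = refl
fromVec-toVec R 2F 2F = refl

-- That decoding inverts encoding is evaluated for each shading, together with the presence of its
-- code in the table.
classified : Shading → Bool
classified R = (R ≐ᵇ decode (encode R)) ∧ any (inClass (encode R)) classes

all-classified : allVec 9 (λ v → classified (fromVec v)) ≡ true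
all-classified = refl

representative : ℕ × List ℕ → MeshPattern
representative (r , _) = p12 , decode r

representatives : List MeshPattern
representatives = map representative classes

class-~ : ∀ {r cs c} → (r , cs) ∈ classes → c ∈ r ∷ cs → decode r ~ decode c
class-~ {r} _ (here refl) = ~-refl {decode r}
class-~ {r} {cs} class∈ (there p) = connected⁻ {r} (r ∷ []) cs (λ { (here refl) → ~-refl {decode r} })
  (all-true⁻ classConnected classes classes-connected class∈) p

decode-represented : ∀ {n} → any (inClass n) classes ≡ true → Any (WilfEquivalent (p12 , decode n)) representatives
decode-represented {n} e = find-class (any-true⁻ (inClass n) classes e)
  where
  find-class : ∃[ k ] k ∈ classes × inClass n k ≡ true → Any (WilfEquivalent (p12 , decode n)) representatives
  find-class ((r , cs) , class∈ , e′) = find-code (any-true⁻ (n ≡ᵇ_) (r ∷ cs) e′)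
    where
    find-code : ∃[ c ] c ∈ r ∷ cs × (n ≡ᵇ c) ≡ true → Any (WilfEquivalent (p12 , decode n)) representatives
    find-code (c , c∈ , e″) = lose {P = WilfEquivalent (p12 , decode n)} (∈-map⁺ representative {xs = classes} class∈)
      (subst (λ m → decode m ~ decode r) (sym (≡ᵇ⇒≡ n c (≡⇒T e″))) (~-sym {decode r} {decode c} (class-~ class∈ c∈)))

classify : ∀ R → Any (WilfEquivalent (p12 , R)) representatives
classify R = Any.map {P = WilfEquivalent (p12 , decode n)} {Q = WilfEquivalent (p12 , R)}
  (λ e k → trans (~-pointwise {R} {R′} (fromVec-toVec R) k) (trans (≐⇒~ R′ (decode n) (proj₁ both) k) (e k)))
  (decode-represented {n} (proj₂ both))
  where
  R′ = fromVec (toVec R)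
  n = encode R′
  both : (R′ ≐ᵇ decode n) ≡ true × any (inClass n) classes ≡ true
  both = ∧-true (allVec⁻ 9 (λ v → classified (fromVec v)) all-classified (toVec R))

theorem1p1 : Σ (List MeshPattern) (λ L → (length L ≤ 49) × ((p : MeshPattern) → Any (WilfEquivalent p) L))
theorem1p1 = representatives , ≤ᵇ⇒≤ 49 49 tt , covered
  where
  covered : (p : MeshPattern) → Any (WilfEquivalent p) representatives
  covered (p12 , R) = classify R
  covered (p21 , R) = Any.map {P = WilfEquivalent (p12 , reflect R)} {Q = WilfEquivalent (p21 , R)}
    (λ e n → trans (wilf-reflect R n) (e n)) (classify (reflect R))
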